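{- Let $\pi,\sigma,\tau\in\mathfrak{B}_n$ be selected independently and uniformly at random, and let $p_{n,3}:=\mathbb{P}(\pi,\sigma,\tau\text{ are comparable})$ and $p_{n,3,\le}:=\mathbb{P}(\pi\le\sigma\le\tau)$, with respect to Bruhat order. Then for $n\ge 2$, $$p_{n,3}=\frac{(n^2+4n+6)\,\mathfrak{b}_{n+3}\mathfrak{b}_{n+6}-42(n+6)(n+7)\,\mathfrak{b}_{n+2}+420(n+6)(n+7)}{70(n+6)(n+7)\,\mathfrak{b}_n^2}$$ and $$p_{n,3,\le}=\frac{(n^2+4n+6)\,\mathfrak{b}_{n+3}\mathfrak{b}_{n+6}}{420(n+6)(n+7)\,\mathfrak{b}_n^2}.$$
   Context: $\mathfrak{S}_n$ is the set of permutations of $[n]=\{1,\dots,n\}$, in one-line notation. A reduction of $\omega\in\mathfrak{S}_n$ interchanges $\omega(i)$ and $\omega(j)$ for some $i<j$ with $\omega(i)>\omega(j)$. Bruhat order: $\pi\le\sigma$ if $\pi$ is obtained from $\sigma$ by a (possibly empty) sequence of reductions. $\mathfrak{B}_n\subseteq\mathfrak{S}_n$ is the set of bigrassmannian permutations, i.e. those $\omega$ such that both $\omega$ and $\omega^{ -1}$ have exactly one descent (a descent of $\omega$ is an $i\in\{1,\dots,n-1\}$ with $\omega(i)>\omega(i+1)$); equivalently $\omega=1\cdots a\,(b+1)\cdots c\,(a+1)\cdots b\,(c+1)\cdots n$ for some $0\le a<b<c\le n$. For each $m\ge 1$, $\mathfrak{b}_m=|\mathfrak{B}_m|=\binom{m+1}{3}$.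 Elements $\pi_1,\dots,\pi_r\in\mathfrak{B}_n$ (not necessarily distinct) are comparable if there is a permutation $\phi$ of $\{1,\dots,r\}$ with $\pi_{\phi(1)}\le\cdots\le\pi_{\phi(r)}$.
   Formalization: The last numerator term of the formula for p_{n,3} is 70(n+6)(n+7) instead of the printed 420(n+6)(n+7); the printed formula is false (at n=2 it gives 6, while the probability is 1). The formula for p_{n,3,≤} is as printed. -}

module Defs where

open import Data.Fin.Base using (Fin; zero; suc; toℕ; punchIn; _<_; _>_)
open import Data.Fin.Induction using (<-wellFounded)
open import Data.Fin.Permutation as Perm
  using (Permutation′; _⟨$⟩ʳ_; _⟨$⟩ˡ_; _≈_; _∘ₚ_; flip; transpose; insert; remove; insert-remove;
         inverseˡ; inverseʳ)
open import Data.Fin.Properties as Fin using (_≟_; _<?_; any?; all?; punchIn-injective)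
open import Data.Integer.Base using (+_)
open import Data.List.Base
  using (List; []; _∷_; length; filter; map; allFin; tabulate; cartesianProduct; cartesianProductWith)
open import Data.List.Membership.Propositional.Properties using (∈-allFin)
open import Data.List.Membership.Setoid.Properties
  using (∈-cartesianProductWith⁺; ∈-filter⁺; ∈-length)
open import Data.List.Properties using (length-++; length-map; tabulate-cong)
open import Data.List.Relation.Unary.All using ([])
open import Data.List.Relation.Unary.AllPairs using ([]; _∷_)
open import Data.List.Relation.Unary.Any as Any using (here)
open import Data.List.Relation.Unary.Enumerates.Setoid using (IsEnumeration)
open import Data.List.Relation.Unary.Linked using (Linked; linked?)
open import Data.List.Relation.Unary.Unique.Propositional.Properties using (allFin⁺)
open import Data.List.Relation.Unary.Unique.Setoid using (Unique)
open import Data.List.Relation.Unary.Unique.Setoid.Properties using (cartesianProductWith⁺)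
open import Data.Nat.Base using (ℕ; zero; suc; _+_; _*_; _^_; _≥_; NonZero; >-nonZero; z≤n; s≤s)
import Data.Nat.Base as Nat
import Data.Nat.Properties as ℕ
open import Data.Product
  using (∃; ∃₂; ∃!; _×_; _,_; proj₁; proj₂)
open import Data.Rational.Base using (ℚ; _/_)
open import Data.Vec.Base as Vec using (Vec; []; _∷_; lookup)
open import Data.Vec.Relation.Binary.Lex.Strict as Lex using (Lex-<; this; next)
open import Function.Base using (_∘_)
open import Induction.WellFounded using (Acc; acc; WellFounded)
open import Level using (0ℓ)
open import Relation.Binary.Bundles using (Setoid)
open import Relation.Binary.Construct.Closure.ReflexiveTransitive using (Star; ε; _◅_)
import Relation.Binary.Construct.On as On
open import Relation.Binary.Definitions using () renaming (Decidable to Decidable₂)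
open import Relation.Binary.PropositionalEquality
  using (_≡_; refl; sym; trans; cong; cong₂; subst; subst₂; module ≡-Reasoning)
import Relation.Binary.PropositionalEquality.Properties as ≡
open import Relation.Nullary using (¬_; Dec; yes; no; contradiction)
open import Relation.Nullary.Decidable using (map′; _×-dec_; _→-dec_; dec-yes; dec-no)
open import Relation.Unary using (Pred; Decidable)

private
  variable
    n r : ℕ

-- The symbols 1,…,n of [n] are the elements 0,…,n-1 of Fin n, and ω(i) is
-- ω ⟨$⟩ʳ i.  A permutation also carries its inverse and proofs, so 𝔖 n is
-- considered up to the pointwise equality _≈_ throughout.

𝔖 : ℕ → Set
𝔖 = Permutation′

𝔖-setoid : ℕ → Setoid 0ℓ 0ℓ
𝔖-setoid n = record
  { Carrier       = 𝔖 n
  ; _≈_           = _≈_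
  ; isEquivalence = record
    { refl  = λ _ → refl
    ; sym   = λ p i → sym (p i)
    ; trans = λ p q i → trans (p i) (q i)
    }
  }

_≈?_ : Decidable₂ (_≈_ {n} {n})
π ≈? σ = all? λ i → (π ⟨$⟩ʳ i) ≟ (σ ⟨$⟩ʳ i)

permutations : ∀ n → List (𝔖 n)
permutations zero    = Perm.id ∷ []
permutations (suc n) = cartesianProductWith (insert zero) (allFin (suc n)) (permutations n)

insert-cong : ∀ {i j : Fin (suc n)} {π σ : 𝔖 n} → i ≡ j → π ≈ σ → insert zero i π ≈ insert zero j σ
insert-cong refl π≈σ zero    = refl
insert-cong {i = i} refl π≈σ (suc k) = cong (punchIn i) (π≈σ k)

insert-injective : ∀ {i j : Fin (suc n)} {π σ : 𝔖 n} →
                   insert zero i π ≈ insert zero j σ → i ≡ j × π ≈ σ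
insert-injective {i = i} {π = π} {σ} eq with refl ← eq zero =
  refl , λ k → punchIn-injective i _ _ (eq (suc k))

permutations-complete : ∀ n → IsEnumeration (𝔖-setoid n) (permutations n)
permutations-complete zero    π = here λ ()
permutations-complete (suc n) π =
  Any.map (λ eq k → trans (sym (insert-remove zero π k)) (eq k))
    (∈-cartesianProductWith⁺ (≡.setoid (Fin (suc n))) (𝔖-setoid n) (𝔖-setoid (suc n))
      (λ {i} {j} {π} {σ} → insert-cong {i = i} {j} {π} {σ})
      (∈-allFin (π ⟨$⟩ʳ zero)) (permutations-complete n (remove zero π)))

permutations-unique : ∀ n → Unique (𝔖-setoid n) (permutations n)
permutations-unique zero    = [] ∷ []
permutations-unique (suc n) =
  cartesianProductWith⁺ (≡.setoid (Fin (suc n))) (𝔖-setoid n) (𝔖-setoid (suc n))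
    (insert zero) (λ {i} {j} {π} {σ} → insert-injective {i = i} {j} {π} {σ})
    (allFin⁺ (suc n)) (permutations-unique n)

infix 4 _⟶_ _≤ᴮ_ _≤ᴮ?_

-- transpose i j ∘ₚ σ is k ↦ σ(transpose i j k): the entries in positions i
-- and j are interchanged.
data _⟶_ {n} (σ : 𝔖 n) : 𝔖 n → Set where
  reduce : ∀ {i j} → i < j → σ ⟨$⟩ʳ i > σ ⟨$⟩ʳ j → σ ⟶ transpose i j ∘ₚ σ

_≤ᴮ_ : 𝔖 n → 𝔖 n → Set
π ≤ᴮ σ = ∃ λ ρ → Star _⟶_ σ ρ × ρ ≈ π

-- A reduction makes the one-line notation lexicographically smaller, so the
-- search for a sequence of reductions terminates.

private
  word : 𝔖 n → Vec (Fin n) n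
  word σ = Vec.tabulate (σ ⟨$⟩ʳ_)

  _≺_ : 𝔖 n → 𝔖 n → Set
  σ ≺ τ = Lex-< _≡_ _<_ (word σ) (word τ)

  ≺-wellFounded : WellFounded (_≺_ {n})
  ≺-wellFounded =
    On.wellFounded word (Lex.<-wellFounded trans (λ { refl p → p }) <-wellFounded)

  tabulate-< : ∀ {m} (f g : Fin m → Fin n) i → (∀ k → k < i → f k ≡ g k) → f i < g i →
               Lex-< _≡_ _<_ (Vec.tabulate f) (Vec.tabulate g)
  tabulate-< f g zero    eq lt = this lt refl
  tabulate-< f g (suc i) eq lt =
    next (eq zero (s≤s z≤n))
      (tabulate-< (f ∘ suc) (g ∘ suc) i (λ k k<i → eq (suc k) (s≤s k<i)) lt)

  transpose-i : ∀ (i j : Fin n) → transpose i j ⟨$⟩ʳ i ≡ j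
  transpose-i i j rewrite proj₂ (dec-yes (i ≟ i) refl) = refl

  transpose-< : ∀ {i j k : Fin n} → i < j → k < i → transpose i j ⟨$⟩ʳ k ≡ k
  transpose-< {i = i} {j} {k} i<j k<i
    rewrite dec-no (k ≟ i) (Fin.<⇒≢ k<i)
          | dec-no (k ≟ j) (Fin.<⇒≢ (Fin.<-trans k<i i<j)) = refl

  reduction-≺ : ∀ (σ : 𝔖 n) {i j} → i < j → σ ⟨$⟩ʳ i > σ ⟨$⟩ʳ j → (transpose i j ∘ₚ σ) ≺ σ
  reduction-≺ σ {i} {j} i<j σi>σj = tabulate-< _ _ i
    (λ k k<i → cong (σ ⟨$⟩ʳ_) (transpose-< i<j k<i))
    (subst (λ x → σ ⟨$⟩ʳ x < σ ⟨$⟩ʳ i) (sym (transpose-i i j)) σi>σj)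

  search : ∀ (π σ : 𝔖 n) → Acc _≺_ σ → Dec (π ≤ᴮ σ)
  search {n} π σ (acc smaller) with σ ≈? π
  ... | yes σ≈π = yes (σ , ε , σ≈π)
  ... | no  σ≉π = map′ to from (any? λ i → any? λ j → below? i j)
    where
    Below : Fin n → Fin n → Set
    Below i j = i < j × σ ⟨$⟩ʳ i > σ ⟨$⟩ʳ j × π ≤ᴮ (transpose i j ∘ₚ σ)

    below? : ∀ i j → Dec (Below i j)
    below? i j with i <? j | (σ ⟨$⟩ʳ j) <? (σ ⟨$⟩ʳ i)
    ... | no  i≮j | _      = no λ (i<j , _) → i≮j i<j
    ... | yes _   | no  ≯  = no λ (_ , σi>σj , _) → ≯ σi>σj
    ... | yes i<j | yes σi>σj =
      map′ (λ p → i<j , σi>σj , p) (λ (_ , _ , p) → p)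
        (search π (transpose i j ∘ₚ σ) (smaller (reduction-≺ σ i<j σi>σj)))

    to : ∃₂ Below → π ≤ᴮ σ
    to (i , j , i<j , σi>σj , ρ , steps , ρ≈π) = ρ , reduce i<j σi>σj ◅ steps , ρ≈π

    from : π ≤ᴮ σ → ∃₂ Below
    from (ρ , ε , ρ≈π) = contradiction ρ≈π σ≉π
    from (ρ , reduce i<j σi>σj ◅ steps , ρ≈π) = _ , _ , i<j , σi>σj , ρ , steps , ρ≈π

_≤ᴮ?_ : Decidable₂ (_≤ᴮ_ {n})
π ≤ᴮ? σ = search π σ (≺-wellFounded σ)

Descent : 𝔖 n → Fin n → Set
Descent ω i = ∃ λ j → toℕ j ≡ suc (toℕ i) × ω ⟨$⟩ʳ i > ω ⟨$⟩ʳ j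

Bigrassmannian : Pred (𝔖 n) 0ℓ
Bigrassmannian ω = ∃! _≡_ (Descent ω) × ∃! _≡_ (Descent (flip ω))

descent? : ∀ (ω : 𝔖 n) → Decidable (Descent ω)
descent? ω i = any? λ j → (toℕ j ℕ.≟ suc (toℕ i)) ×-dec ((ω ⟨$⟩ʳ j) <? (ω ⟨$⟩ʳ i))

bigrassmannian? : Decidable (Bigrassmannian {n})
bigrassmannian? ω = oneDescent? ω ×-dec oneDescent? (flip ω)
  where
  oneDescent? : ∀ (ω : 𝔖 n) → Dec (∃! _≡_ (Descent ω))
  oneDescent? ω = any? λ i → descent? ω i ×-dec
    map′ (λ f {j} → f j) (λ f j → f {j}) (all? λ j → descent? ω j →-dec (i ≟ j))

𝔅 : ∀ n → List (𝔖 n)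
𝔅 n = filter bigrassmannian? (permutations n)

𝔟 : ℕ → ℕ
𝔟 n = length (𝔅 n)

Comparable : Vec (𝔖 n) r → Set
Comparable {r = r} πs =
  ∃ λ (φ : 𝔖 r) → Linked _≤ᴮ_ (tabulate λ i → lookup πs (φ ⟨$⟩ʳ i))

comparable? : Decidable (Comparable {n} {r})
comparable? {n} {r} πs = map′ Any.satisfied complete
  (Any.any? (λ φ → linked? _≤ᴮ?_ (chain φ)) (permutations r))
  where
  chain : 𝔖 r → List (𝔖 n)
  chain φ = tabulate λ i → lookup πs (φ ⟨$⟩ʳ i)

  complete : Comparable πs → Any.Any (Linked _≤ᴮ_ ∘ chain) (permutations r)
  complete (φ , linked) = Any.map
    (λ φ≈ψ → subst (Linked _≤ᴮ_) (tabulate-cong λ i → cong (lookup πs) (φ≈ψ i)) linked)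
    (permutations-complete r φ)

-- For n ≥ 2 the permutation 213⋯n is bigrassmannian, so the probabilities
-- below are well defined.

private
  Descent-resp : ∀ {π σ : 𝔖 n} → π ≈ σ → ∀ {i} → Descent π i → Descent σ i
  Descent-resp π≈σ {i} (j , eq , gt) = j , eq , subst₂ _<_ (π≈σ j) (π≈σ i) gt

  ∃!-Descent-resp : ∀ {π σ : 𝔖 n} → π ≈ σ → ∃! _≡_ (Descent π) → ∃! _≡_ (Descent σ)
  ∃!-Descent-resp {π = π} {σ} π≈σ (i , d , unique) =
    i , Descent-resp {π = π} {σ} π≈σ d ,
    unique ∘ Descent-resp {π = σ} {π} (λ k → sym (π≈σ k))

  flip-resp : ∀ {π σ : 𝔖 n} → π ≈ σ → flip π ≈ flip σ
  flip-resp {π = π} {σ} π≈σ k = begin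
    π ⟨$⟩ˡ k                       ≡⟨ cong (π ⟨$⟩ˡ_) (inverseʳ σ) ⟨
    π ⟨$⟩ˡ (σ ⟨$⟩ʳ (σ ⟨$⟩ˡ k))     ≡⟨ cong (π ⟨$⟩ˡ_) (π≈σ _) ⟨
    π ⟨$⟩ˡ (π ⟨$⟩ʳ (σ ⟨$⟩ˡ k))     ≡⟨ inverseˡ π ⟩
    σ ⟨$⟩ˡ k                       ∎
    where open ≡-Reasoning

  Bigrassmannian-resp : ∀ {π σ : 𝔖 n} → π ≈ σ → Bigrassmannian π → Bigrassmannian σ
  Bigrassmannian-resp {π = π} {σ} π≈σ (d , d⁻¹) =
    ∃!-Descent-resp {π = π} {σ} π≈σ d ,
    ∃!-Descent-resp {π = flip π} {flip σ} (flip-resp {π = π} {σ} π≈σ) d⁻¹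

  module _ (m : ℕ) where
    s : 𝔖 (2 + m)
    s = transpose zero (suc zero)

    s-descent : ∃! _≡_ (Descent s)
    s-descent = zero , (suc zero , refl , s≤s z≤n) , unique _
      where
      unique : ∀ i → Descent s i → zero ≡ i
      unique zero d = refl
      unique (suc zero) (suc (suc j) , eq , ())
      unique (suc (suc i)) (suc (suc j) , eq , gt) =
        contradiction (subst (Nat._< toℕ (suc (suc i))) eq gt)
          (ℕ.<⇒≯ (ℕ.n<1+n _))

    s⁻¹≈s : s ≈ flip s
    s⁻¹≈s zero          = refl
    s⁻¹≈s (suc zero)    = refl
    s⁻¹≈s (suc (suc k)) = refl

    s-bigrassmannian : Bigrassmannian s
    s-bigrassmannian = s-descent , ∃!-Descent-resp {π = s} {flip s} s⁻¹≈s s-descent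

  length-cartesianProduct : ∀ {A B : Set} (xs : List A) (ys : List B) →
                            length (cartesianProduct xs ys) ≡ length xs * length ys
  length-cartesianProduct []       ys = refl
  length-cartesianProduct (x ∷ xs) ys =
    trans (length-++ (map (x ,_) ys))
      (cong₂ _+_ (length-map _ ys) (length-cartesianProduct xs ys))

𝔟-nonZero : n ≥ 2 → NonZero (𝔟 n)
𝔟-nonZero {suc (suc m)} _ = >-nonZero (∈-length S {x = s m} {xs = 𝔅 (2 + m)}
  (∈-filter⁺ S bigrassmannian? (λ {π} {σ} → Bigrassmannian-resp {π = π} {σ})
    {v = s m} {xs = permutations (2 + m)} (permutations-complete (2 + m) (s m)) (s-bigrassmannian m)))
  where S = 𝔖-setoid (2 + m)
𝔟-nonZero {suc zero} (s≤s ())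

denominator-nonZero : ∀ k .{{k≢0 : NonZero k}} → n ≥ 2 →
                      NonZero (k * (n + 6) * (n + 7) * 𝔟 n ^ 2)
denominator-nonZero {n} k {{k≢0}} 2≤n =
  ℕ.m*n≢0 (k * (n + 6) * (n + 7)) (𝔟 n ^ 2)
    {{ℕ.m*n≢0 (k * (n + 6)) (n + 7) {{ℕ.m*n≢0 k (n + 6) {{k≢0}} {{+-nonZero 5}}}} {{+-nonZero 6}}}}
    {{ℕ.m^n≢0 (𝔟 n) 2 {{𝔟-nonZero 2≤n}}}}
  where
  +-nonZero : ∀ l → NonZero (n + suc l)
  +-nonZero l = subst NonZero (sym (ℕ.+-suc n l)) _

ℙ : ∀ {A : Set} {P : Pred A 0ℓ} (xs : List A) .{{_ : NonZero (length xs)}} → Decidable P → ℚ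
ℙ xs P? = + length (filter P? xs) / length xs

-- Independent uniform choices of π, σ, τ amount to a uniform choice of (π , σ , τ).

𝔅³ : ∀ n → List (𝔖 n × 𝔖 n × 𝔖 n)
𝔅³ n = cartesianProduct (𝔅 n) (cartesianProduct (𝔅 n) (𝔅 n))

𝔅³-nonZero : n ≥ 2 → NonZero (length (𝔅³ n))
𝔅³-nonZero {n} 2≤n
  rewrite length-cartesianProduct (𝔅 n) (cartesianProduct (𝔅 n) (𝔅 n))
        | length-cartesianProduct (𝔅 n) (𝔅 n)
  = ℕ.m*n≢0 (𝔟 n) (𝔟 n * 𝔟 n) {{b}} {{ℕ.m*n≢0 (𝔟 n) (𝔟 n) {{b}} {{b}}}}
  where b = 𝔟-nonZero 2≤n

p₃ : ∀ n → n ≥ 2 → ℚ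
p₃ n 2≤n = ℙ (𝔅³ n) {{𝔅³-nonZero 2≤n}} λ (π , σ , τ) → comparable? (π ∷ σ ∷ τ ∷ [])

p₃≤ : ∀ n → n ≥ 2 → ℚ
p₃≤ n 2≤n = ℙ (𝔅³ n) {{𝔅³-nonZero 2≤n}} λ (π , σ , τ) → (π ≤ᴮ? σ) ×-dec (σ ≤ᴮ? τ)

{-# OPTIONS --safe #-}

-- A bigrassmannian permutation of [n] is determined by the lengths a, 1 + x,
-- 1 + y, z of its four blocks, and π ≤ π′ holds in Bruhat order exactly when
-- a ≥ a′, z ≥ z′, x ≤ x′ and y ≤ y′: bounds v ≤ i + const, v ≥ i - const and
-- "i is fixed" on the entries v = ω(i) survive every reduction, and conversely
-- one unit can be moved from x or y to a or z by a sequence of reductions that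
-- all involve one position.  A chain of r such quadruples is given by a and z
-- of its largest and x and y of its smallest member together with r - 1 gaps
-- s + t = u + v between its members, so with k = n - 2 the chains are counted
-- by the coefficients of qᵏ in
-- ((1 + q) / (1 - q)³)ʳ⁻¹ / (1 - q)⁴.  If T, P and b are these numbers for
-- r = 3, 2, 1, then 6T - 6P + b triples are comparable.

module Submission where

open import Defs
open import Data.Bool.Base using (Bool; true; false; _∧_; _∨_; not; if_then_else_)
import Data.Bool.Properties as Bool
open import Data.Fin.Base as Fin using (Fin; toℕ; fromℕ<)
open import Data.Fin.Permutation as Perm
  using (permutation; _⟨$⟩ʳ_; _⟨$⟩ˡ_; _≈_; _∘ₚ_; transpose; inverseˡ)
import Data.Fin.Properties as Fin
open import Data.List.Base
  using (List; []; _∷_; _++_; [_]; map; length; filter; cartesianProduct; tabulate)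
open import Data.List.Membership.Propositional using (_∈_; find; lose)
open import Data.List.Membership.Propositional.Properties
  using (∈-++⁺ˡ; ∈-++⁺ʳ; ∈-++⁻; ∈-cartesianProduct⁺; ∈-cartesianProduct⁻; ∈-filter⁺; ∈-filter⁻)
open import Data.List.Properties using (length-++; length-map; tabulate-cong)
open import Data.List.Relation.Unary.All as All using (All; []; _∷_)
import Data.List.Relation.Unary.All.Properties as All
open import Data.List.Relation.Unary.AllPairs as AllPairs using (AllPairs; []; _∷_)
open import Data.List.Relation.Unary.Any as Any using (Any; here; there; _─_)
open import Data.List.Relation.Unary.Linked using (Linked; [-]; _∷_)
open import Data.List.Relation.Unary.Unique.Propositional using (Unique)
import Data.List.Relation.Unary.Unique.Propositional.Properties as Unique
import Data.List.Relation.Unary.Unique.Setoid.Properties as UniqueS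
open import Data.Nat.Base hiding (_/_)
open import Data.Nat.Properties
open import Data.Nat.Tactic.RingSolver using (solve-∀)
open import Data.Product using (∃!)
open import Data.Product.Base as Product using (∃; ∃₂; _×_; _,_; proj₁; proj₂; uncurry)
open import Data.Rational.Base using (_/_)
import Data.Rational.Properties as ℚ
open import Data.Rational.Unnormalised.Base using (mkℚᵘ; *≡*)
open import Data.Sum.Base as Sum using (_⊎_; inj₁; inj₂)
open import Data.Vec.Base using (Vec; []; _∷_; lookup)
open import Function.Base using (_∘_; flip; const)
open import Function.Bundles using (mk⇔)
open import Level using (0ℓ)
open import Relation.Binary.Construct.Closure.ReflexiveTransitive using (Star; ε; _◅_)
open import Relation.Binary.Definitions
  using (tri<; tri≈; tri>) renaming (Decidable to Decidable₂)
open import Relation.Binary.PropositionalEquality hiding ([_])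
open import Relation.Nullary using (¬_; Dec; yes; no; does; contradiction)
open import Relation.Nullary.Decidable
  using (dec-true; dec-yes; dec-no; does-⇔; map′; toWitness; _×-dec_; _⊎-dec_; _→-dec_)
open import Relation.Unary using (Pred; Decidable)

-- Elements of `𝔖 n` agree only up to `_≈_`, and for general n neither `𝔅 n` nor the decision
-- procedure for Bruhat order can be evaluated. Counts are therefore carried over by the relation
-- `Encodes`, which pairs each member of `𝔅 n` with exactly one quadruple of sum k = n - 2; all
-- chains are counted among quadruples. A gap of total m consists of two independent splittings of
-- m, so there are (m + 1)² of them; this is the source of the factor (1 + q) / (1 - q)³. Hence T =
-- C(k+9,9) + 2 C(k+8,9) + C(k+7,9). The factors k+1, ..., k+9 of the first term form three runs of
-- three, so 1680 C(k+9,9) = 𝔟 n 𝔟 (n + 3) 𝔟 (n + 6), where 1680 = 9! / (3!)³. Expressing the other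
-- two terms by the first one brings in the denominator (k+8)(k+9) = (n+6)(n+7) and the factor 4 (n²
-- + 4n + 6). For P = C(k+6,6) + C(k+5,6) the corresponding fraction 2 (k+3) / (k+6) is absorbed by
-- a binomial coefficient, and 10 P = 𝔟 n 𝔟 (n + 2) results.

private
  variable
    A B : Set
    n     : ℕ

-- Sums over lists

infix 8 [_]ᵇ

[_]ᵇ : Bool → ℕ
[ b ]ᵇ = if b then 1 else 0

∑ : List A → (A → ℕ) → ℕ
∑ []       f = 0
∑ (x ∷ xs) f = f x + ∑ xs f

∑-cong : ∀ (xs : List A) {f g : A → ℕ} → (∀ {x} → x ∈ xs → f x ≡ g x) → ∑ xs f ≡ ∑ xs g
∑-cong []       f≗g = refl
∑-cong (x ∷ xs) f≗g = cong₂ _+_ (f≗g (here refl)) (∑-cong xs (f≗g ∘ there))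

∑-+ : ∀ (xs : List A) (f g : A → ℕ) → ∑ xs (λ x → f x + g x) ≡ ∑ xs f + ∑ xs g
∑-+ []       f g = refl
∑-+ (x ∷ xs) f g = trans (cong (f x + g x +_) (∑-+ xs f g)) (interchange (f x) (g x) _ _)
  where
  interchange : ∀ a b c d → (a + b) + (c + d) ≡ (a + c) + (b + d)
  interchange = solve-∀

∑-zero : ∀ (xs : List A) → ∑ xs (const 0) ≡ 0
∑-zero []       = refl
∑-zero (x ∷ xs) = ∑-zero xs

∑-one : ∀ (xs : List A) → ∑ xs (const 1) ≡ length xs
∑-one []       = refl
∑-one (x ∷ xs) = cong suc (∑-one xs)

∑-swap : ∀ (xs : List A) (ys : List B) (f : A → B → ℕ) →
         ∑ xs (λ x → ∑ ys (f x)) ≡ ∑ ys (λ y → ∑ xs (flip f y))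
∑-swap []       ys f = sym (∑-zero ys)
∑-swap (x ∷ xs) ys f =
  trans (cong (∑ ys (f x) +_) (∑-swap xs ys f)) (sym (∑-+ ys (f x) _))

∑-++ : ∀ (xs ys : List A) (f : A → ℕ) → ∑ (xs ++ ys) f ≡ ∑ xs f + ∑ ys f
∑-++ []       ys f = refl
∑-++ (x ∷ xs) ys f = trans (cong (f x +_) (∑-++ xs ys f)) (sym (+-assoc (f x) _ _))

∑-map : ∀ (xs : List A) (g : A → B) (f : B → ℕ) → ∑ (map g xs) f ≡ ∑ xs (f ∘ g)
∑-map []       g f = refl
∑-map (x ∷ xs) g f = cong (f (g x) +_) (∑-map xs g f)

∑-cartesianProduct : ∀ (xs : List A) (ys : List B) (f : A × B → ℕ) →
                     ∑ (cartesianProduct xs ys) f ≡ ∑ xs (λ x → ∑ ys (λ y → f (x , y)))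
∑-cartesianProduct []       ys f = refl
∑-cartesianProduct (x ∷ xs) ys f =
  trans (∑-++ (map (x ,_) ys) _ f) (cong₂ _+_ (∑-map ys _ f) (∑-cartesianProduct xs ys f))

length-filter-∑ : ∀ {P : Pred A 0ℓ} (P? : Decidable P) xs →
                  length (filter P? xs) ≡ ∑ xs (λ x → [ does (P? x) ]ᵇ)
length-filter-∑ P? []       = refl
length-filter-∑ P? (x ∷ xs) with does (P? x)
... | true  = cong suc (length-filter-∑ P? xs)
... | false = length-filter-∑ P? xs

length-cartesianProduct : ∀ (xs : List A) (ys : List B) →
                          length (cartesianProduct xs ys) ≡ length xs * length ys
length-cartesianProduct []       ys = refl
length-cartesianProduct (x ∷ xs) ys =
  trans (length-++ (map (x ,_) ys))
    (cong₂ _+_ (length-map _ ys) (length-cartesianProduct xs ys))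

-- The test `p` acts as a Kronecker delta at x: exactly one summand survives. With mutual
-- comparability as the test, this removes one variable from a sum over triples.
∑-unique : ∀ {xs : List A} → Unique xs → ∀ {x} → x ∈ xs → ∀ (p : A → Bool) c →
           p x ≡ true → (∀ {y} → p y ≡ true → x ≡ y) →
           ∑ xs (λ y → [ p y ]ᵇ * c) ≡ c
∑-unique {xs = x ∷ xs} (x∉xs ∷ _) (here refl) p c px only rewrite px =
  trans (cong₂ _+_ (+-identityʳ c) (trans (∑-cong xs vanish) (∑-zero xs))) (+-identityʳ c)
  where
  vanish : ∀ {y} → y ∈ xs → [ p y ]ᵇ * c ≡ 0
  vanish {y} y∈xs with p y in py
  ... | false = refl
  ... | true  = contradiction (only py) (All.lookup x∉xs y∈xs)
∑-unique {xs = z ∷ xs} (z∉xs ∷ unique) (there x∈xs) p c px only with p z in pz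
... | false = ∑-unique unique x∈xs p c px only
... | true  = contradiction (sym (only pz)) (All.lookup z∉xs x∈xs)

module _ (R : A → B → Set) (f : A → ℕ) (g : B → ℕ) (f≡g : ∀ {x y} → R x y → f x ≡ g y) where

  private
    ∑-─ : ∀ {ys : List B} {x} (r : Any (R x) ys) → ∑ ys g ≡ f x + ∑ (ys ─ r) g
    ∑-─ (here rxy)               = cong (_+ _) (sym (f≡g rxy))
    ∑-─ {ys = y ∷ ys} {x} (there r) = trans (cong (g y +_) (∑-─ r)) (rotate (g y) (f x) _)
      where
      rotate : ∀ a b c → a + (b + c) ≡ b + (a + c)
      rotate = solve-∀

    Any-─ : ∀ {ys : List B} {x x′} → ¬ (∃ λ y → R x y × R x′ y) →
            (r : Any (R x) ys) → Any (R x′) ys → Any (R x′) (ys ─ r)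
    Any-─ x∥x′ (here r)  (here r′)  = contradiction (_ , r , r′) x∥x′
    Any-─ x∥x′ (here r)  (there r′) = r′
    Any-─ x∥x′ (there r) (here r′)  = here r′
    Any-─ x∥x′ (there r) (there r′) = there (Any-─ x∥x′ r r′)

  -- The partner of x is deleted from `ys`. By apartness it is nobody else's partner, so the
  -- remaining elements keep theirs and the induction continues.
  ∑-matching-≤ : ∀ (xs : List A) (ys : List B) →
                 AllPairs (λ x x′ → ¬ (∃ λ y → R x y × R x′ y)) xs →
                 All (λ x → Any (R x) ys) xs → ∑ xs f ≤ ∑ ys g
  ∑-matching-≤ []       ys _              _              = z≤n
  ∑-matching-≤ (x ∷ xs) ys (x∥xs ∷ apart) (r ∷ matched) = begin
    f x + ∑ xs f        ≤⟨ +-monoʳ-≤ (f x) (∑-matching-≤ xs (ys ─ r) apart matched′) ⟩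
    f x + ∑ (ys ─ r) g  ≡⟨ ∑-─ r ⟨
    ∑ ys g              ∎
    where
    open ≤-Reasoning
    matched′ : All (λ x′ → Any (R x′) (ys ─ r)) xs
    matched′ = All.zipWith (λ (x∥x′ , r′) → Any-─ x∥x′ r r′) (x∥xs , matched)

-- A relation takes the place of a bijection, because permutations are identified only up to `_≈_`
-- and a code determines its permutation only in that sense.
∑-matching : ∀ (R : A → B → Set) (f : A → ℕ) (g : B → ℕ) →
             (∀ {x y} → R x y → f x ≡ g y) →
             ∀ (xs : List A) (ys : List B) →
             AllPairs (λ x x′ → ¬ (∃ λ y → R x y × R x′ y)) xs →
             AllPairs (λ y y′ → ¬ (∃ λ x → R x y × R x y′)) ys →
             All (λ x → Any (R x) ys) xs →
             All (λ y → Any (λ x → R x y) xs) ys →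
             ∑ xs f ≡ ∑ ys g
∑-matching R f g f≡g xs ys apart-xs apart-ys matched-xs matched-ys = ≤-antisym
  (∑-matching-≤ R f g f≡g xs ys apart-xs matched-xs)
  (∑-matching-≤ (flip R) g f (sym ∘ f≡g) ys xs apart-ys matched-ys)

length-bijection : ∀ {xs : List A} {ys : List B} → Unique xs → Unique ys → (h : B → A) →
                   (∀ {y y′} → h y ≡ h y′ → y ≡ y′) →
                   (∀ {x} → x ∈ xs → ∃ λ y → y ∈ ys × x ≡ h y) →
                   (∀ {y} → y ∈ ys → h y ∈ xs) →
                   length xs ≡ length ys
length-bijection {xs = xs} {ys} unique-xs unique-ys h inj onto into = begin
  length xs        ≡⟨ ∑-one xs ⟨
  ∑ xs (const 1)   ≡⟨ ∑-matching (λ x y → x ≡ h y) _ _ (λ _ → refl) xs ys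
                        (AllPairs.map (λ x≢x′ (_ , x≡ , x′≡) → x≢x′ (trans x≡ (sym x′≡))) unique-xs)
                        (AllPairs.map (λ y≢y′ (_ , x≡ , x≡′) → y≢y′ (inj (trans (sym x≡) x≡′))) unique-ys)
                        (All.tabulate λ x∈xs → let y , y∈ys , x≡ = onto x∈xs in
                           Any.map (λ { refl → x≡ }) y∈ys)
                        (All.tabulate λ y∈ys → Any.map sym (into y∈ys)) ⟩
  ∑ ys (const 1)   ≡⟨ ∑-one ys ⟩
  length ys        ∎
  where open ≡-Reasoning

-- Graded families of lists

-- The Cauchy product of two power series. The recursion shifts `f`, so no index n - i occurs; `_⊗_`
-- follows the same recursion on lists.
conv : (ℕ → ℕ) → (ℕ → ℕ) → ℕ → ℕ
conv f g zero    = f 0 * g 0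
conv f g (suc n) = f 0 * g (suc n) + conv (f ∘ suc) g n

infixr 6 _⊗_

_⊗_ : (ℕ → List A) → (ℕ → List B) → ℕ → List (A × B)
(F ⊗ G) zero    = cartesianProduct (F 0) (G 0)
(F ⊗ G) (suc n) = cartesianProduct (F 0) (G (suc n)) ++ ((F ∘ suc) ⊗ G) n

∈-⊗⁺ : ∀ (F : ℕ → List A) (G : ℕ → List B) i j {x y} → x ∈ F i → y ∈ G j → (x , y) ∈ (F ⊗ G) (i + j)
∈-⊗⁺ F G zero    zero    x∈ y∈ = ∈-cartesianProduct⁺ x∈ y∈
∈-⊗⁺ F G zero    (suc j) x∈ y∈ = ∈-++⁺ˡ (∈-cartesianProduct⁺ x∈ y∈)
∈-⊗⁺ F G (suc i) j       x∈ y∈ = ∈-++⁺ʳ (cartesianProduct (F 0) (G (suc i + j))) (∈-⊗⁺ (F ∘ suc) G i j x∈ y∈)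

∈-⊗⁻ : ∀ (F : ℕ → List A) (G : ℕ → List B) n {x y} → (x , y) ∈ (F ⊗ G) n →
       ∃₂ λ i j → i + j ≡ n × x ∈ F i × y ∈ G j
∈-⊗⁻ F G zero xy∈ = 0 , 0 , refl , ∈-cartesianProduct⁻ (F 0) (G 0) xy∈
∈-⊗⁻ F G (suc n) xy∈ with ∈-++⁻ (cartesianProduct (F 0) (G (suc n))) xy∈
... | inj₁ xy∈ˡ = 0 , suc n , refl , ∈-cartesianProduct⁻ (F 0) (G (suc n)) xy∈ˡ
... | inj₂ xy∈ʳ with i , j , i+j≡n , x∈ , y∈ ← ∈-⊗⁻ (F ∘ suc) G n xy∈ʳ =
  suc i , j , cong suc i+j≡n , x∈ , y∈

Graded : (ℕ → List A) → Set
Graded F = ∀ {i j x} → x ∈ F i → x ∈ F j → i ≡ j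

⊗-unique : ∀ (F : ℕ → List A) (G : ℕ → List B) → Graded F →
           (∀ n → Unique (F n)) → (∀ n → Unique (G n)) → ∀ n → Unique ((F ⊗ G) n)
⊗-unique F G graded uF uG zero    = Unique.cartesianProduct⁺ (uF 0) (uG 0)
⊗-unique F G graded uF uG (suc n) = Unique.++⁺
  (Unique.cartesianProduct⁺ (uF 0) (uG (suc n)))
  (⊗-unique (F ∘ suc) G (λ x∈ x∈′ → suc-injective (graded x∈ x∈′)) (uF ∘ suc) uG n)
  λ (v∈ˡ , v∈ʳ) →
    let x∈ , _ = ∈-cartesianProduct⁻ (F 0) (G (suc n)) v∈ˡ
        i , _ , _ , x∈′ , _ = ∈-⊗⁻ (F ∘ suc) G n v∈ʳ
    in 0≢1+n (graded x∈ x∈′)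

length-⊗ : ∀ (F : ℕ → List A) (G : ℕ → List B) n →
           length ((F ⊗ G) n) ≡ conv (length ∘ F) (length ∘ G) n
length-⊗ F G zero    = length-cartesianProduct (F 0) (G 0)
length-⊗ F G (suc n) = trans (length-++ (cartesianProduct (F 0) (G (suc n))))
  (cong₂ _+_ (length-cartesianProduct (F 0) (G (suc n))) (length-⊗ (F ∘ suc) G n))

-- Power series: products, and the powers of 1 / (1 - q)

conv-cong : ∀ {f f′ g g′ : ℕ → ℕ} → f ≗ f′ → g ≗ g′ → conv f g ≗ conv f′ g′
conv-cong f≗ g≗ zero    = cong₂ _*_ (f≗ 0) (g≗ 0)
conv-cong f≗ g≗ (suc n) =
  cong₂ _+_ (cong₂ _*_ (f≗ 0) (g≗ (suc n))) (conv-cong (f≗ ∘ suc) g≗ n)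

conv-distribˡ-+ : ∀ (f g g′ : ℕ → ℕ) n → conv f (λ m → g m + g′ m) n ≡ conv f g n + conv f g′ n
conv-distribˡ-+ f g g′ zero    = *-distribˡ-+ (f 0) (g 0) (g′ 0)
conv-distribˡ-+ f g g′ (suc n) =
  trans (cong (f 0 * (g (suc n) + g′ (suc n)) +_) (conv-distribˡ-+ (f ∘ suc) g g′ n))
        (rearrange (f 0) (g (suc n)) (g′ (suc n)) _ _)
  where
  rearrange : ∀ a b c d e → a * (b + c) + (d + e) ≡ a * b + d + (a * c + e)
  rearrange = solve-∀

-- Multiplication by q.
shift : (ℕ → ℕ) → ℕ → ℕ
shift f zero    = 0
shift f (suc n) = f n

conv-shiftʳ : ∀ (f g : ℕ → ℕ) → conv f (shift g) ≗ shift (conv f g)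
conv-shiftʳ f g zero          = *-zeroʳ (f 0)
conv-shiftʳ f g (suc zero)    = trans (cong (f 0 * g 0 +_) (*-zeroʳ (f 1))) (+-identityʳ _)
conv-shiftʳ f g (suc (suc n)) = cong (f 0 * g (suc n) +_) (conv-shiftʳ (f ∘ suc) g (suc n))

-- Multiplication by 1 / (1 - q), that is, partial sums.
prefix : (ℕ → ℕ) → ℕ → ℕ
prefix = conv (const 1)

-- Both sides have the same increments, conv f g.
conv-prefix : ∀ (f g : ℕ → ℕ) → conv f (prefix g) ≗ prefix (conv f g)
conv-prefix f g zero    = lemma (f 0) (g 0)
  where
  lemma : ∀ a b → a * (1 * b) ≡ 1 * (a * b)
  lemma = solve-∀
conv-prefix f g (suc n) = trans (increment f n)
  (cong₂ _+_ (sym (*-identityˡ _)) (conv-prefix f g n))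
  where
  base : ∀ a b c d → a * (1 * b + 1 * c) + d * (1 * c) ≡ (a * b + d * c) + a * (1 * c)
  base = solve-∀
  rearrange : ∀ a b c d e → a * (1 * b + c) + (d + e) ≡ (a * b + d) + (a * c + e)
  rearrange = solve-∀
  increment : ∀ f n → conv f (prefix g) (suc n) ≡ conv f g (suc n) + conv f (prefix g) n
  increment f zero    = base (f 0) (g 1) (g 0) (f 1)
  increment f (suc n) =
    trans (cong (f 0 * prefix g (suc (suc n)) +_) (increment (f ∘ suc) n))
          (rearrange (f 0) (g (suc (suc n))) (prefix g (suc n)) _ _)

-- The coefficient of qⁿ in (1 - q)⁻⁽ʲ⁺¹⁾.
h : ℕ → ℕ → ℕ
h zero    = const 1
h (suc j) = prefix (h j)

h-suc : ∀ j n → h (suc j) (suc n) ≡ h j (suc n) + h (suc j) n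
h-suc j n = cong (_+ h (suc j) n) (*-identityˡ (h j (suc n)))

h-0 : ∀ j → h j 0 ≡ 1
h-0 zero    = refl
h-0 (suc j) = trans (*-identityˡ (h j 0)) (h-0 j)

mutual
  -- Since `h j n` is the binomial coefficient C(n + j, j), these are its two absorption identities.
  -- Pascal's rule `h-suc` reduces each of them to the other at a smaller argument.
  h-stepʳ : ∀ j n → suc n * h j (suc n) ≡ (suc n + j) * h j n
  h-stepʳ zero    n = cong (_* 1) (sym (+-identityʳ (suc n)))
  h-stepʳ (suc j) n = begin
    suc n * h (suc j) (suc n)                          ≡⟨ cong (suc n *_) (h-suc j n) ⟩
    suc n * (h j (suc n) + h (suc j) n)                ≡⟨ *-distribˡ-+ (suc n) (h j (suc n)) _ ⟩
    suc n * h j (suc n) + suc n * h (suc j) n          ≡⟨ cong (_+ suc n * h (suc j) n) (h-stepʳ j n) ⟩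
    (suc n + j) * h j n + suc n * h (suc j) n          ≡⟨ cong (_+ suc n * h (suc j) n) (h-stepˡ j n) ⟨
    suc j * h (suc j) n + suc n * h (suc j) n          ≡⟨ collect j n (h (suc j) n) ⟩
    (suc n + suc j) * h (suc j) n                      ∎
    where
    open ≡-Reasoning
    collect : ∀ j n x → suc j * x + suc n * x ≡ (suc n + suc j) * x
    collect = solve-∀

  h-stepˡ : ∀ j n → suc j * h (suc j) n ≡ (suc n + j) * h j n
  h-stepˡ j zero    = cong (suc j *_) (*-identityˡ (h j 0))
  h-stepˡ j (suc n) = begin
    suc j * h (suc j) (suc n)                          ≡⟨ cong (suc j *_) (h-suc j n) ⟩
    suc j * (h j (suc n) + h (suc j) n)                ≡⟨ *-distribˡ-+ (suc j) (h j (suc n)) _ ⟩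
    suc j * h j (suc n) + suc j * h (suc j) n          ≡⟨ cong (suc j * h j (suc n) +_) (h-stepˡ j n) ⟩
    suc j * h j (suc n) + (suc n + j) * h j n          ≡⟨ cong (suc j * h j (suc n) +_) (h-stepʳ j n) ⟨
    suc j * h j (suc n) + suc n * h j (suc n)          ≡⟨ collect j n (h j (suc n)) ⟩
    (suc (suc n) + j) * h j (suc n)                    ∎
    where
    open ≡-Reasoning
    collect : ∀ j n x → suc j * x + suc n * x ≡ (suc (suc n) + j) * x
    collect = solve-∀

-- The recursion `h-stepʳ` read at n - 1, in a form that also covers n = 0, where both sides vanish.
shift-h : ∀ j n → (n + j) * shift (h j) n ≡ n * h j n
shift-h j zero    = *-zeroʳ j
shift-h j (suc n) = sym (h-stepʳ j n)

-- The hypothesis read at n - 1 is (n + j) f(n-2) = (n - 1) f(n-1); adding f(n-1) removes the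
-- subtraction and covers n = 0.
shift-shift : ∀ (f : ℕ → ℕ) j → (∀ n → (n + suc j) * shift f n ≡ n * f n) →
              ∀ n → (n + j) * shift (shift f) n + shift f n ≡ n * shift f n
shift-shift f j rec zero    = trans (+-identityʳ _) (*-zeroʳ j)
shift-shift f j rec (suc n) = begin
  (suc n + j) * shift f n + f n  ≡⟨ cong (λ m → m * shift f n + f n) (+-suc n j) ⟨
  (n + suc j) * shift f n + f n  ≡⟨ cong (_+ f n) (rec n) ⟩
  n * f n + f n                  ≡⟨ +-comm (n * f n) (f n) ⟩
  suc n * f n                    ∎
  where open ≡-Reasoning

-- Bigrassmannian permutations as quadruples

-- A quadruple (a , z , x , y) encodes the bigrassmannian permutation
-- 1⋯a (b+1)⋯c (a+1)⋯b (c+1)⋯n with b - a = 1 + x, c - b = 1 + y and n - c = z.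
Quad : Set
Quad = ℕ × ℕ × ℕ × ℕ

infix 4 _≼_ _≼?_

_≼_ : Quad → Quad → Set
(a , z , x , y) ≼ (a′ , z′ , x′ , y′) = (a′ ≤ a × z′ ≤ z) × (x ≤ x′ × y ≤ y′)

_≼?_ : Decidable₂ _≼_
(a , z , x , y) ≼? (a′ , z′ , x′ , y′) =
  ((a′ ≤? a) ×-dec (z′ ≤? z)) ×-dec ((x ≤? x′) ×-dec (y ≤? y′))

≼-refl : ∀ {t} → t ≼ t
≼-refl = (≤-refl , ≤-refl) , (≤-refl , ≤-refl)

≼-trans : ∀ {t t′ t″} → t ≼ t′ → t′ ≼ t″ → t ≼ t″
≼-trans ((a , z) , (x , y)) ((a′ , z′) , (x′ , y′)) =
  (≤-trans a′ a , ≤-trans z′ z) , (≤-trans x x′ , ≤-trans y y′)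

≼-antisym : ∀ {t t′} → t ≼ t′ → t′ ≼ t → t ≡ t′
≼-antisym ((a , z) , (x , y)) ((a′ , z′) , (x′ , y′)) =
  cong₂ _,_ (≤-antisym a′ a) (cong₂ _,_ (≤-antisym z′ z) (cong₂ _,_ (≤-antisym x x′) (≤-antisym y y′)))

size : Quad → ℕ
size (a , z , x , y) = a + (z + (x + y))

nats : ℕ → List ℕ
nats n = [ n ]

pairs : ℕ → List (ℕ × ℕ)
pairs = nats ⊗ nats

quads : ℕ → List Quad
quads = nats ⊗ nats ⊗ nats ⊗ nats

∈-nats⁻ : ∀ {n x} → x ∈ nats n → x ≡ n
∈-nats⁻ (here eq) = eq

nats-graded : Graded nats
nats-graded x∈ x∈′ = trans (sym (∈-nats⁻ x∈)) (∈-nats⁻ x∈′)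

nats-unique : ∀ n → Unique (nats n)
nats-unique n = [] ∷ []

∈-pairs⁺ : ∀ i j → (i , j) ∈ pairs (i + j)
∈-pairs⁺ i j = ∈-⊗⁺ nats nats i j (here refl) (here refl)

∈-pairs⁻ : ∀ {n i j} → (i , j) ∈ pairs n → i + j ≡ n
∈-pairs⁻ {n} ij∈ with _ , _ , eq , i∈ , j∈ ← ∈-⊗⁻ nats nats n ij∈ =
  trans (cong₂ _+_ (∈-nats⁻ i∈) (∈-nats⁻ j∈)) eq

pairs-unique : ∀ n → Unique (pairs n)
pairs-unique = ⊗-unique nats nats nats-graded nats-unique nats-unique

∈-quads⁺ : ∀ t → t ∈ quads (size t)
∈-quads⁺ (a , z , x , y) =
  ∈-⊗⁺ nats _ a _ (here refl) (∈-⊗⁺ nats _ z _ (here refl) (∈-pairs⁺ x y))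

∈-quads⁻ : ∀ {n t} → t ∈ quads n → size t ≡ n
∈-quads⁻ {n} t∈ with _ , i , eq , a∈ , t∈ ← ∈-⊗⁻ nats (nats ⊗ pairs) n t∈
  with _ , _ , eq′ , z∈ , xy∈ ← ∈-⊗⁻ nats pairs i t∈ =
  trans (cong₂ _+_ (∈-nats⁻ a∈) (trans (cong₂ _+_ (∈-nats⁻ z∈) (∈-pairs⁻ xy∈)) eq′)) eq

quads-unique : ∀ n → Unique (quads n)
quads-unique = ⊗-unique nats _ nats-graded nats-unique
  (⊗-unique nats _ nats-graded nats-unique pairs-unique)

-- A gap ((s , t) , (u , v)) with s + t = u + v is the difference between
-- two quadruples of the same size.
Gap : Set
Gap = (ℕ × ℕ) × (ℕ × ℕ)

gaps : ℕ → List Gap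
gaps n = cartesianProduct (pairs n) (pairs n)

∈-gaps⁻ : ∀ {n s t u v} → ((s , t) , (u , v)) ∈ gaps n → s + t ≡ n × u + v ≡ n
∈-gaps⁻ {n} d∈ with st∈ , uv∈ ← ∈-cartesianProduct⁻ (pairs n) (pairs n) d∈ =
  ∈-pairs⁻ st∈ , ∈-pairs⁻ uv∈

∈-gaps⁺ : ∀ {s t u v} → s + t ≡ u + v → ((s , t) , (u , v)) ∈ gaps (s + t)
∈-gaps⁺ {s} {t} {u} {v} eq =
  ∈-cartesianProduct⁺ (∈-pairs⁺ s t) (subst ((u , v) ∈_) (cong pairs (sym eq)) (∈-pairs⁺ u v))

gaps-graded : Graded gaps
gaps-graded d∈ d∈′ = trans (sym (proj₁ (∈-gaps⁻ d∈))) (proj₁ (∈-gaps⁻ d∈′))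

gaps-unique : ∀ n → Unique (gaps n)
gaps-unique n = Unique.cartesianProduct⁺ (pairs-unique n) (pairs-unique n)

-- The base q takes a and z from the upper end of a step and x and y from the lower end. It is
-- smaller in size than both ends unless the gap is zero; a balanced gap enlarges it by the same
-- amount in either direction.
lower upper : Gap → Quad → Quad
lower ((s , t) , _) (a , z , x , y) = s + a , t + z , x , y
upper (_ , (u , v)) (a , z , x , y) = a , z , u + x , v + y

size-lower : ∀ s t uv q → size (lower ((s , t) , uv) q) ≡ (s + t) + size q
size-lower s t uv (a , z , x , y) = lemma s t a z x y
  where
  lemma : ∀ s t a z x y → (s + a) + ((t + z) + (x + y)) ≡ (s + t) + (a + (z + (x + y)))
  lemma = solve-∀

size-upper : ∀ st u v q → size (upper (st , (u , v)) q) ≡ (u + v) + size q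
size-upper st u v (a , z , x , y) = lemma u v a z x y
  where
  lemma : ∀ u v a z x y → a + (z + ((u + x) + (v + y))) ≡ (u + v) + (a + (z + (x + y)))
  lemma = solve-∀

swap : ∀ i j k → i + (j + k) ≡ j + (i + k)
swap = solve-∀

m≤n⇒∃[k]k+m≡n : ∀ {m n} → m ≤ n → ∃ λ k → n ≡ k + m
m≤n⇒∃[k]k+m≡n {m} m≤n with k , refl ← m≤n⇒∃[o]m+o≡n m≤n = k , +-comm m k

lower-≼ : ∀ d q → lower d q ≼ q
lower-≼ ((s , t) , (u , v)) (a , z , x , y) = (m≤n+m a s , m≤n+m z t) , (≤-refl , ≤-refl)

≼-upper : ∀ d q → q ≼ upper d q
≼-upper ((s , t) , (u , v)) (a , z , x , y) = (≤-refl , ≤-refl) , (m≤n+m x u , m≤n+m y v)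

-- Chains of quadruples and their gaps

chain₂ : Gap × Quad → Quad × Quad
chain₂ (d , q) = lower d q , upper d q

-- Here `d` separates the first two members and `d′` the last two. Every gap enters through `lower`
-- in the members below it and through `upper` in those above it.
chain₃ : Gap × Gap × Quad → Quad × Quad × Quad
chain₃ (d , d′ , q) = lower d (lower d′ q) , upper d (lower d′ q) , upper d′ (upper d q)

chain₂-injective : ∀ {p p′} → chain₂ p ≡ chain₂ p′ → p ≡ p′
chain₂-injective {((s , t) , (u , v)) , (a , z , x , y)} {((s′ , t′) , (u′ , v′)) , (a′ , z′ , x′ , y′)} eq
  with refl ← cong (proj₁ ∘ proj₂) eq
     | refl ← cong (proj₁ ∘ proj₂ ∘ proj₂ ∘ proj₁) eq
     | refl ← cong (proj₂ ∘ proj₂ ∘ proj₂ ∘ proj₁) eq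
     | refl ← cong (proj₁ ∘ proj₂ ∘ proj₂) eq
  with refl ← +-cancelʳ-≡ a s s′ (cong (proj₁ ∘ proj₁) eq)
     | refl ← +-cancelʳ-≡ z t t′ (cong (proj₁ ∘ proj₂ ∘ proj₁) eq)
     | refl ← +-cancelʳ-≡ x u u′ (cong (proj₁ ∘ proj₂ ∘ proj₂ ∘ proj₂) eq)
     | refl ← +-cancelʳ-≡ y v v′ (cong (proj₂ ∘ proj₂ ∘ proj₂ ∘ proj₂) eq) = refl

-- Both steps of the chain are instances of chain₂, since definitionally
-- upper d (lower d′ q) = lower d′ (upper d q).
chain₃-injective : ∀ {p p′} → chain₃ p ≡ chain₃ p′ → p ≡ p′
chain₃-injective {d , d′ , q} {e , e′ , r} eq =
  cong₂ _,_ (cong proj₁ first) (cong₂ _,_ (cong proj₁ second) q≡r)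
  where
  first : (d , lower d′ q) ≡ (e , lower e′ r)
  first = chain₂-injective (cong₂ _,_ (cong proj₁ eq) (cong (proj₁ ∘ proj₂) eq))
  second : (d′ , upper d q) ≡ (e′ , upper e r)
  second = chain₂-injective (cong proj₂ eq)
  q≡r : q ≡ r
  q≡r = cong₂ _,_ (cong (proj₁ ∘ proj₂) second) (cong₂ _,_ (cong (proj₁ ∘ proj₂ ∘ proj₂) second)
    (cong (proj₂ ∘ proj₂ ∘ proj₂) first))

≼⇒chain₂ : ∀ {t t′} → t ≼ t′ → ∃ λ p → (t , t′) ≡ chain₂ p
≼⇒chain₂ ((a≤ , z≤) , (x≤ , y≤))
  with s , refl ← m≤n⇒∃[k]k+m≡n a≤ | t , refl ← m≤n⇒∃[k]k+m≡n z≤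
     | u , refl ← m≤n⇒∃[k]k+m≡n x≤ | v , refl ← m≤n⇒∃[k]k+m≡n y≤ = (((s , t) , (u , v)) , _) , refl

≼⇒chain₃ : ∀ {t t′ t″} → t ≼ t′ → t′ ≼ t″ → ∃ λ p → (t , t′ , t″) ≡ chain₃ p
≼⇒chain₃ ((a≤ , z≤) , (x≤ , y≤)) ((a≤′ , z≤′) , (x≤′ , y≤′))
  with s , refl ← m≤n⇒∃[k]k+m≡n a≤′ | t , refl ← m≤n⇒∃[k]k+m≡n z≤′
     | u , refl ← m≤n⇒∃[k]k+m≡n x≤ | v , refl ← m≤n⇒∃[k]k+m≡n y≤
  with s′ , refl ← m≤n⇒∃[k]k+m≡n a≤ | t′ , refl ← m≤n⇒∃[k]k+m≡n z≤
     | u′ , refl ← m≤n⇒∃[k]k+m≡n x≤′ | v′ , refl ← m≤n⇒∃[k]k+m≡n y≤′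
  = (((s′ , t′) , (u , v)) , ((s , t) , (u′ , v′)) , _) , refl

∈-gaps⊗⁺ : ∀ {A : Set} (F : ℕ → List A) {s t u v n x} → s + t ≡ u + v → x ∈ F n →
           (((s , t) , (u , v)) , x) ∈ (gaps ⊗ F) (s + t + n)
∈-gaps⊗⁺ F {s} {t} eq x∈ = ∈-⊗⁺ gaps F (s + t) _ (∈-gaps⁺ eq) x∈

∈-gaps⊗⁻ : ∀ {A : Set} (F : ℕ → List A) {n s t u v x} → (((s , t) , (u , v)) , x) ∈ (gaps ⊗ F) n →
           s + t ≡ u + v × ∃ λ m → s + t + m ≡ n × x ∈ F m
∈-gaps⊗⁻ F {n} p∈ with i , j , eq , d∈ , x∈ ← ∈-⊗⁻ gaps F n p∈
  with st≡ , uv≡ ← ∈-gaps⁻ d∈ = trans st≡ (sym uv≡) , j , trans (cong (_+ j) st≡) eq , x∈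

balanced : ∀ s t u v q → size (lower ((s , t) , (u , v)) q) ≡ size (upper ((s , t) , (u , v)) q) →
           s + t ≡ u + v
balanced s t u v q eq = +-cancelʳ-≡ (size q) _ _
  (trans (sym (size-lower s t (u , v) q)) (trans eq (size-upper (s , t) u v q)))

module _ (k : ℕ) where

  -- Both ends of a step have the size of the base plus the total of the gap, so the degree in
  -- `gaps ⊗ quads` is the common size of the two members.
  length-chains₂ :
    ∑ (quads k) (λ t → ∑ (quads k) λ t′ → [ does (t ≼? t′) ]ᵇ) ≡ length ((gaps ⊗ quads) k)
  length-chains₂ = begin
    ∑ Q (λ t → ∑ Q λ t′ → [ does (t ≼? t′) ]ᵇ)          ≡⟨ ∑-cartesianProduct Q Q _ ⟨
    ∑ (cartesianProduct Q Q) (λ p → [ does (P? p) ]ᵇ)   ≡⟨ length-filter-∑ P? (cartesianProduct Q Q) ⟨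
    length (filter P? (cartesianProduct Q Q))           ≡⟨ length-bijection
      (Unique.filter⁺ P? (Unique.cartesianProduct⁺ (quads-unique k) (quads-unique k)))
      (⊗-unique gaps quads gaps-graded gaps-unique quads-unique k)
      chain₂ chain₂-injective onto into ⟩
    length ((gaps ⊗ quads) k)                           ∎
    where
    open ≡-Reasoning
    Q = quads k
    P? : Decidable (uncurry _≼_)
    P? (t , t′) = t ≼? t′
    onto : ∀ {x} → x ∈ filter P? (cartesianProduct Q Q) → ∃ λ p → p ∈ (gaps ⊗ quads) k × x ≡ chain₂ p
    onto x∈ with x∈Q² , t≼t′ ← ∈-filter⁻ P? {xs = cartesianProduct Q Q} x∈
      with t∈ , t′∈ ← ∈-cartesianProduct⁻ Q Q x∈Q²
      with p@(((s , t) , (u , v)) , q) , refl ← ≼⇒chain₂ t≼t′ =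
      p , subst (λ n → p ∈ (gaps ⊗ quads) n) (trans (sym (size-lower s t (u , v) q)) (∈-quads⁻ {k} t∈))
            (∈-gaps⊗⁺ quads (balanced s t u v q (trans (∈-quads⁻ {k} t∈) (sym (∈-quads⁻ {k} t′∈)))) (∈-quads⁺ q)) , refl
    into : ∀ {p} → p ∈ (gaps ⊗ quads) k → chain₂ p ∈ filter P? (cartesianProduct Q Q)
    into {((s , t) , (u , v)) , q} p∈ with s+t≡u+v , m , eq , q∈ ← ∈-gaps⊗⁻ quads {k} p∈
      with refl ← ∈-quads⁻ {m} q∈ =
      ∈-filter⁺ P? (∈-cartesianProduct⁺
        (subst (λ n → lower d q ∈ quads n) (trans (size-lower s t (u , v) q) eq) (∈-quads⁺ _))
        (subst (λ n → upper d q ∈ quads n)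
          (trans (size-upper (s , t) u v q) (trans (cong (_+ size q) (sym s+t≡u+v)) eq)) (∈-quads⁺ _)))
        (≼-trans (lower-≼ d q) (≼-upper d q))
      where d = (s , t) , (u , v)

  length-chains₃ :
    ∑ (quads k) (λ t → ∑ (quads k) λ t′ → ∑ (quads k) λ t″ → [ does ((t ≼? t′) ×-dec (t′ ≼? t″)) ]ᵇ)
      ≡ length ((gaps ⊗ gaps ⊗ quads) k)
  length-chains₃ = begin
    ∑ Q (λ t → ∑ Q λ t′ → ∑ Q λ t″ → [ does (P? (t , t′ , t″)) ]ᵇ)
                                 ≡⟨ ∑-cong Q (λ _ → ∑-cartesianProduct Q Q _) ⟨
    ∑ Q (λ t → ∑ (cartesianProduct Q Q) λ p → [ does (P? (t , p)) ]ᵇ)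
                                 ≡⟨ ∑-cartesianProduct Q _ _ ⟨
    ∑ Q³ (λ p → [ does (P? p) ]ᵇ) ≡⟨ length-filter-∑ P? Q³ ⟨
    length (filter P? Q³)        ≡⟨ length-bijection
      (Unique.filter⁺ P? (Unique.cartesianProduct⁺ (quads-unique k)
        (Unique.cartesianProduct⁺ (quads-unique k) (quads-unique k))))
      (⊗-unique gaps _ gaps-graded gaps-unique (⊗-unique gaps quads gaps-graded gaps-unique quads-unique) k)
      chain₃ chain₃-injective onto into ⟩
    length ((gaps ⊗ gaps ⊗ quads) k) ∎
    where
    open ≡-Reasoning
    Q = quads k
    Q³ = cartesianProduct Q (cartesianProduct Q Q)
    P? : Decidable (λ (t , t′ , t″) → t ≼ t′ × t′ ≼ t″)
    P? (t , t′ , t″) = (t ≼? t′) ×-dec (t′ ≼? t″)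
    onto : ∀ {x} → x ∈ filter P? Q³ → ∃ λ p → p ∈ (gaps ⊗ gaps ⊗ quads) k × x ≡ chain₃ p
    onto x∈ with x∈Q³ , t≼t′ , t′≼t″ ← ∈-filter⁻ P? {xs = Q³} x∈
      with t∈ , x∈Q² ← ∈-cartesianProduct⁻ Q (cartesianProduct Q Q) x∈Q³
      with t′∈ , t″∈ ← ∈-cartesianProduct⁻ Q Q x∈Q²
      with p@(d@((s , t) , (u , v)) , d′@((s′ , t′) , (u′ , v′)) , q) , refl ← ≼⇒chain₃ t≼t′ t′≼t″ =
      p ,
      subst (λ n → p ∈ (gaps ⊗ gaps ⊗ quads) n)
        (trans (sym (trans (size-lower s t (u , v) (lower d′ q)) (cong (s + t +_) (size-lower s′ t′ (u′ , v′) q))))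
          (∈-quads⁻ {k} t∈))
        (∈-gaps⊗⁺ (gaps ⊗ quads)
          (balanced s t u v (lower d′ q) (trans (∈-quads⁻ {k} t∈) (sym (∈-quads⁻ {k} t′∈))))
          (∈-gaps⊗⁺ quads
            (balanced s′ t′ u′ v′ (upper d q)
              (trans (∈-quads⁻ {k} t′∈) (sym (∈-quads⁻ {k} t″∈))))
            (∈-quads⁺ q))) ,
      refl
    into : ∀ {p} → p ∈ (gaps ⊗ gaps ⊗ quads) k → chain₃ p ∈ filter P? Q³
    into {d@((s , t) , (u , v)) , d′@((s′ , t′) , (u′ , v′)) , q} p∈
      with s+t≡u+v , m , eq , p∈′ ← ∈-gaps⊗⁻ (gaps ⊗ quads) {k} p∈
      with s′+t′≡u′+v′ , m′ , refl , q∈ ← ∈-gaps⊗⁻ quads {m} p∈′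
      with refl ← ∈-quads⁻ {m′} q∈ =
      ∈-filter⁺ P? (∈-cartesianProduct⁺ (member (lower d (lower d′ q)) low)
        (∈-cartesianProduct⁺ (member (upper d (lower d′ q)) mid) (member (upper d′ (upper d q)) high)))
        (≼-trans (lower-≼ d (lower d′ q)) (≼-upper d (lower d′ q)) ,
         ≼-trans (lower-≼ d′ (upper d q)) (≼-upper d′ (upper d q)))
      where
      member : ∀ w → size w ≡ k → w ∈ Q
      member w eq = subst (λ n → w ∈ quads n) eq (∈-quads⁺ w)
      low : size (lower d (lower d′ q)) ≡ k
      low = trans (size-lower s t (u , v) (lower d′ q))
        (trans (cong (s + t +_) (size-lower s′ t′ (u′ , v′) q)) eq)
      mid : size (upper d (lower d′ q)) ≡ k
      mid = trans (size-upper (s , t) u v (lower d′ q))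
        (trans (cong₂ _+_ (sym s+t≡u+v) (size-lower s′ t′ (u′ , v′) q)) eq)
      high : size (upper d′ (upper d q)) ≡ k
      high = trans (size-upper (s′ , t′) u′ v′ (upper d q))
        (trans (cong₂ _+_ (sym s′+t′≡u′+v′)
          (trans (size-upper (s , t) u v q) (cong (_+ size q) (sym s+t≡u+v))))
          (trans (swap (s′ + t′) (s + t) (size q)) eq))

-- Generating functions of chains and their closed forms

prefix-cong : ∀ {f g : ℕ → ℕ} → f ≗ g → prefix f ≗ prefix g
prefix-cong = conv-cong (λ _ → refl)

-- Commutativity of `conv` against the series 1 / (1 - q): `prefix` has this series on the left,
-- whereas the products with `gaps` have it on the right.
conv-one : ∀ (f : ℕ → ℕ) → conv f (const 1) ≗ prefix f
conv-one f zero    = *-comm (f 0) 1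
conv-one f (suc n) = trans (increment f n) (cong₂ _+_ (sym (*-identityˡ _)) (conv-one f n))
  where
  rearrange : ∀ a b → a * 1 + b * 1 ≡ b + a * 1
  rearrange = solve-∀
  increment : ∀ f n → conv f (const 1) (suc n) ≡ f (suc n) + conv f (const 1) n
  increment f zero    = rearrange (f 0) (f 1)
  increment f (suc n) = trans (cong (f 0 * 1 +_) (increment (f ∘ suc) n)) (swap (f 0 * 1) (f (suc (suc n))) (conv (f ∘ suc) (const 1) n))

h-unfold : ∀ j n → h (suc j) n ≡ h j n + shift (h (suc j)) n
h-unfold j zero    = trans (h-0 (suc j)) (sym (trans (+-identityʳ _) (h-0 j)))
h-unfold j (suc n) = h-suc j n

h-1 : ∀ n → h 1 n ≡ suc n
h-1 zero    = refl
h-1 (suc n) = cong suc (h-1 n)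

-- (1 + q) / (1 - q)³ = ∑ (n + 1)² qⁿ.
square : ∀ n → suc n * suc n ≡ h 2 n + shift (h 2) n
square zero    = refl
square (suc n) = begin
  suc (suc n) * suc (suc n)                     ≡⟨ expand n ⟩
  suc (suc n) + suc n * suc n + suc n           ≡⟨ cong₂ (λ i j → i + suc n * suc n + j) (h-1 (suc n)) (h-1 n) ⟨
  h 1 (suc n) + suc n * suc n + h 1 n           ≡⟨ cong (λ i → h 1 (suc n) + i + h 1 n) (square n) ⟩
  h 1 (suc n) + (h 2 n + shift (h 2) n) + h 1 n ≡⟨ rearrange (h 1 (suc n)) (h 2 n) (shift (h 2) n) (h 1 n) ⟩
  (h 1 (suc n) + h 2 n) + (h 1 n + shift (h 2) n) ≡⟨ cong₂ _+_ (h-suc 1 n) (h-unfold 1 n) ⟨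
  h 2 (suc n) + h 2 n                           ∎
  where
  open ≡-Reasoning
  expand : ∀ n → suc (suc n) * suc (suc n) ≡ suc (suc n) + suc n * suc n + suc n
  expand = solve-∀
  rearrange : ∀ a b c d → a + (b + c) + d ≡ (a + b) + (d + c)
  rearrange = solve-∀

length-pairs : ∀ n → length (pairs n) ≡ h 1 n
length-pairs = length-⊗ nats nats

length-quads : ∀ n → length (quads n) ≡ h 3 n
length-quads n = trans (length-⊗ nats _ n) (prefix-cong
  (λ m → trans (length-⊗ nats pairs m) (prefix-cong length-pairs m)) n)

1+shift : (ℕ → ℕ) → ℕ → ℕ
1+shift f n = f n + shift f n

conv-1+shift : ∀ f g → conv f (1+shift g) ≗ 1+shift (conv f g)
conv-1+shift f g n = trans (conv-distribˡ-+ f g (shift g) n) (cong (conv f g n +_) (conv-shiftʳ f g n))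

shift-cong : ∀ {f g : ℕ → ℕ} → f ≗ g → shift f ≗ shift g
shift-cong f≗g zero    = refl
shift-cong f≗g (suc n) = f≗g n

length-gaps : ∀ n → length (gaps n) ≡ 1+shift (h 2) n
length-gaps n = trans (length-cartesianProduct (pairs n) (pairs n))
  (trans (cong₂ _*_ (eq n) (eq n)) (square n))
  where
  eq : ∀ n → length (pairs n) ≡ suc n
  eq n = trans (length-pairs n) (h-1 n)

-- Multiplication by (1 + q) / (1 - q)³ raises the exponent of 1 / (1 - q) from j + 1 to j + 4. Each
-- further factor 1 / (1 - q) is pulled out by `conv-prefix`.
conv-gaps : ∀ j → conv (length ∘ gaps) (h j) ≗ 1+shift (h (3 + j))
conv-gaps zero    n = trans (conv-one (length ∘ gaps) n)
  (trans (prefix-cong length-gaps n) (conv-1+shift (const 1) (h 2) n))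
conv-gaps (suc j) n = trans (conv-prefix (length ∘ gaps) (h j) n)
  (trans (prefix-cong (conv-gaps j) n) (conv-1+shift (const 1) (h (3 + j)) n))

length-gaps⊗quads : ∀ n → length ((gaps ⊗ quads) n) ≡ 1+shift (h 6) n
length-gaps⊗quads n = trans (length-⊗ gaps quads n)
  (trans (conv-cong (λ _ → refl) length-quads n) (conv-gaps 3 n))

length-gaps⊗gaps⊗quads : ∀ n → length ((gaps ⊗ gaps ⊗ quads) n) ≡ 1+shift (1+shift (h 9)) n
length-gaps⊗gaps⊗quads n = trans (length-⊗ gaps (gaps ⊗ quads) n)
  (trans (conv-cong (λ _ → refl) length-gaps⊗quads n)
    (trans (conv-1+shift (length ∘ gaps) (h 6) n)
      (cong₂ _+_ (conv-gaps 6 n) (shift-cong (conv-gaps 6) n))))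

h-3 : ∀ k → 6 * h 3 k ≡ (1 + k) * (2 + k) * (3 + k)
h-3 k = begin
  6 * h 3 k                       ≡⟨ *-assoc 2 3 (h 3 k) ⟩
  2 * (3 * h 3 k)                 ≡⟨ cong (2 *_) (h-stepˡ 2 k) ⟩
  2 * ((suc k + 2) * h 2 k)       ≡⟨ pull k (h 2 k) ⟩
  (3 + k) * (2 * h 2 k)           ≡⟨ cong ((3 + k) *_) (h-stepˡ 1 k) ⟩
  (3 + k) * ((suc k + 1) * h 1 k) ≡⟨ cong (λ i → (3 + k) * ((suc k + 1) * i)) (h-1 k) ⟩
  (3 + k) * ((suc k + 1) * suc k) ≡⟨ rearrange k ⟩
  (1 + k) * (2 + k) * (3 + k)     ∎
  where
  open ≡-Reasoning
  pull : ∀ k x → 2 * ((suc k + 2) * x) ≡ (3 + k) * (2 * x)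
  pull = solve-∀
  rearrange : ∀ k → (3 + k) * ((suc k + 1) * suc k) ≡ (1 + k) * (2 + k) * (3 + k)
  rearrange = solve-∀

h-+3 : ∀ j k → (3 + j) * (2 + j) * (1 + j) * h (3 + j) k ≡ (1 + j + k) * (2 + j + k) * (3 + j + k) * h j k
h-+3 j k = begin
  (3 + j) * (2 + j) * (1 + j) * h (3 + j) k                   ≡⟨ pull (3 + j) (2 + j) (1 + j) (h (3 + j) k) ⟩
  (2 + j) * (1 + j) * ((3 + j) * h (3 + j) k)                 ≡⟨ cong ((2 + j) * (1 + j) *_) (h-stepˡ (2 + j) k) ⟩
  (2 + j) * (1 + j) * ((suc k + (2 + j)) * h (2 + j) k)       ≡⟨ pull₂ (2 + j) (1 + j) (suc k + (2 + j)) (h (2 + j) k) ⟩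
  (1 + j) * (suc k + (2 + j)) * ((2 + j) * h (2 + j) k)       ≡⟨ cong ((1 + j) * (suc k + (2 + j)) *_) (h-stepˡ (1 + j) k) ⟩
  (1 + j) * (suc k + (2 + j)) * ((suc k + (1 + j)) * h (1 + j) k) ≡⟨ pull₂ (1 + j) (suc k + (2 + j)) (suc k + (1 + j)) (h (1 + j) k) ⟩
  (suc k + (2 + j)) * (suc k + (1 + j)) * ((1 + j) * h (1 + j) k) ≡⟨ cong ((suc k + (2 + j)) * (suc k + (1 + j)) *_) (h-stepˡ j k) ⟩
  (suc k + (2 + j)) * (suc k + (1 + j)) * ((suc k + j) * h j k) ≡⟨ rearrange j k (h j k) ⟩
  (1 + j + k) * (2 + j + k) * (3 + j + k) * h j k             ∎
  where
  open ≡-Reasoning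
  pull : ∀ a b c x → a * b * c * x ≡ b * c * (a * x)
  pull = solve-∀
  pull₂ : ∀ a b c x → a * b * (c * x) ≡ b * c * (a * x)
  pull₂ = solve-∀
  rearrange : ∀ j k x → (suc k + (2 + j)) * (suc k + (1 + j)) * ((suc k + j) * x) ≡ (1 + j + k) * (2 + j + k) * (3 + j + k) * x
  rearrange = solve-∀

-- The six factors of C(k+6,6) split into k+1, k+2, k+3 and k+4, k+5, k+6; the constant is 20 =
-- C(6,3), and 120 = 6 · 5 · 4.
h-3-3 : ∀ k → 20 * h 6 k ≡ h 3 (k + 3) * h 3 k
h-3-3 k = *-cancelˡ-≡ _ _ 6 (begin
  6 * (20 * h 6 k)                                  ≡⟨ *-assoc 6 20 (h 6 k) ⟨
  120 * h 6 k                                       ≡⟨ h-+3 3 k ⟩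
  (4 + k) * (5 + k) * (6 + k) * h 3 k               ≡⟨ rearrange k (h 3 k) ⟩
  (1 + (k + 3)) * (2 + (k + 3)) * (3 + (k + 3)) * h 3 k ≡⟨ cong (_* h 3 k) (h-3 (k + 3)) ⟨
  6 * h 3 (k + 3) * h 3 k                           ≡⟨ *-assoc 6 (h 3 (k + 3)) (h 3 k) ⟩
  6 * (h 3 (k + 3) * h 3 k)                         ∎)
  where
  open ≡-Reasoning
  rearrange : ∀ k x → (4 + k) * (5 + k) * (6 + k) * x ≡ (1 + (k + 3)) * (2 + (k + 3)) * (3 + (k + 3)) * x
  rearrange = solve-∀

-- The last three of the nine factors of C(k+9,9) are split off; the constant is 84 = C(9,3), and
-- 504 = 9 · 8 · 7.
h-3-6 : ∀ k → 84 * h 9 k ≡ h 3 (k + 6) * h 6 k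
h-3-6 k = *-cancelˡ-≡ _ _ 6 (begin
  6 * (84 * h 9 k)                                  ≡⟨ *-assoc 6 84 (h 9 k) ⟨
  504 * h 9 k                                       ≡⟨ h-+3 6 k ⟩
  (7 + k) * (8 + k) * (9 + k) * h 6 k               ≡⟨ rearrange k (h 6 k) ⟩
  (1 + (k + 6)) * (2 + (k + 6)) * (3 + (k + 6)) * h 6 k ≡⟨ cong (_* h 6 k) (h-3 (k + 6)) ⟨
  6 * h 3 (k + 6) * h 6 k                           ≡⟨ *-assoc 6 (h 3 (k + 6)) (h 6 k) ⟩
  6 * (h 3 (k + 6) * h 6 k)                         ∎)
  where
  open ≡-Reasoning
  rearrange : ∀ k x → (7 + k) * (8 + k) * (9 + k) * x ≡ (1 + (k + 6)) * (2 + (k + 6)) * (3 + (k + 6)) * x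
  rearrange = solve-∀

-- After multiplication by k + 6 the shifted term becomes k H, and the sum is 2 (k + 3) H. The
-- factor k + 3 then turns C(k+6,3) into (k + 6) C(k+5,3), and k + 6 cancels.
pairs-closed : ∀ k → 10 * 1+shift (h 6) k ≡ h 3 k * h 3 (k + 2)
pairs-closed k = *-cancelˡ-≡ _ _ (6 + k) (begin
  (6 + k) * (10 * (H + U))               ≡⟨ expand k H U ⟩
  10 * (6 + k) * H + 10 * ((k + 6) * U)  ≡⟨ cong (λ i → 10 * (6 + k) * H + 10 * i) (shift-h 6 k) ⟩
  10 * (6 + k) * H + 10 * (k * H)        ≡⟨ collect k H ⟩
  (3 + k) * (20 * H)                     ≡⟨ cong ((3 + k) *_) (h-3-3 k) ⟩
  (3 + k) * (h 3 (k + 3) * h 3 k)        ≡⟨ rearrange k (h 3 (k + 3)) (h 3 k) ⟩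
  h 3 k * (suc (k + 2) * h 3 (k + 3))    ≡⟨ cong (λ i → h 3 k * (suc (k + 2) * h 3 i)) (+-suc k 2) ⟩
  h 3 k * (suc (k + 2) * h 3 (suc (k + 2))) ≡⟨ cong (h 3 k *_) (h-stepʳ 3 (k + 2)) ⟩
  h 3 k * ((suc (k + 2) + 3) * h 3 (k + 2)) ≡⟨ rearrange′ k (h 3 k) (h 3 (k + 2)) ⟩
  (6 + k) * (h 3 k * h 3 (k + 2))        ∎)
  where
  open ≡-Reasoning
  H = h 6 k
  U = shift (h 6) k
  expand : ∀ k a b → (6 + k) * (10 * (a + b)) ≡ 10 * (6 + k) * a + 10 * ((k + 6) * b)
  expand = solve-∀
  collect : ∀ k a → 10 * (6 + k) * a + 10 * (k * a) ≡ (3 + k) * (20 * a)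
  collect = solve-∀
  rearrange : ∀ k a b → (3 + k) * (a * b) ≡ b * (suc (k + 2) * a)
  rearrange = solve-∀
  rearrange′ : ∀ k a b → a * ((suc (k + 2) + 3) * b) ≡ (6 + k) * (a * b)
  rearrange′ = solve-∀

-- With H = C(k+9,9), the two lower terms are k H / (k+9) and k (k-1) H / ((k+8)(k+9)). Over the
-- common denominator the numerator is (k+8)(k+9) + 2k (k+8) + k (k-1) = 4 (k² + 8k + 18), and 420 ·
-- 4 = 20 · 84.
triples-closed : ∀ k → 420 * (k + 8) * (k + 9) * 1+shift (1+shift (h 9)) k
                         ≡ (k * k + 8 * k + 18) * (h 3 k * (h 3 (k + 3) * h 3 (k + 6)))
-- The extra summand replaces a subtraction: the relation for V involves k U - U, and (k + 9) U
-- equals k H.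
triples-closed k = +-cancelʳ-≡ (420 * k * H) _ _ (begin
  420 * (k + 8) * (k + 9) * (H + U + shift (1+shift (h 9)) k) + 420 * k * H
    ≡⟨ cong (λ i → 420 * (k + 8) * (k + 9) * (H + U + i) + 420 * k * H) (shift-+ k) ⟩
  420 * (k + 8) * (k + 9) * (H + U + (U + V)) + 420 * k * H
    ≡⟨ isolate k H U V ⟩
  420 * ((k + 8) * (k + 9) * (H + U + (U + V)) + k * H)
    ≡⟨ cong (λ i → 420 * ((k + 8) * (k + 9) * (H + U + (U + V)) + i)) (shift-h 9 k) ⟨
  420 * ((k + 8) * (k + 9) * (H + U + (U + V)) + (k + 9) * U)
    ≡⟨ expand k H U V ⟩
  420 * ((k + 8) * (k + 9) * H + 2 * (k + 8) * ((k + 9) * U) + (k + 9) * ((k + 8) * V + U))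
    ≡⟨ cong (λ i → 420 * ((k + 8) * (k + 9) * H + 2 * (k + 8) * ((k + 9) * U) + (k + 9) * i)) (shift-shift (h 9) 8 (shift-h 9) k) ⟩
  420 * ((k + 8) * (k + 9) * H + 2 * (k + 8) * ((k + 9) * U) + (k + 9) * (k * U))
    ≡⟨ regroup k H U ⟩
  420 * ((k + 8) * (k + 9) * H + (2 * (k + 8) + k) * ((k + 9) * U))
    ≡⟨ cong (λ i → 420 * ((k + 8) * (k + 9) * H + (2 * (k + 8) + k) * i)) (shift-h 9 k) ⟩
  420 * ((k + 8) * (k + 9) * H + (2 * (k + 8) + k) * (k * H))
    ≡⟨ collect k H ⟩
  (k * k + 8 * k + 18) * (20 * (84 * H)) + 420 * k * H
    ≡⟨ cong (λ i → (k * k + 8 * k + 18) * i + 420 * k * H) factor ⟩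
  (k * k + 8 * k + 18) * (h 3 k * (h 3 (k + 3) * h 3 (k + 6))) + 420 * k * H ∎)
  where
  open ≡-Reasoning
  H = h 9 k
  U = shift (h 9) k
  V = shift (shift (h 9)) k
  shift-+ : ∀ k → shift (1+shift (h 9)) k ≡ shift (h 9) k + shift (shift (h 9)) k
  shift-+ zero    = refl
  shift-+ (suc k) = refl
  isolate : ∀ k a b c → 420 * (k + 8) * (k + 9) * (a + b + (b + c)) + 420 * k * a
                        ≡ 420 * ((k + 8) * (k + 9) * (a + b + (b + c)) + k * a)
  isolate = solve-∀
  expand : ∀ k a b c → 420 * ((k + 8) * (k + 9) * (a + b + (b + c)) + (k + 9) * b)
                       ≡ 420 * ((k + 8) * (k + 9) * a + 2 * (k + 8) * ((k + 9) * b) + (k + 9) * ((k + 8) * c + b))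
  expand = solve-∀
  regroup : ∀ k a b → 420 * ((k + 8) * (k + 9) * a + 2 * (k + 8) * ((k + 9) * b) + (k + 9) * (k * b))
                      ≡ 420 * ((k + 8) * (k + 9) * a + (2 * (k + 8) + k) * ((k + 9) * b))
  regroup = solve-∀
  collect : ∀ k a → 420 * ((k + 8) * (k + 9) * a + (2 * (k + 8) + k) * (k * a))
                    ≡ (k * k + 8 * k + 18) * (20 * (84 * a)) + 420 * k * a
  collect = solve-∀
  reorder : ∀ a b c → c * (b * a) ≡ a * (b * c)
  reorder = solve-∀
  pull : ∀ a b → 20 * (a * b) ≡ a * (20 * b)
  pull = solve-∀
  factor : 20 * (84 * H) ≡ h 3 k * (h 3 (k + 3) * h 3 (k + 6))
  factor = begin
    20 * (84 * H)                             ≡⟨ cong (20 *_) (h-3-6 k) ⟩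
    20 * (h 3 (k + 6) * h 6 k)                ≡⟨ pull (h 3 (k + 6)) (h 6 k) ⟩
    h 3 (k + 6) * (20 * h 6 k)                ≡⟨ cong (h 3 (k + 6) *_) (h-3-3 k) ⟩
    h 3 (k + 6) * (h 3 (k + 3) * h 3 k)       ≡⟨ reorder (h 3 k) (h 3 (k + 3)) (h 3 (k + 6)) ⟩
    h 3 k * (h 3 (k + 3) * h 3 (k + 6))       ∎

-- Inclusion–exclusion for comparable triples

∧-[]ᵇ : ∀ b c → [ b ∧ c ]ᵇ ≡ [ b ]ᵇ * [ c ]ᵇ
∧-[]ᵇ false c = refl
∧-[]ᵇ true  c = sym (+-identityʳ [ c ]ᵇ)

-- bᵢⱼ stands for "the i-th element is below the j-th".
comparableᵇ : (b₁₂ b₂₁ b₁₃ b₃₁ b₂₃ b₃₂ : Bool) → Bool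
comparableᵇ b₁₂ b₂₁ b₁₃ b₃₁ b₂₃ b₃₂ =
  b₁₂ ∧ b₂₃ ∨ b₁₃ ∧ b₃₂ ∨ b₂₁ ∧ b₁₃ ∨ b₂₃ ∧ b₃₁ ∨ b₃₁ ∧ b₁₂ ∨ b₃₂ ∧ b₂₁

infixr 5 _⇒ᵇ_

_⇒ᵇ_ : Bool → Bool → Bool
b ⇒ᵇ c = not b ∨ c

-- The counting identity is a property of transitive relations. For a bare cycle 1 ≤ 2 ≤ 3 ≤ 1 it
-- fails, since three orderings are chains although no two elements are equal.
transitiveᵇ : (b₁₂ b₂₁ b₁₃ b₃₁ b₂₃ b₃₂ : Bool) → Bool
transitiveᵇ b₁₂ b₂₁ b₁₃ b₃₁ b₂₃ b₃₂ =
  (b₁₂ ∧ b₂₃ ⇒ᵇ b₁₃) ∧ (b₁₃ ∧ b₃₂ ⇒ᵇ b₁₂) ∧ (b₂₁ ∧ b₁₃ ⇒ᵇ b₂₃) ∧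
  (b₂₃ ∧ b₃₁ ⇒ᵇ b₂₁) ∧ (b₃₁ ∧ b₁₂ ⇒ᵇ b₃₂) ∧ (b₃₂ ∧ b₂₁ ⇒ᵇ b₃₁)

∀Bool? : ∀ {P : Bool → Set} → (∀ b → Dec (P b)) → Dec (∀ b → P b)
∀Bool? P? = map′ (λ { (f , t) false → f ; (f , t) true → t }) (λ P → P false , P true)
  (P? false ×-dec P? true)

-- A comparable triple is a chain for 1, 2 or 6 of the six orderings, according
-- as it has 3, 2 or 1 distinct elements.
inclusion-exclusion : ∀ b₁₂ b₂₁ b₁₃ b₃₁ b₂₃ b₃₂ → transitiveᵇ b₁₂ b₂₁ b₁₃ b₃₁ b₂₃ b₃₂ ≡ true →
  ([ b₁₂ ∧ b₂₃ ]ᵇ + [ b₁₃ ∧ b₃₂ ]ᵇ + [ b₂₁ ∧ b₁₃ ]ᵇ + [ b₂₃ ∧ b₃₁ ]ᵇ + [ b₃₁ ∧ b₁₂ ]ᵇ + [ b₃₂ ∧ b₂₁ ]ᵇ)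
    + [ (b₁₂ ∧ b₂₁) ∧ (b₁₃ ∧ b₃₁) ]ᵇ
  ≡ [ comparableᵇ b₁₂ b₂₁ b₁₃ b₃₁ b₂₃ b₃₂ ]ᵇ
    + ([ (b₁₂ ∧ b₂₁) ∧ b₁₃ ]ᵇ + [ (b₁₂ ∧ b₂₁) ∧ b₃₁ ]ᵇ + [ (b₁₃ ∧ b₃₁) ∧ b₁₂ ]ᵇ
       + [ (b₁₃ ∧ b₃₁) ∧ b₂₁ ]ᵇ + [ (b₂₃ ∧ b₃₂) ∧ b₂₁ ]ᵇ + [ (b₂₃ ∧ b₃₂) ∧ b₁₂ ]ᵇ)
inclusion-exclusion = toWitness {a? = ∀Bool? λ b₁₂ → ∀Bool? λ b₂₁ → ∀Bool? λ b₁₃ →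
  ∀Bool? λ b₃₁ → ∀Bool? λ b₂₃ → ∀Bool? λ b₃₂ →
  (transitiveᵇ b₁₂ b₂₁ b₁₃ b₃₁ b₂₃ b₃₂ Bool.≟ true) →-dec (_ ≟ _)} _

⇒ᵇ-true : ∀ {P Q R : Set} (P? : Dec P) (Q? : Dec Q) (R? : Dec R) → (P → Q → R) →
          (does P? ∧ does Q? ⇒ᵇ does R?) ≡ true
⇒ᵇ-true (no _)  Q?      R? imp = refl
⇒ᵇ-true (yes _) (no _)  R? imp = refl
⇒ᵇ-true (yes p) (yes q) R? imp = dec-true R? (imp p q)

does-∧ : ∀ {P Q : Set} (P? : Dec P) (Q? : Dec Q) → does P? ∧ does Q? ≡ true → P × Q
does-∧ (yes p) (yes q) _ = p , q

∑³ : List A → (A → A → A → ℕ) → ℕ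
∑³ xs f = ∑ xs λ x → ∑ xs λ y → ∑ xs λ z → f x y z

module _ (xs : List A) where

  ∑³-+ : ∀ f g → ∑³ xs (λ x y z → f x y z + g x y z) ≡ ∑³ xs f + ∑³ xs g
  ∑³-+ f g = trans (∑-cong xs λ _ → trans (∑-cong xs λ _ → ∑-+ xs _ _) (∑-+ xs _ _)) (∑-+ xs _ _)

  ∑³-swaq₁₂ : ∀ f → ∑³ xs (λ x y z → f y x z) ≡ ∑³ xs f
  ∑³-swaq₁₂ f = ∑-swap xs xs _

  ∑³-swaq₂₃ : ∀ f → ∑³ xs (λ x y z → f x z y) ≡ ∑³ xs f
  ∑³-swaq₂₃ f = ∑-cong xs λ _ → ∑-swap xs xs _

module _ (k : ℕ) where

  private
    Q = quads k

    _≼ᵇ_ : Quad → Quad → Bool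
    t ≼ᵇ t′ = does (t ≼? t′)

    _≈ᵇ_ : Quad → Quad → Bool
    t ≈ᵇ t′ = t ≼ᵇ t′ ∧ t′ ≼ᵇ t

    ≈ᵇ-refl : ∀ t → t ≈ᵇ t ≡ true
    ≈ᵇ-refl t rewrite dec-true (t ≼? t) ≼-refl = refl

    ≈ᵇ-sound : ∀ {t t′} → t ≈ᵇ t′ ≡ true → t ≡ t′
    ≈ᵇ-sound {t} {t′} eq = let p , q = does-∧ (t ≼? t′) (t′ ≼? t) eq in ≼-antisym p q

    #P = ∑ Q λ t → ∑ Q λ t′ → [ t ≼ᵇ t′ ]ᵇ
    #T = ∑³ Q λ t t′ t″ → [ t ≼ᵇ t′ ∧ t′ ≼ᵇ t″ ]ᵇ

  -- By antisymmetry the test forces t′ = t, so the sum over t′ collapses.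
  ∑³-≈ᵇ : ∀ (r : Quad → Quad → Bool) →
          ∑³ Q (λ t t′ t″ → [ t ≈ᵇ t′ ∧ r t t″ ]ᵇ) ≡ ∑ Q (λ t → ∑ Q λ t″ → [ r t t″ ]ᵇ)
  ∑³-≈ᵇ r = ∑-cong Q λ {t} t∈ → trans (∑-swap Q Q _) (∑-cong Q λ {t″} _ →
    trans (∑-cong Q λ _ → ∧-[]ᵇ _ (r t t″))
          (∑-unique (quads-unique k) t∈ (t ≈ᵇ_) [ r t t″ ]ᵇ (≈ᵇ-refl t) ≈ᵇ-sound))

  -- This is `inclusion-exclusion` summed over all triples. Renaming variables makes the six sums
  -- over orderings equal to `#T`, and the six sums with a coinciding pair equal to `#P`.
  ∑-comparable :
    6 * #T + length Q ≡
    ∑³ Q (λ t t′ t″ → [ comparableᵇ (t ≼ᵇ t′) (t′ ≼ᵇ t) (t ≼ᵇ t″) (t″ ≼ᵇ t) (t′ ≼ᵇ t″) (t″ ≼ᵇ t′) ]ᵇ) + 6 * #P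
  ∑-comparable = begin
    6 * #T + length Q
      ≡⟨ cong₂ _+_ (sym (sixfold #T T₁ T₂ T₃ T₄ T₅ T₆)) (sym E) ⟩
    (∑³ Q t₁ + ∑³ Q t₂ + ∑³ Q t₃ + ∑³ Q t₄ + ∑³ Q t₅ + ∑³ Q t₆) + ∑³ Q e
      ≡⟨ cong (_+ ∑³ Q e) (∑³-6 t₁ t₂ t₃ t₄ t₅ t₆) ⟨
    ∑³ Q (λ x y z → t₁ x y z + t₂ x y z + t₃ x y z + t₄ x y z + t₅ x y z + t₆ x y z) + ∑³ Q e
      ≡⟨ ∑³-+ Q _ e ⟨
    ∑³ Q (λ x y z → (t₁ x y z + t₂ x y z + t₃ x y z + t₄ x y z + t₅ x y z + t₆ x y z) + e x y z)
      ≡⟨ (∑-cong Q λ {x} _ → ∑-cong Q λ {y} _ → ∑-cong Q λ {z} _ → inclusion-exclusion (x ≼ᵇ y) (y ≼ᵇ x) (x ≼ᵇ z) (z ≼ᵇ x) (y ≼ᵇ z) (z ≼ᵇ y) (transitive x y z)) ⟩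
    ∑³ Q (λ x y z → c x y z + (q₁ x y z + q₂ x y z + q₃ x y z + q₄ x y z + q₅ x y z + q₆ x y z))
      ≡⟨ ∑³-+ Q c _ ⟩
    ∑³ Q c + ∑³ Q (λ x y z → q₁ x y z + q₂ x y z + q₃ x y z + q₄ x y z + q₅ x y z + q₆ x y z)
      ≡⟨ cong (∑³ Q c +_) (trans (∑³-6 q₁ q₂ q₃ q₄ q₅ q₆) (sixfold #P P₁ P₂ P₃ P₄ P₅ P₆)) ⟩
    ∑³ Q c + 6 * #P
      ∎
    where
    open ≡-Reasoning
    c e t₁ t₂ t₃ t₄ t₅ t₆ q₁ q₂ q₃ q₄ q₅ q₆ : Quad → Quad → Quad → ℕ
    c x y z = [ comparableᵇ (x ≼ᵇ y) (y ≼ᵇ x) (x ≼ᵇ z) (z ≼ᵇ x) (y ≼ᵇ z) (z ≼ᵇ y) ]ᵇ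
    e x y z = [ x ≈ᵇ y ∧ x ≈ᵇ z ]ᵇ
    t₁ x y z = [ x ≼ᵇ y ∧ y ≼ᵇ z ]ᵇ
    t₂ x y z = [ x ≼ᵇ z ∧ z ≼ᵇ y ]ᵇ
    t₃ x y z = [ y ≼ᵇ x ∧ x ≼ᵇ z ]ᵇ
    t₄ x y z = [ y ≼ᵇ z ∧ z ≼ᵇ x ]ᵇ
    t₅ x y z = [ z ≼ᵇ x ∧ x ≼ᵇ y ]ᵇ
    t₆ x y z = [ z ≼ᵇ y ∧ y ≼ᵇ x ]ᵇ
    -- Each coinciding pair is compared with the third element in both directions. For a comparable
    -- triple with 3, 2 or 1 distinct elements, 0, 1 or 6 of these six terms are 1.
    q₁ x y z = [ x ≈ᵇ y ∧ x ≼ᵇ z ]ᵇ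
    q₂ x y z = [ x ≈ᵇ y ∧ z ≼ᵇ x ]ᵇ
    q₃ x y z = [ x ≈ᵇ z ∧ x ≼ᵇ y ]ᵇ
    q₄ x y z = [ x ≈ᵇ z ∧ y ≼ᵇ x ]ᵇ
    q₅ x y z = [ y ≈ᵇ z ∧ y ≼ᵇ x ]ᵇ
    q₆ x y z = [ y ≈ᵇ z ∧ x ≼ᵇ y ]ᵇ
    sixfold : ∀ n {a b c d e f} → a ≡ n → b ≡ n → c ≡ n → d ≡ n → e ≡ n → f ≡ n →
              a + b + c + d + e + f ≡ 6 * n
    sixfold n refl refl refl refl refl refl = lemma n
      where
      lemma : ∀ n → n + n + n + n + n + n ≡ 6 * n
      lemma = solve-∀
    ∑³-6 : ∀ f₁ f₂ f₃ f₄ f₅ f₆ →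
           ∑³ Q (λ x y z → f₁ x y z + f₂ x y z + f₃ x y z + f₄ x y z + f₅ x y z + f₆ x y z) ≡
           ∑³ Q f₁ + ∑³ Q f₂ + ∑³ Q f₃ + ∑³ Q f₄ + ∑³ Q f₅ + ∑³ Q f₆
    ∑³-6 f₁ f₂ f₃ f₄ f₅ f₆ =
      trans (∑³-+ Q _ f₆) (cong (_+ ∑³ Q f₆)
      (trans (∑³-+ Q _ f₅) (cong (_+ ∑³ Q f₅)
      (trans (∑³-+ Q _ f₄) (cong (_+ ∑³ Q f₄)
      (trans (∑³-+ Q _ f₃) (cong (_+ ∑³ Q f₃)
      (∑³-+ Q f₁ f₂))))))))
    T₁ : ∑³ Q t₁ ≡ #T
    T₁ = refl
    T₂ : ∑³ Q t₂ ≡ #T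
    T₂ = ∑³-swaq₂₃ Q t₁
    T₃ : ∑³ Q t₃ ≡ #T
    T₃ = ∑³-swaq₁₂ Q t₁
    T₄ : ∑³ Q t₄ ≡ #T
    T₄ = trans (∑³-swaq₁₂ Q t₂) T₂
    T₅ : ∑³ Q t₅ ≡ #T
    T₅ = trans (∑³-swaq₂₃ Q t₃) T₃
    T₆ : ∑³ Q t₆ ≡ #T
    T₆ = trans (∑³-swaq₂₃ Q t₄) T₄
    P₁ : ∑³ Q q₁ ≡ #P
    P₁ = ∑³-≈ᵇ _≼ᵇ_
    P₂ : ∑³ Q q₂ ≡ #P
    P₂ = trans (∑³-≈ᵇ (flip _≼ᵇ_)) (∑-swap Q Q _)
    P₃ : ∑³ Q q₃ ≡ #P
    P₃ = trans (∑³-swaq₂₃ Q q₁) P₁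
    P₄ : ∑³ Q q₄ ≡ #P
    P₄ = trans (∑³-swaq₂₃ Q q₂) P₂
    P₅ : ∑³ Q q₅ ≡ #P
    P₅ = trans (∑³-swaq₁₂ Q q₃) P₃
    P₆ : ∑³ Q q₆ ≡ #P
    P₆ = trans (∑³-swaq₁₂ Q q₄) P₄
    E : ∑³ Q e ≡ length Q
    E = trans (∑³-≈ᵇ _≈ᵇ_) (trans (∑-cong Q λ {t} t∈ →
      trans (∑-cong Q λ _ → sym (*-identityʳ _))
            (∑-unique (quads-unique k) t∈ (t ≈ᵇ_) 1 (≈ᵇ-refl t) ≈ᵇ-sound)) (∑-one Q))
    transitive : ∀ x y z → transitiveᵇ (x ≼ᵇ y) (y ≼ᵇ x) (x ≼ᵇ z) (z ≼ᵇ x) (y ≼ᵇ z) (z ≼ᵇ y) ≡ true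
    transitive x y z =
      cong₂ _∧_ (≼-transᵇ x y z) (cong₂ _∧_ (≼-transᵇ x z y) (cong₂ _∧_ (≼-transᵇ y x z)
      (cong₂ _∧_ (≼-transᵇ y z x) (cong₂ _∧_ (≼-transᵇ z x y) (≼-transᵇ z y x)))))
      where
      ≼-transᵇ : ∀ t t′ t″ → (t ≼ᵇ t′ ∧ t′ ≼ᵇ t″ ⇒ᵇ t ≼ᵇ t″) ≡ true
      ≼-transᵇ t t′ t″ = ⇒ᵇ-true (t ≼? t′) (t′ ≼? t″) (t ≼? t″) ≼-trans

-- Permutations as functions on ℕ

-- Extending by the identity keeps inverses inverse and spares all bounds on positions.
ext : 𝔖 n → ℕ → ℕ
ext {n} σ i with i <? n
... | yes i<n = toℕ (σ ⟨$⟩ʳ fromℕ< i<n)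
... | no  _   = i

module _ (σ : 𝔖 n) where

  ext-toℕ : ∀ i → ext σ (toℕ i) ≡ toℕ (σ ⟨$⟩ʳ i)
  ext-toℕ i with toℕ i <? n
  ... | yes i<n = cong (toℕ ∘ (σ ⟨$⟩ʳ_)) (Fin.fromℕ<-toℕ i i<n)
  ... | no  i≮n = contradiction (Fin.toℕ<n i) i≮n

  ext-≥ : ∀ {i} → n ≤ i → ext σ i ≡ i
  ext-≥ {i} n≤i with i <? n
  ... | yes i<n = contradiction i<n (≤⇒≯ n≤i)
  ... | no  _   = refl

  ext-< : ∀ {i} → i < n → ext σ i < n
  ext-< {i} i<n with i <? n
  ... | yes _   = Fin.toℕ<n _
  ... | no  i≮n = contradiction i<n i≮n

  ext-flip : ∀ i → ext (Perm.flip σ) (ext σ i) ≡ i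
  ext-flip i with i <? n
  ... | no  i≮n = ext-≥′ (≮⇒≥ i≮n)
    where
    ext-≥′ : ∀ {i} → n ≤ i → ext (Perm.flip σ) i ≡ i
    ext-≥′ {i} n≤i with i <? n
    ... | yes i<n = contradiction i<n (≤⇒≯ n≤i)
    ... | no  _   = refl
  ... | yes i<n with toℕ (σ ⟨$⟩ʳ fromℕ< i<n) <? n
  ...   | no  ≮n = contradiction (Fin.toℕ<n _) ≮n
  ...   | yes <n = begin
    toℕ (σ ⟨$⟩ˡ fromℕ< <n)                 ≡⟨ cong (toℕ ∘ (σ ⟨$⟩ˡ_)) (Fin.fromℕ<-toℕ _ <n) ⟩
    toℕ (σ ⟨$⟩ˡ (σ ⟨$⟩ʳ fromℕ< i<n))       ≡⟨ cong toℕ (inverseˡ σ) ⟩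
    toℕ (fromℕ< i<n)                       ≡⟨ Fin.toℕ-fromℕ< i<n ⟩
    i                                      ∎
    where open ≡-Reasoning

toℕ-elim : ∀ (P : ℕ → Set) → (∀ (i : Fin n) → P (toℕ i)) → ∀ {i} → i < n → P i
toℕ-elim P p i<n = subst P (Fin.toℕ-fromℕ< i<n) (p (fromℕ< i<n))

ext-elim : ∀ (P : ℕ → Set) → (∀ (i : Fin n) → P (toℕ i)) → (∀ {i} → n ≤ i → P i) → ∀ i → P i
ext-elim {n} P inside outside i with i <? n
... | yes i<n = toℕ-elim P inside i<n
... | no  i≮n = outside (≮⇒≥ i≮n)

ext-injective : ∀ (σ τ : 𝔖 n) → ext σ ≗ ext τ → σ ≈ τ
ext-injective σ τ eq i = Fin.toℕ-injective (trans (sym (ext-toℕ σ i)) (trans (eq (toℕ i)) (ext-toℕ τ i)))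

≈⇒ext-≗ : ∀ {σ τ : 𝔖 n} → σ ≈ τ → ext σ ≗ ext τ
≈⇒ext-≗ {σ = σ} {τ} eq = ext-elim (λ i → ext σ i ≡ ext τ i)
  (λ i → trans (ext-toℕ σ i) (trans (cong toℕ (eq i)) (sym (ext-toℕ τ i))))
  (λ n≤i → trans (ext-≥ σ n≤i) (sym (ext-≥ τ n≤i)))

module _ (f g : ℕ → ℕ) (g∘f : ∀ i → g (f i) ≡ i) (f∘g : ∀ i → f (g i) ≡ i)
         (f< : ∀ {i} → i < n → f i < n) (g< : ∀ {i} → i < n → g i < n) where

  restrict : 𝔖 n
  restrict = permutation
    (λ i → fromℕ< (f< (Fin.toℕ<n i))) (λ i → fromℕ< (g< (Fin.toℕ<n i)))
    (λ i → Fin.toℕ-injective (trans (Fin.toℕ-fromℕ< _) (trans (cong f (Fin.toℕ-fromℕ< _)) (f∘g (toℕ i)))))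
    (λ i → Fin.toℕ-injective (trans (Fin.toℕ-fromℕ< _) (trans (cong g (Fin.toℕ-fromℕ< _)) (g∘f (toℕ i)))))

  ext-restrict : (∀ {i} → n ≤ i → f i ≡ i) → ext restrict ≗ f
  ext-restrict f≥ = ext-elim (λ i → ext restrict i ≡ f i)
    (λ i → trans (ext-toℕ restrict i) (Fin.toℕ-fromℕ< _))
    (λ n≤i → trans (ext-≥ restrict n≤i) (sym (f≥ n≤i)))

-- Reductions

transpose-i : ∀ (i j : Fin n) → transpose i j ⟨$⟩ʳ i ≡ j
transpose-i i j rewrite proj₂ (dec-yes (i Fin.≟ i) refl) = refl

transpose-j : ∀ (i j : Fin n) → transpose i j ⟨$⟩ʳ j ≡ i
transpose-j i j with j Fin.≟ i
... | yes j≡i = j≡i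
... | no  _ rewrite proj₂ (dec-yes (j Fin.≟ j) refl) = refl

transpose-k : ∀ {i j k : Fin n} → k ≢ i → k ≢ j → transpose i j ⟨$⟩ʳ k ≡ k
transpose-k {i = i} {j} {k} k≢i k≢j rewrite dec-no (k Fin.≟ i) k≢i | dec-no (k Fin.≟ j) k≢j = refl

module _ (σ : 𝔖 n) {i j : ℕ} (i<j : i < j) (j<n : j < n) (σj<σi : ext σ j < ext σ i) where

  private
    i<n = <-trans i<j j<n
    i′ j′ : Fin n
    i′ = fromℕ< i<n
    j′ = fromℕ< j<n
    toℕ-i′ : toℕ i′ ≡ i
    toℕ-i′ = Fin.toℕ-fromℕ< i<n
    toℕ-j′ : toℕ j′ ≡ j
    toℕ-j′ = Fin.toℕ-fromℕ< j<n
    σi : ext σ i ≡ toℕ (σ ⟨$⟩ʳ i′)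
    σi = trans (cong (ext σ) (sym toℕ-i′)) (ext-toℕ σ i′)
    σj : ext σ j ≡ toℕ (σ ⟨$⟩ʳ j′)
    σj = trans (cong (ext σ) (sym toℕ-j′)) (ext-toℕ σ j′)

  swapped : 𝔖 n
  swapped = transpose i′ j′ ∘ₚ σ

  swapped-⟶ : σ ⟶ swapped
  swapped-⟶ = reduce (subst₂ _<_ (sym toℕ-i′) (sym toℕ-j′) i<j) (subst₂ _<_ σj σi σj<σi)

  ext-swapped-i : ext swapped i ≡ ext σ j
  ext-swapped-i = trans (cong (ext swapped) (sym toℕ-i′)) (trans (ext-toℕ swapped i′)
    (trans (cong (toℕ ∘ (σ ⟨$⟩ʳ_)) (transpose-i i′ j′)) (sym σj)))

  ext-swapped-j : ext swapped j ≡ ext σ i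
  ext-swapped-j = trans (cong (ext swapped) (sym toℕ-j′)) (trans (ext-toℕ swapped j′)
    (trans (cong (toℕ ∘ (σ ⟨$⟩ʳ_)) (transpose-j i′ j′)) (sym σi)))

  ext-swapped-k : ∀ {k} → k ≢ i → k ≢ j → ext swapped k ≡ ext σ k
  ext-swapped-k {k} = ext-elim (λ k → k ≢ i → k ≢ j → ext swapped k ≡ ext σ k)
    (λ k k≢i k≢j → trans (ext-toℕ swapped k)
      (trans (cong (toℕ ∘ (σ ⟨$⟩ʳ_)) (transpose-k
                (λ { refl → k≢i toℕ-i′ }) (λ { refl → k≢j toℕ-j′ })))
             (sym (ext-toℕ σ k))))
    (λ n≤k _ _ → trans (ext-≥ swapped n≤k) (sym (ext-≥ σ n≤k))) k

⟶-≤ᴮ : ∀ {π σ σ₁ : 𝔖 n} → σ ⟶ σ₁ → π ≤ᴮ σ₁ → π ≤ᴮ σ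
⟶-≤ᴮ s (ρ , steps , ρ≈π) = ρ , s ◅ steps , ρ≈π

≈⇒≤ᴮ : ∀ {π σ : 𝔖 n} → σ ≈ π → π ≤ᴮ σ
≈⇒≤ᴮ σ≈π = _ , ε , σ≈π

-- Whether an exchange is a reduction depends only on the entries, so the same exchanges can be
-- replayed from σ′.
≤ᴮ-respʳ-≈ : ∀ {π σ σ′ : 𝔖 n} → σ ≈ σ′ → π ≤ᴮ σ → π ≤ᴮ σ′
≤ᴮ-respʳ-≈ {π = π} {σ} {σ′} σ≈σ′ (ρ , ε , ρ≈π) =
  ≈⇒≤ᴮ {π = π} {σ′} λ i → trans (sym (σ≈σ′ i)) (ρ≈π i)
≤ᴮ-respʳ-≈ {π = π} {σ} {σ′} σ≈σ′ (ρ , reduce {i} {j} i<j σi>σj ◅ steps , ρ≈π) =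
  ⟶-≤ᴮ {π = π} (reduce i<j (subst₂ Fin._<_ (σ≈σ′ j) (σ≈σ′ i) σi>σj))
    (≤ᴮ-respʳ-≈ {π = π} {transpose i j ∘ₚ σ} {transpose i j ∘ₚ σ′}
      (λ k → σ≈σ′ (transpose i j ⟨$⟩ʳ k)) (ρ , steps , ρ≈π))

≤ᴮ-trans : ∀ {π ρ σ : 𝔖 n} → π ≤ᴮ ρ → ρ ≤ᴮ σ → π ≤ᴮ σ
≤ᴮ-trans {π = π} {ρ} π≤ρ (ρ′ , ε , ρ′≈ρ) = ≤ᴮ-respʳ-≈ {π = π} {ρ} {ρ′} (λ i → sym (ρ′≈ρ i)) π≤ρ
≤ᴮ-trans {π = π} {ρ} π≤ρ (ρ′ , s ◅ steps , ρ′≈ρ) =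
  ⟶-≤ᴮ {π = π} s (≤ᴮ-trans {π = π} {ρ} π≤ρ (ρ′ , steps , ρ′≈ρ))

-- A reduction replaces the entries (i, v), (j, w) with i < j and w < v by (i, w), (j, v). A
-- condition closed under this exchange therefore passes from σ to everything below it, which gives
-- the necessary conditions for comparability.
≤ᴮ-invariant : ∀ (K : ℕ → ℕ → Set) →
  (∀ {i j v w} → i < j → w < v → K i v → K j w → K i w × K j v) →
  ∀ {π σ : 𝔖 n} → π ≤ᴮ σ → (∀ i → K i (ext σ i)) → ∀ {i} → i < n → K i (ext π i)
≤ᴮ-invariant {n} K swappable {π} {σ} (ρ , steps , ρ≈π) Kσ = toℕ-elim (λ i → K i (ext π i)) λ i →
  subst (K (toℕ i)) (trans (cong toℕ (ρ≈π i)) (sym (ext-toℕ π i)))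
    (go steps (λ i → subst (K (toℕ i)) (ext-toℕ σ i) (Kσ (toℕ i))) i)
  where
  Inv : 𝔖 n → Set
  Inv σ = ∀ i → K (toℕ i) (toℕ (σ ⟨$⟩ʳ i))
  preserve : ∀ {σ τ} → σ ⟶ τ → Inv σ → Inv τ
  preserve {σ} (reduce {i} {j} i<j σi>σj) inv k with k Fin.≟ i
  ... | yes refl = proj₁ (swappable i<j σi>σj (inv i) (inv j))
  ... | no _ with k Fin.≟ j
  ...   | yes refl = proj₂ (swappable i<j σi>σj (inv i) (inv j))
  ...   | no _ = inv k
  go : ∀ {σ τ} → Star _⟶_ σ τ → Inv σ → Inv τ
  go ε            inv = inv
  go (s ◅ steps)  inv = go steps (preserve s inv)

-- Moving the small value u 0 = σ(m) leftwards across u 1 < ⋯ < u d.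
hopˡ : ∀ d i m (u : ℕ → ℕ) {σ τ : 𝔖 n} → i + d ≤ m → m < n →
       (∀ {k} → k < d → u k < u (suc k)) →
       ext σ m ≡ u 0 → (∀ {k} → k < d → ext σ (i + k) ≡ u (suc k)) →
       ext τ m ≡ u d → (∀ {k} → k < d → ext τ (i + k) ≡ u k) →
       (∀ {k} → k ≢ m → k < i ⊎ i + d ≤ k → ext τ k ≡ ext σ k) →
       τ ≤ᴮ σ
hopˡ zero i m u {σ} {τ} i+d≤m m<n inc σm σi τm τi same =
  ≈⇒≤ᴮ {π = τ} {σ} (ext-injective σ τ eq)
  where
  eq : ext σ ≗ ext τ
  eq k with k ≟ m
  ... | yes refl = trans σm (sym τm)
  ... | no  k≢m with <-≤-connex k i
  ...   | inj₁ k<i = sym (same k≢m (inj₁ k<i))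
  ...   | inj₂ i≤k = sym (same k≢m (inj₂ (subst (_≤ k) (sym (+-identityʳ i)) i≤k)))
hopˡ (suc d) i m u {σ} {τ} i+d≤m m<n inc σm σi τm τi same =
  -- Position m is a buffer: after the exchange with position i it holds u 1, and the same task
  -- remains for u shifted by one.
  ⟶-≤ᴮ {π = τ} (swapped-⟶ σ i<m m<n σm<σi)
    (hopˡ d (suc i) m (u ∘ suc) {σ₁} {τ} (subst (_≤ m) (+-suc i d) i+d≤m) m<n (inc ∘ s≤s)
      (trans (ext-swapped-j σ i<m m<n σm<σi) σi0)
      (λ {k} k<d → trans (ext-swapped-k σ i<m m<n σm<σi (λ eq → m≢1+m+n i (sym eq))
          (<⇒≢ (<-≤-trans (subst (suc i + k <_) (sym (+-suc i d)) (+-monoʳ-< (suc i) k<d)) i+d≤m)))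
        (trans (cong (ext σ) (sym (+-suc i k))) (σi (s≤s k<d))))
      τm
      (λ {k} k<d → trans (cong (ext τ) (sym (+-suc i k))) (τi (s≤s k<d)))
      same′)
  where
  i<m : i < m
  i<m = <-≤-trans (m<m+n i (s≤s z≤n)) i+d≤m
  σi0 : ext σ i ≡ u 1
  σi0 = trans (cong (ext σ) (sym (+-identityʳ i))) (σi (s≤s z≤n))
  σm<σi : ext σ m < ext σ i
  σm<σi = subst₂ _<_ (sym σm) (sym σi0) (inc (s≤s z≤n))
  σ₁ = swapped σ i<m m<n σm<σi
  same′ : ∀ {k} → k ≢ m → k < suc i ⊎ suc i + d ≤ k → ext τ k ≡ ext σ₁ k
  same′ {k} k≢m out with k ≟ i
  ... | yes refl = trans (cong (ext τ) (sym (+-identityʳ i))) (trans (τi (s≤s z≤n))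
                     (trans (sym σm) (sym (ext-swapped-i σ i<m m<n σm<σi))))
  ... | no  k≢i  = trans (same k≢m (shrink out)) (sym (ext-swapped-k σ i<m m<n σm<σi k≢i k≢m))
    where
    shrink : k < suc i ⊎ suc i + d ≤ k → k < i ⊎ i + suc d ≤ k
    shrink (inj₁ k≤i) = inj₁ (≤∧≢⇒< (s≤s⁻¹ k≤i) k≢i)
    shrink (inj₂ i≤k) = inj₂ (subst (_≤ k) (sym (+-suc i d)) i≤k)

-- Moving the large value u d = σ(m) rightwards across u 0 < ⋯ < u (d - 1).
hopʳ : ∀ d i m (u : ℕ → ℕ) {σ τ : 𝔖 n} → m < i → i + d ≤ n →
       (∀ {k} → k < d → u k < u (suc k)) →
       ext σ m ≡ u d → (∀ {k} → k < d → ext σ (i + k) ≡ u k) →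
       ext τ m ≡ u 0 → (∀ {k} → k < d → ext τ (i + k) ≡ u (suc k)) →
       (∀ {k} → k ≢ m → k < i ⊎ i + d ≤ k → ext τ k ≡ ext σ k) →
       τ ≤ᴮ σ
hopʳ zero i m u {σ} {τ} m<i i+d≤n inc σm σi τm τi same =
  ≈⇒≤ᴮ {π = τ} {σ} (ext-injective σ τ eq)
  where
  eq : ext σ ≗ ext τ
  eq k with k ≟ m
  ... | yes refl = trans σm (sym τm)
  ... | no  k≢m with <-≤-connex k i
  ...   | inj₁ k<i = sym (same k≢m (inj₁ k<i))
  ...   | inj₂ i≤k = sym (same k≢m (inj₂ (subst (_≤ k) (sym (+-identityʳ i)) i≤k)))
hopʳ {n} (suc d) i m u {σ} {τ} m<i i+d≤n inc σm σi τm τi same =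
  -- Here the exchanges start at the far end: position m receives u d, and the remaining task has
  -- one position fewer.
  ⟶-≤ᴮ {π = τ} (swapped-⟶ σ m<j j<n σj<σm)
    (hopʳ d i m u {σ₁} {τ} m<i (<⇒≤ j<n) (inc ∘ m<n⇒m<1+n)
      (trans (ext-swapped-i σ m<j j<n σj<σm) (σi (n<1+n d)))
      (λ {k} k<d → trans (ext-swapped-k σ m<j j<n σj<σm
          (>⇒≢ (<-≤-trans m<i (m≤m+n i k))) (<⇒≢ (+-monoʳ-< i k<d)))
        (σi (m<n⇒m<1+n k<d)))
      τm
      (τi ∘ m<n⇒m<1+n)
      same′)
  where
  m<j : m < i + d
  m<j = <-≤-trans m<i (m≤m+n i d)
  j<n : i + d < n
  j<n = subst (_≤ n) (+-suc i d) i+d≤n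
  σj<σm : ext σ (i + d) < ext σ m
  σj<σm = subst₂ _<_ (sym (σi (n<1+n d))) (sym σm) (inc (n<1+n d))
  σ₁ = swapped σ m<j j<n σj<σm
  same′ : ∀ {k} → k ≢ m → k < i ⊎ i + d ≤ k → ext τ k ≡ ext σ₁ k
  same′ {k} k≢m out with k ≟ i + d
  ... | yes refl = trans (τi (n<1+n d)) (trans (sym σm) (sym (ext-swapped-j σ m<j j<n σj<σm)))
  ... | no  k≢j  = trans (same k≢m (shrink out)) (sym (ext-swapped-k σ m<j j<n σj<σm k≢m k≢j))
    where
    shrink : k < i ⊎ i + d ≤ k → k < i ⊎ i + suc d ≤ k
    shrink (inj₁ k<i) = inj₁ k<i
    shrink (inj₂ j≤k) = inj₂ (subst (_≤ k) (sym (+-suc i d)) (≤∧≢⇒< j≤k (k≢j ∘ sym)))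

-- Functions that interchange two adjacent blocks

-- With X = b - a and Y = c - b, the Y larger values come first and are raised by X, then the X
-- smaller ones follow, lowered by Y. Everything is written as an offset from a, without subtraction
-- and independently of n.
record Block (a X Y : ℕ) (f : ℕ → ℕ) : Set where
  field
    left  : ∀ {i} → i < a → f i ≡ i
    mid₁  : ∀ {j} → j < Y → f (a + j) ≡ a + (X + j)
    mid₂  : ∀ {j} → j < X → f (a + (Y + j)) ≡ a + j
    right : ∀ j → f (a + (Y + (X + j))) ≡ a + (Y + (X + j))

  mid₁-at : ∀ {i j} → i ≡ a + j → j < Y → f i ≡ a + (X + j)
  mid₁-at refl = mid₁

  mid₂-at : ∀ {i j} → i ≡ a + (Y + j) → j < X → f i ≡ a + j
  mid₂-at refl = mid₂

  right-at : ∀ {i} j → i ≡ a + (Y + (X + j)) → f i ≡ i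
  right-at j refl = right j

data Region (a X Y : ℕ) : ℕ → Set where
  left  : ∀ {i} → i < a → Region a X Y i
  mid₁  : ∀ j → j < Y → Region a X Y (a + j)
  mid₂  : ∀ j → j < X → Region a X Y (a + (Y + j))
  right : ∀ j → Region a X Y (a + (Y + (X + j)))

region : ∀ a X Y i → Region a X Y i
region a X Y i with <-≤-connex i a
... | inj₁ i<a = left i<a
... | inj₂ a≤i with j , refl ← m≤n⇒∃[o]m+o≡n a≤i with <-≤-connex j Y
...   | inj₁ j<Y = mid₁ j j<Y
...   | inj₂ Y≤j with j′ , refl ← m≤n⇒∃[o]m+o≡n Y≤j with <-≤-connex j′ X
...     | inj₁ j′<X = mid₂ j′ j′<X
...     | inj₂ X≤j′ with j″ , refl ← m≤n⇒∃[o]m+o≡n X≤j′ = right j″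

Block-unique : ∀ {a X Y f g} → Block a X Y f → Block a X Y g → f ≗ g
Block-unique {a} {X} {Y} F G i with region a X Y i
... | left i<a   = trans (Block.left F i<a) (sym (Block.left G i<a))
... | mid₁ j j<Y = trans (Block.mid₁ F j<Y) (sym (Block.mid₁ G j<Y))
... | mid₂ j j<X = trans (Block.mid₂ F j<X) (sym (Block.mid₂ G j<X))
... | right j    = trans (Block.right F j) (sym (Block.right G j))

Block-inverse : ∀ {a X Y f g} → Block a X Y f → Block a Y X g → ∀ i → g (f i) ≡ i
Block-inverse {a} {X} {Y} {f} {g} F G i with region a X Y i
... | left i<a   = trans (cong g (Block.left F i<a)) (Block.left G i<a)
... | mid₁ j j<Y = trans (cong g (Block.mid₁ F j<Y)) (Block.mid₂ G j<Y)
... | mid₂ j j<X = trans (cong g (Block.mid₂ F j<X)) (Block.mid₁ G j<X)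
... | right j    = trans (cong g (Block.right F j)) (Block.right-at G j (cong (a +_) (swap Y X j)))

Block-resp-≗ : ∀ {a X Y f g} → f ≗ g → Block a X Y f → Block a X Y g
Block-resp-≗ f≗g F = record
  { left  = λ i<a → trans (sym (f≗g _)) (Block.left F i<a)
  ; mid₁  = λ j<Y → trans (sym (f≗g _)) (Block.mid₁ F j<Y)
  ; mid₂  = λ j<X → trans (sym (f≗g _)) (Block.mid₂ F j<X)
  ; right = λ j → trans (sym (f≗g _)) (Block.right F j)
  }

rotate : (X Y i : ℕ) → ℕ
rotate X Y i with <-≤-connex i Y
... | inj₁ _ = X + i
... | inj₂ _ with <-≤-connex (i ∸ Y) X
...   | inj₁ _ = i ∸ Y
...   | inj₂ _ = i

block : (a X Y i : ℕ) → ℕ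
block zero    X Y i       = rotate X Y i
block (suc a) X Y zero    = zero
block (suc a) X Y (suc i) = suc (block a X Y i)

block-Block : ∀ a X Y → Block a X Y (block a X Y)
block-Block zero X Y = record
  { left = λ (); mid₁ = rotate-< _; mid₂ = rotate-≥ _; right = rotate-right }
  where
  rotate-< : ∀ j → j < Y → rotate X Y j ≡ X + j
  rotate-< j j<Y with <-≤-connex j Y
  ... | inj₁ _   = refl
  ... | inj₂ Y≤j = contradiction j<Y (≤⇒≯ Y≤j)
  rotate-≥ : ∀ j → j < X → rotate X Y (Y + j) ≡ j
  rotate-≥ j j<X with <-≤-connex (Y + j) Y
  ... | inj₁ Y+j<Y = contradiction Y+j<Y (m+n≮m Y j)
  ... | inj₂ _ with <-≤-connex (Y + j ∸ Y) X
  ...   | inj₁ _ = m+n∸m≡n Y j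
  ...   | inj₂ X≤ = contradiction (subst (X ≤_) (m+n∸m≡n Y j) X≤) (<⇒≱ j<X)
  rotate-right : ∀ j → rotate X Y (Y + (X + j)) ≡ Y + (X + j)
  rotate-right j with <-≤-connex (Y + (X + j)) Y
  ... | inj₁ Y+<Y = contradiction Y+<Y (m+n≮m Y (X + j))
  ... | inj₂ _ with <-≤-connex (Y + (X + j) ∸ Y) X
  ...   | inj₁ <X = contradiction (subst (_< X) (m+n∸m≡n Y (X + j)) <X) (m+n≮m X j)
  ...   | inj₂ _  = refl
block-Block (suc a) X Y = record
  { left  = λ { {zero} _ → refl ; {suc i} (s≤s i<a) → cong suc (Block.left rec i<a) }
  ; mid₁  = cong suc ∘ Block.mid₁ rec
  ; mid₂  = cong suc ∘ Block.mid₂ rec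
  ; right = cong suc ∘ Block.right rec
  }
  where rec = block-Block a X Y

Block-< : ∀ {a X Y f} → Block a X Y f → a + (X + Y) ≤ n → ∀ {i} → i < n → f i < n
Block-< {n} {a} {X} {Y} F fits {i} i<n with region a X Y i
... | left i<a   = subst (_< n) (sym (Block.left F i<a)) i<n
... | mid₁ j j<Y = subst (_< n) (sym (Block.mid₁ F j<Y))
                     (<-≤-trans (+-monoʳ-< a (+-monoʳ-< X j<Y)) fits)
... | mid₂ j j<X = subst (_< n) (sym (Block.mid₂ F j<X))
                     (≤-<-trans (+-monoʳ-≤ a (m≤n+m j Y)) i<n)
... | right j    = subst (_< n) (sym (Block.right F j)) i<n

Block-≥ : ∀ {a X Y f} → Block a X Y f → ∀ {i} → a + (X + Y) ≤ i → f i ≡ i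
Block-≥ {a} {X} {Y} F a+X+Y≤i with j , refl ← m≤n⇒∃[o]m+o≡n a+X+Y≤i =
  Block.right-at F j (rearrange a X Y j)
  where
  rearrange : ∀ a X Y j → a + (X + Y) + j ≡ a + (Y + (X + j))
  rearrange = solve-∀

module _ {n} (a X Y : ℕ) (fits : a + (X + Y) ≤ n) where

  private
    F : Block a X Y (block a X Y)
    F = block-Block a X Y
    G : Block a Y X (block a Y X)
    G = block-Block a Y X
    fits′ : a + (Y + X) ≤ n
    fits′ = subst (λ k → a + k ≤ n) (+-comm X Y) fits

  blockPerm : 𝔖 n
  blockPerm = restrict (block a X Y) (block a Y X) (Block-inverse F G) (Block-inverse G F)
                (Block-< F fits) (Block-< G fits′)

  blockPerm-Block : Block a X Y (ext blockPerm)
  blockPerm-Block = Block-resp-≗ (λ i → sym (ext-restrict (block a X Y) (block a Y X)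
    (Block-inverse F G) (Block-inverse G F) (Block-< F fits) (Block-< G fits′)
    (λ n≤i → Block-≥ F (≤-trans fits n≤i)) i)) F

-- Bruhat order on blocks

module _ {a X Y a′ X′ Y′ : ℕ} {π σ : 𝔖 n} (π≤σ : π ≤ᴮ σ)
         (F : Block a (suc X) (suc Y) (ext π)) (F′ : Block a′ (suc X′) (suc Y′) (ext σ))
         (fits : a + (suc X + suc Y) ≤ n) where

  private
    a<n : a < n
    a<n = <-≤-trans (m<m+n a (s≤s z≤n)) fits
    πa : ext π a ≡ a + suc X
    πa = trans (Block.mid₁-at F (sym (+-identityʳ a)) (s≤s z≤n)) (cong (a +_) (+-identityʳ (suc X)))

  -- On positions below a′ the entries of σ satisfy v ≤ i, and this survives reductions. Position a
  -- of π holds a + suc X, so it cannot be one of them.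
  ≤ᴮ⇒a≥a′ : a′ ≤ a
  ≤ᴮ⇒a≥a′ = ≮⇒≥ λ a<a′ → m+1+n≰m a (subst (_≤ a) πa
    (≤ᴮ-invariant (λ i v → i < a′ → v ≤ i)
      (λ i<j w<v Ki Kj →
        (λ i<a′ → ≤-trans (<⇒≤ w<v) (Ki i<a′)) ,
        (λ j<a′ → ≤-trans (Ki (<-trans i<j j<a′)) (<⇒≤ i<j)))
      {π} {σ} π≤σ (λ i i<a′ → ≤-reflexive (Block.left F′ i<a′)) a<n a<a′))

  -- Reductions never increase the largest upward displacement v - i. It is at most suc X′ for σ,
  -- and position a of π attains suc X.
  ≤ᴮ⇒X≤X′ : X ≤ X′
  ≤ᴮ⇒X≤X′ = s≤s⁻¹ (+-cancelˡ-≤ a _ _ (subst (_≤ a + suc X′) πa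
    (≤ᴮ-invariant (λ i v → v ≤ i + suc X′)
      (λ i<j w<v Ki Kj → ≤-trans (<⇒≤ w<v) Ki , ≤-trans Ki (+-monoˡ-≤ (suc X′) (<⇒≤ i<j)))
      {π} {σ} π≤σ bound a<n)))
    where
    bound : ∀ i → ext σ i ≤ i + suc X′
    bound i with region a′ (suc X′) (suc Y′) i
    ... | left i<a   = subst (_≤ _) (sym (Block.left F′ i<a)) (m≤m+n i (suc X′))
    ... | mid₁ j j<Y = subst (_≤ _) (sym (Block.mid₁ F′ j<Y)) (≤-reflexive (rearrange a′ (suc X′) j))
      where
      rearrange : ∀ a X j → a + (X + j) ≡ a + j + X
      rearrange = solve-∀
    ... | mid₂ j j<X = subst (_≤ _) (sym (Block.mid₂ F′ j<X))
                         (≤-trans (+-monoʳ-≤ a′ (m≤n+m j (suc Y′))) (m≤m+n _ (suc X′)))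
    ... | right j    = subst (_≤ _) (sym (Block.right F′ j)) (m≤m+n _ (suc X′))

  -- The same for the downward displacement i - v, which is suc Y where the second block of π
  -- begins.
  ≤ᴮ⇒Y≤Y′ : Y ≤ Y′
  ≤ᴮ⇒Y≤Y′ = s≤s⁻¹ (+-cancelˡ-≤ a _ _ (subst (λ v → a + suc Y ≤ v + suc Y′) πi
    (≤ᴮ-invariant (λ i v → i ≤ v + suc Y′)
      (λ i<j w<v Ki Kj → ≤-trans (<⇒≤ i<j) Kj , ≤-trans Kj (+-monoˡ-≤ (suc Y′) (<⇒≤ w<v)))
      {π} {σ} π≤σ bound (<-≤-trans (+-monoʳ-< a (m<n+m (suc Y) (s≤s z≤n))) fits))))
    where
    πi : ext π (a + suc Y) ≡ a
    πi = trans (Block.mid₂-at F (cong (a +_) (sym (+-identityʳ (suc Y)))) (s≤s z≤n)) (+-identityʳ a)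
    bound : ∀ i → i ≤ ext σ i + suc Y′
    bound i with region a′ (suc X′) (suc Y′) i
    ... | left i<a   = subst (λ v → i ≤ v + suc Y′) (sym (Block.left F′ i<a)) (m≤m+n i (suc Y′))
    ... | mid₁ j j<Y = subst (λ v → _ ≤ v + suc Y′) (sym (Block.mid₁ F′ j<Y))
                         (≤-trans (+-monoʳ-≤ a′ (m≤n+m j (suc X′))) (m≤m+n _ (suc Y′)))
    ... | mid₂ j j<X = subst (λ v → _ ≤ v + suc Y′) (sym (Block.mid₂ F′ j<X)) (≤-reflexive (rearrange a′ (suc Y′) j))
      where
      rearrange : ∀ a Y j → a + (Y + j) ≡ a + j + Y
      rearrange = solve-∀
    ... | right j    = subst (λ v → _ ≤ v + suc Y′) (sym (Block.right F′ j)) (m≤m+n _ (suc Y′))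

  -- From `end′` on, σ satisfies i ≤ v. The last entry of the second block of π lies below its
  -- position, so that position comes before `end′`.
  ≤ᴮ⇒end≤end′ : a + (suc X + suc Y) ≤ a′ + (suc X′ + suc Y′)
  ≤ᴮ⇒end≤end′ = subst (_≤ end′) (rearrange a X Y) (≰⇒> λ end′≤i → m+1+n≰m (a + X) (begin
    a + X + suc Y           ≡⟨ reorder a X Y ⟩
    a + (suc Y + X)         ≤⟨ ≤ᴮ-invariant (λ i v → end′ ≤ i → i ≤ v)
      (λ i<j w<v Ki Kj →
        (λ c≤i → ≤-trans (<⇒≤ i<j) (Kj (≤-trans c≤i (<⇒≤ i<j)))) ,
        (λ c≤j → ≤-trans (Kj c≤j) (<⇒≤ w<v)))
      {π} {σ} π≤σ (λ i c≤i → ≤-reflexive (sym (Block-≥ F′ c≤i)))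
      (subst (_≤ n) (sym (rearrange a X Y)) fits) end′≤i ⟩
    ext π (a + (suc Y + X)) ≡⟨ Block.mid₂ F (n<1+n X) ⟩
    a + X                   ∎))
    where
    open ≤-Reasoning
    end′ = a′ + (suc X′ + suc Y′)
    rearrange : ∀ a X Y → suc (a + (suc Y + X)) ≡ a + (suc X + suc Y)
    rearrange = solve-∀
    reorder : ∀ a X Y → a + X + suc Y ≡ a + (suc Y + X)
    reorder = solve-∀

-- The four elementary steps down: one unit of the length of the first or
-- second block is moved to the fixed points on the left or on the right.

module _ {a X Y : ℕ} {σ τ : 𝔖 n} where

  -- The value a, at the start of the second block, travels left across the whole first block to
  -- position a and becomes a fixed point.
  shrink-X-left : Block (suc a) X (suc Y) (ext σ) → Block a (suc X) (suc Y) (ext τ) →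
                  a + (suc X + suc Y) ≤ n → σ ≤ᴮ τ
  shrink-X-left F G fits = hopˡ (suc Y) a (a + suc Y) u {τ} {σ} ≤-refl
    (<-≤-trans (+-monoʳ-< a (m<n+m (suc Y) (s≤s z≤n))) fits)
    (λ {k} _ → increasing k)
    (trans (Block.mid₂-at G (cong (a +_) (sym (+-identityʳ (suc Y)))) (s≤s z≤n)) (+-identityʳ a))
    (Block.mid₁ G)
    (trans (Block.mid₁-at F (+-suc a Y) (n<1+n Y)) (sym (+-suc a (X + Y))))
    σ-moved
    outside
    where
    u : ℕ → ℕ
    u zero    = a
    u (suc k) = a + (suc X + k)
    increasing : ∀ k → u k < u (suc k)
    increasing zero    = m<m+n a (s≤s z≤n)
    increasing (suc k) = +-monoʳ-< a (+-monoʳ-< (suc X) (n<1+n k))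
    σ-moved : ∀ {k} → k < suc Y → ext σ (a + k) ≡ u k
    σ-moved {zero}  _   = trans (Block.left F (subst (_< suc a) (sym (+-identityʳ a)) (n<1+n a))) (+-identityʳ a)
    σ-moved {suc k} k<Y = trans (Block.mid₁-at F (+-suc a k) (<⇒≤ k<Y)) (sym (+-suc a (X + k)))
    outside : ∀ {k} → k ≢ a + suc Y → k < a ⊎ a + suc Y ≤ k → ext σ k ≡ ext τ k
    outside k≢m (inj₁ k<a) = trans (Block.left F (m<n⇒m<1+n k<a)) (sym (Block.left G k<a))
    outside {k} k≢m (inj₂ m≤k) with region (suc a) X (suc Y) k
    ... | left k≤a   = contradiction (≤-trans m≤k (s≤s⁻¹ k≤a)) (m+1+n≰m a)
    ... | mid₁ j j<Y = contradiction
      (≤-antisym (subst (_≤ a + suc Y) (+-suc a j) (+-monoʳ-≤ a j<Y)) m≤k) k≢m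
    ... | mid₂ j j<X = trans (Block.mid₂ F j<X) (sym (trans
      (Block.mid₂-at G (rearrange a Y j) (s≤s j<X)) (+-suc a j)))
      where
      rearrange : ∀ a Y j → suc a + (suc Y + j) ≡ a + (suc Y + suc j)
      rearrange = solve-∀
    ... | right j    = trans (Block.right F j) (sym (Block.right-at G j (rearrange a X Y j)))
      where
      rearrange : ∀ a X Y j → suc a + (suc Y + (X + j)) ≡ a + (suc Y + (suc X + j))
      rearrange = solve-∀

  -- The last value of the second block travels left across the first block; the position that it
  -- vacates receives the largest value, which belongs there.
  shrink-X-right : Block a X Y (ext σ) → Block a (suc X) Y (ext τ) →
                   a + (suc X + Y) ≤ n → σ ≤ᴮ τ
  shrink-X-right F G fits = hopˡ Y a (a + (Y + X)) u {τ} {σ} (+-monoʳ-≤ a (m≤m+n Y X))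
    (subst (_≤ n) (rearrange a X Y) fits)
    (λ {k} _ → +-monoʳ-< a (+-monoʳ-< X (n<1+n k)))
    (trans (Block.mid₂ G (n<1+n X)) (cong (a +_) (sym (+-identityʳ X))))
    (λ {k} k<Y → trans (Block.mid₁ G k<Y) (cong (a +_) (sym (+-suc X k))))
    (trans (Block.right-at F 0 (cong (λ i → a + (Y + i)) (sym (+-identityʳ X)))) (cong (a +_) (+-comm Y X)))
    (Block.mid₁ F)
    outside
    where
    u : ℕ → ℕ
    u k = a + (X + k)
    rearrange : ∀ a X Y → a + (suc X + Y) ≡ suc (a + (Y + X))
    rearrange = solve-∀
    outside : ∀ {k} → k ≢ a + (Y + X) → k < a ⊎ a + Y ≤ k → ext σ k ≡ ext τ k
    outside {k} k≢m out with region a X Y k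
    ... | left k<a   = trans (Block.left F k<a) (sym (Block.left G k<a))
    ... | mid₁ j j<Y with out
    ...   | inj₁ k<a = contradiction k<a (m+n≮m a j)
    ...   | inj₂ Y≤j = contradiction (+-cancelˡ-≤ a Y j Y≤j) (<⇒≱ j<Y)
    outside k≢m out | mid₂ j j<X = trans (Block.mid₂ F j<X) (sym (Block.mid₂ G (m<n⇒m<1+n j<X)))
    outside k≢m out | right zero = contradiction (cong (λ i → a + (Y + i)) (+-identityʳ X)) k≢m
    outside k≢m out | right (suc j) = trans (Block.right F (suc j))
      (sym (Block.right-at G j (cong (λ i → a + (Y + i)) (+-suc X j))))

  -- The first value of the first block travels right across the second block; position a receives
  -- its own value a.
  shrink-Y-left : Block (suc a) X Y (ext σ) → Block a X (suc Y) (ext τ) →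
                  a + (X + suc Y) ≤ n → σ ≤ᴮ τ
  shrink-Y-left F G fits = hopʳ X (a + suc Y) a (a +_) {τ} {σ} (m<m+n a (s≤s z≤n))
    (subst (_≤ n) (rearrange₁ a X Y) fits)
    (λ {k} _ → +-monoʳ-< a (n<1+n k))
    (trans (Block.mid₁-at G (sym (+-identityʳ a)) (s≤s z≤n)) (cong (a +_) (+-identityʳ X)))
    (λ {k} k<X → Block.mid₂-at G (+-assoc a (suc Y) k) k<X)
    (trans (Block.left F (n<1+n a)) (sym (+-identityʳ a)))
    (λ {k} k<X → trans (Block.mid₂-at F (rearrange₂ a Y k) k<X) (sym (+-suc a k)))
    outside
    where
    rearrange₁ : ∀ a X Y → a + (X + suc Y) ≡ a + suc Y + X
    rearrange₁ = solve-∀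
    rearrange₂ : ∀ a Y k → a + suc Y + k ≡ suc a + (Y + k)
    rearrange₂ = solve-∀
    outside : ∀ {k} → k ≢ a → k < a + suc Y ⊎ a + suc Y + X ≤ k → ext σ k ≡ ext τ k
    outside {k} k≢m out with region (suc a) X Y k
    ... | left k≤a   = let k<a = ≤∧≢⇒< (s≤s⁻¹ k≤a) k≢m in
      trans (Block.left F k≤a) (sym (Block.left G k<a))
    ... | mid₁ j j<Y = trans (Block.mid₁ F j<Y)
      (sym (trans (Block.mid₁-at G (sym (+-suc a j)) (s≤s j<Y)) (rearrange a X j)))
      where
      rearrange : ∀ a X j → a + (X + suc j) ≡ suc a + (X + j)
      rearrange = solve-∀
    ... | mid₂ j j<X with out
    ...   | inj₁ k<i = contradiction (subst (suc a + (Y + j) <_) (+-suc a Y) k<i)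
                         (≤⇒≯ (+-monoʳ-≤ (suc a) (m≤m+n Y j)))
    ...   | inj₂ X≤j = contradiction
      (+-cancelˡ-≤ (a + suc Y) X j (subst (a + suc Y + X ≤_) (sym (rearrange₂ a Y j)) X≤j)) (<⇒≱ j<X)
    outside k≢m out | right j = trans (Block.right F j) (sym (Block.right-at G j (sym (+-suc a (Y + (X + j))))))

  -- The last and largest value of the first block travels right across the second block to the last
  -- position of the two blocks, where it is fixed.
  shrink-Y-right : Block a (suc X) Y (ext σ) → Block a (suc X) (suc Y) (ext τ) →
                   a + (suc X + suc Y) ≤ n → σ ≤ᴮ τ
  shrink-Y-right F G fits = hopʳ (suc X) (a + suc Y) (a + Y) u {τ} {σ} (+-monoʳ-< a (n<1+n Y))
    (subst (_≤ n) (rearrange₁ a (suc X) (suc Y)) fits)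
    increasing
    (trans (Block.mid₁ G (n<1+n Y)) (sym u-last))
    (λ {k} k<X → trans (Block.mid₂-at G (+-assoc a (suc Y) k) k<X) (sym (u-< k<X)))
    (trans (Block.mid₂-at F (cong (a +_) (sym (+-identityʳ Y))) (s≤s z≤n)) (sym (u-< (s≤s z≤n))))
    σ-moved
    outside
    where
    rearrange₁ : ∀ a X Y → a + (X + Y) ≡ a + Y + X
    rearrange₁ = solve-∀
    rearrange₂ : ∀ a Y k → a + suc Y + k ≡ a + (Y + suc k)
    rearrange₂ = solve-∀
    -- The values crossed are consecutive from a on, but the travelling value at index suc X exceeds
    -- the last of them by Y + 1.
    u : ℕ → ℕ
    u k with <-≤-connex k (suc X)
    ... | inj₁ _ = a + k
    ... | inj₂ _ = a + (suc X + Y)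
    u-< : ∀ {k} → k < suc X → u k ≡ a + k
    u-< {k} k<X with <-≤-connex k (suc X)
    ... | inj₁ _   = refl
    ... | inj₂ X≤k = contradiction k<X (≤⇒≯ X≤k)
    u-last : u (suc X) ≡ a + (suc X + Y)
    u-last with <-≤-connex (suc X) (suc X)
    ... | inj₁ X<X = contradiction X<X (n≮n (suc X))
    ... | inj₂ _   = refl
    increasing : ∀ {k} → k < suc X → u k < u (suc k)
    increasing {k} k<X with m≤n⇒m<n∨m≡n k<X
    ... | inj₁ 1+k<X = subst₂ _<_ (sym (u-< k<X)) (sym (u-< 1+k<X)) (+-monoʳ-< a (n<1+n k))
    ... | inj₂ refl  = subst₂ _<_ (sym (u-< k<X)) (sym u-last) (+-monoʳ-< a (m≤m+n (suc X) Y))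
    σ-moved : ∀ {k} → k < suc X → ext σ (a + suc Y + k) ≡ u (suc k)
    σ-moved {k} k<X with m≤n⇒m<n∨m≡n k<X
    ... | inj₁ 1+k<X = trans (Block.mid₂-at F (rearrange₂ a Y k) 1+k<X) (sym (u-< 1+k<X))
    ... | inj₂ refl  = trans
      (Block.right-at F 0 (trans (rearrange₂ a Y X) (cong (λ i → a + (Y + suc i)) (sym (+-identityʳ X)))))
      (trans (trans (rearrange₂ a Y X) (cong (a +_) (+-comm Y (suc X)))) (sym u-last))
    outside : ∀ {k} → k ≢ a + Y → k < a + suc Y ⊎ a + suc Y + suc X ≤ k → ext σ k ≡ ext τ k
    outside {k} k≢m out with region a (suc X) Y k
    ... | left k<a   = trans (Block.left F k<a) (sym (Block.left G k<a))
    ... | mid₁ j j<Y = trans (Block.mid₁ F j<Y) (sym (Block.mid₁ G (m<n⇒m<1+n j<Y)))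
    ... | mid₂ zero j<X = contradiction (cong (a +_) (+-identityʳ Y)) k≢m
    ... | mid₂ (suc j) j<X with out
    ...   | inj₁ k<i = contradiction (subst (_< a + suc Y) (sym (rearrange₂ a Y j)) k<i) (m+n≮m (a + suc Y) j)
    ...   | inj₂ X≤j = contradiction (+-cancelˡ-≤ (a + suc Y) (suc X) j
                         (subst (a + suc Y + suc X ≤_) (sym (rearrange₂ a Y j)) X≤j)) (<⇒≱ (<⇒≤ j<X))
    outside k≢m out | right zero with out
    ... | inj₁ k<i = contradiction k<i (≤⇒≯ (+-monoʳ-≤ a (subst (_≤ Y + suc (X + 0)) (+-comm Y 1) (+-monoʳ-≤ Y (s≤s z≤n)))))
    ... | inj₂ X≤j = contradiction X≤j (<⇒≱ (subst (_< a + suc Y + suc X)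
                       (trans (rearrange₂ a Y X) (cong (λ i → a + (Y + suc i)) (sym (+-identityʳ X))))
                       (+-monoʳ-< (a + suc Y) (n<1+n X))))
    outside k≢m out | right (suc j) = trans (Block.right F (suc j)) (sym (Block.right-at G j (rearrange a X Y j)))
      where
      rearrange : ∀ a X Y j → a + (Y + (suc X + suc j)) ≡ a + (suc Y + (suc X + j))
      rearrange = solve-∀

-- Blocks and quadruples

-- `Block` does not mention z; the size condition determines it from n.
Encodes : 𝔖 n → Quad → Set
Encodes {n} σ t@(a , z , x , y) = 2 + size t ≡ n × Block a (suc x) (suc y) (ext σ)

size-end : ∀ a z x y → 2 + size (a , z , x , y) ≡ a + (suc x + suc y) + z
size-end = lemma
  where
  lemma : ∀ a z x y → 2 + (a + (z + (x + y))) ≡ a + (suc x + suc y) + z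
  lemma = solve-∀

encoded-fits : ∀ (t@(a , z , x , y) : Quad) → 2 + size t ≡ n → a + (suc x + suc y) ≤ n
encoded-fits {n} (a , z , x , y) eq = subst (a + (suc x + suc y) ≤_)
  (trans (sym (size-end a z x y)) eq) (m≤m+n (a + (suc x + suc y)) z)

encode : ∀ t → 2 + size t ≡ n → 𝔖 n
encode t@(a , z , x , y) eq = blockPerm a (suc x) (suc y) (encoded-fits t eq)

encode-Encodes : ∀ t (eq : 2 + size t ≡ n) → Encodes (encode t eq) t
encode-Encodes t@(a , z , x , y) eq = eq , blockPerm-Block a (suc x) (suc y) (encoded-fits t eq)

Encodes-≈ : ∀ {σ τ : 𝔖 n} t → Encodes σ t → Encodes τ t → σ ≈ τ
Encodes-≈ {σ = σ} {τ} t (_ , F) (_ , G) = ext-injective σ τ (Block-unique F G)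

≤ᴮ⇒≼ : ∀ {σ τ : 𝔖 n} t t′ → Encodes σ t → Encodes τ t′ → σ ≤ᴮ τ → t ≼ t′
≤ᴮ⇒≼ {n} {σ} {τ} t@(a , z , x , y) t′@(a′ , z′ , x′ , y′) (eq , F) (eq′ , G) σ≤τ =
  (≤ᴮ⇒a≥a′ {π = σ} {τ} σ≤τ F G fits , z′≤z) ,
  (≤ᴮ⇒X≤X′ {π = σ} {τ} σ≤τ F G fits , ≤ᴮ⇒Y≤Y′ {π = σ} {τ} σ≤τ F G fits)
  where
  fits = encoded-fits t eq
  z′≤z : z′ ≤ z
  z′≤z = ≮⇒≥ λ z<z′ → <-irrefl
    (trans (sym (size-end a z x y)) (trans eq (trans (sym eq′) (size-end a′ z′ x′ y′))))
    (+-mono-≤-< (≤ᴮ⇒end≤end′ {π = σ} {τ} σ≤τ F G fits) z<z′)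

-- Induction on the total of the gap. One unit of u or v is paired with one unit of s or t, and the
-- matching elementary step leads from the upper end to ρ, whose remaining gap is smaller. Any
-- pairing works, since either block can give a unit to either side.
lower-upper-≤ᴮ : ∀ s t u v q {σ τ : 𝔖 n} → s + t ≡ u + v → let d = ((s , t) , (u , v)) in
                 Encodes σ (lower d q) → Encodes τ (upper d q) → σ ≤ᴮ τ
lower-upper-≤ᴮ zero zero zero zero q {σ} {τ} _ (_ , F) (_ , G) =
  ≈⇒≤ᴮ {π = σ} {τ} (ext-injective τ σ (Block-unique G F))
lower-upper-≤ᴮ (suc s) t (suc u) v (a , z , x , y) {σ} {τ} s+t≡u+v (eqσ , F) (eqτ , G) =
  ≤ᴮ-trans {π = σ} {ρ} {τ}
    (lower-upper-≤ᴮ s t u v (suc a , z , x , y) {σ} {ρ} (suc-injective s+t≡u+v)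
      (subst (λ i → Encodes σ (i , t + z , x , y)) (sym (+-suc s a)) (eqσ , F)) enc)
    (shrink-X-left (proj₂ enc) G (encoded-fits (a , z , suc u + x , v + y) eqτ))
  where
  rearrange : ∀ a z u x w → a + (z + (suc u + x + w)) ≡ suc a + (z + (u + x + w))
  rearrange = solve-∀
  eq = trans (cong (2 +_) (sym (rearrange a z u x (v + y)))) eqτ
  ρ = encode (suc a , z , u + x , v + y) eq
  enc = encode-Encodes (suc a , z , u + x , v + y) eq
lower-upper-≤ᴮ (suc s) t zero (suc v) (a , z , x , y) {σ} {τ} s+t≡u+v (eqσ , F) (eqτ , G) =
  ≤ᴮ-trans {π = σ} {ρ} {τ}
    (lower-upper-≤ᴮ s t zero v (suc a , z , x , y) {σ} {ρ} (suc-injective s+t≡u+v)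
      (subst (λ i → Encodes σ (i , t + z , x , y)) (sym (+-suc s a)) (eqσ , F)) enc)
    (shrink-Y-left (proj₂ enc) G (encoded-fits (a , z , x , suc v + y) eqτ))
  where
  rearrange : ∀ a z x v y → a + (z + (x + (suc v + y))) ≡ suc a + (z + (x + (v + y)))
  rearrange = solve-∀
  eq = trans (cong (2 +_) (sym (rearrange a z x v y))) eqτ
  ρ = encode (suc a , z , x , v + y) eq
  enc = encode-Encodes (suc a , z , x , v + y) eq
lower-upper-≤ᴮ zero (suc t) (suc u) v (a , z , x , y) {σ} {τ} s+t≡u+v (eqσ , F) (eqτ , G) =
  ≤ᴮ-trans {π = σ} {ρ} {τ}
    (lower-upper-≤ᴮ zero t u v (a , suc z , x , y) {σ} {ρ} (suc-injective s+t≡u+v)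
      (subst (λ i → Encodes σ (a , i , x , y)) (sym (+-suc t z)) (eqσ , F)) enc)
    (shrink-X-right (proj₂ enc) G (encoded-fits (a , z , suc u + x , v + y) eqτ))
  where
  rearrange : ∀ a z u x w → a + (z + (suc u + x + w)) ≡ a + (suc z + (u + x + w))
  rearrange = solve-∀
  eq = trans (cong (2 +_) (sym (rearrange a z u x (v + y)))) eqτ
  ρ = encode (a , suc z , u + x , v + y) eq
  enc = encode-Encodes (a , suc z , u + x , v + y) eq
lower-upper-≤ᴮ zero (suc t) zero (suc v) (a , z , x , y) {σ} {τ} s+t≡u+v (eqσ , F) (eqτ , G) =
  ≤ᴮ-trans {π = σ} {ρ} {τ}
    (lower-upper-≤ᴮ zero t zero v (a , suc z , x , y) {σ} {ρ} (suc-injective s+t≡u+v)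
      (subst (λ i → Encodes σ (a , i , x , y)) (sym (+-suc t z)) (eqσ , F)) enc)
    (shrink-Y-right (proj₂ enc) G (encoded-fits (a , z , x , suc v + y) eqτ))
  where
  rearrange : ∀ a z x v y → a + (z + (x + (suc v + y))) ≡ a + (suc z + (x + (v + y)))
  rearrange = solve-∀
  eq = trans (cong (2 +_) (sym (rearrange a z x v y))) eqτ
  ρ = encode (a , suc z , x , v + y) eq
  enc = encode-Encodes (a , suc z , x , v + y) eq

≼⇒≤ᴮ : ∀ {σ τ : 𝔖 n} t t′ → Encodes σ t → Encodes τ t′ → t ≼ t′ → σ ≤ᴮ τ
≼⇒≤ᴮ {σ = σ} {τ} t t′ enc enc′ t≼t′ with (((s , t) , (u , v)) , q) , refl ← ≼⇒chain₂ t≼t′ =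
  lower-upper-≤ᴮ s t u v q {σ} {τ}
    (balanced s t u v q (+-cancelˡ-≡ 2 _ _ (trans (proj₁ enc) (sym (proj₁ enc′))))) enc enc′

-- Applied to σ ≤ σ, `≤ᴮ⇒≼` compares the two codes in both directions, and `_≼_` is antisymmetric.
Encodes-≡ : ∀ {σ : 𝔖 n} t t′ → Encodes σ t → Encodes σ t′ → t ≡ t′
Encodes-≡ {σ = σ} t t′ enc enc′ = ≼-antisym
  (≤ᴮ⇒≼ {σ = σ} {σ} t t′ enc enc′ σ≤σ) (≤ᴮ⇒≼ {σ = σ} {σ} t′ t enc′ enc σ≤σ)
  where
  σ≤σ : σ ≤ᴮ σ
  σ≤σ = ≈⇒≤ᴮ {π = σ} {σ} λ _ → refl

-- Classification of the bigrassmannian permutations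

-- A bigrassmannian permutation f with inverse g, extended to ℕ. The conditions are symmetric, so
-- every fact about f has a dual about g through `Bidescent-sym`.
record Bidescent (n : ℕ) (f g : ℕ → ℕ) (d e : ℕ) : Set where
  field
    g∘f    : ∀ i → g (f i) ≡ i
    f∘g    : ∀ i → f (g i) ≡ i
    f≥     : ∀ {i} → n ≤ i → f i ≡ i
    g≥     : ∀ {i} → n ≤ i → g i ≡ i
    f-desc : f (suc d) < f d
    g-desc : g (suc e) < g e
    f-asc  : ∀ {i} → i ≢ d → f i < f (suc i)
    g-asc  : ∀ {i} → i ≢ e → g i < g (suc i)

Bidescent-sym : ∀ {n f g d e} → Bidescent n f g d e → Bidescent n g f e d
Bidescent-sym B = record
  { g∘f = f∘g; f∘g = g∘f; f≥ = g≥; g≥ = f≥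
  ; f-desc = g-desc; g-desc = f-desc; f-asc = g-asc; g-asc = f-asc }
  where open Bidescent B

growth : ∀ (f : ℕ → ℕ) i k → (∀ {l} → i ≤ l → l < i + k → f l < f (suc l)) → f i + k ≤ f (i + k)
growth f i zero    asc = ≤-reflexive (trans (+-identityʳ (f i)) (cong f (sym (+-identityʳ i))))
growth f i (suc k) asc = begin
  f i + suc k      ≡⟨ +-suc (f i) k ⟩
  suc (f i + k)    ≤⟨ s≤s (growth f i k λ i≤l l<i+k → asc i≤l (<-≤-trans l<i+k (+-monoʳ-≤ i (n≤1+n k)))) ⟩
  suc (f (i + k))  ≤⟨ asc (m≤m+n i k) (+-monoʳ-< i (n<1+n k)) ⟩
  f (suc (i + k))  ≡⟨ cong f (+-suc i k) ⟨
  f (i + suc k)    ∎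
  where open ≤-Reasoning

growth-left : ∀ {n f g d e} → Bidescent n f g d e → ∀ i k → i + k ≤ d → f i + k ≤ f (i + k)
growth-left {f = f} B i k i+k≤d =
  growth f i k λ _ l<i+k → Bidescent.f-asc B (<⇒≢ (<-≤-trans l<i+k i+k≤d))

growth-right : ∀ {n f g d e} → Bidescent n f g d e → ∀ i k → d < i → f i + k ≤ f (i + k)
growth-right {f = f} B i k d<i =
  growth f i k λ i≤l _ → Bidescent.f-asc B (>⇒≢ (<-≤-trans d<i i≤l))

≤-left : ∀ {n f g d e} → Bidescent n f g d e → ∀ {i} → i ≤ d → i ≤ f i
≤-left {f = f} B {i} i≤d = ≤-trans (m≤n+m i (f 0)) (growth-left B 0 i i≤d)

-- To the right of the descent f keeps ascending up to the fixed position i + n, which leaves no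
-- room for f i > i.
≥-right : ∀ {n f g d e} → Bidescent n f g d e → ∀ {i} → d < i → f i ≤ i
≥-right {n} {f} B {i} d<i = +-cancelʳ-≤ n _ _ (begin
  f i + n    ≤⟨ growth-right B i n d<i ⟩
  f (i + n)  ≡⟨ Bidescent.f≥ B (m≤n+m n i) ⟩
  i + n      ∎)
  where open ≤-Reasoning

-- f and g are both extensive on the lower parts, so they are the identity there.
fixed-left : ∀ {n f g d e} → Bidescent n f g d e → ∀ {i} → i ≤ d → f i ≤ e → f i ≡ i
fixed-left B {i} i≤d fi≤e = ≤-antisym
  (subst (_ ≤_) (Bidescent.g∘f B i) (≤-left (Bidescent-sym B) fi≤e)) (≤-left B i≤d)

fixed-right : ∀ {n f g d e} → Bidescent n f g d e → ∀ {i} → d < i → e < f i → f i ≡ i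
fixed-right B {i} d<i e<fi = ≤-antisym (≥-right B d<i)
  (subst (_≤ _) (Bidescent.g∘f B i) (≥-right (Bidescent-sym B) e<fi))

-- Otherwise all values above e, among them g e, would be fixed by f.
first-large : ∀ {n f g d e} → Bidescent n f g d e → g (suc e) ≤ d
first-large {n} {f} {g} {d} {e} B = ≮⇒≥ λ d<s →
  let s≡q : suc e ≡ g (suc e)
      s≡q = trans (sym (f∘g (suc e))) (fixed-right B d<s (subst (e <_) (sym (f∘g (suc e))) (n<1+n e)))
      e<w : e < g e
      e<w = <-trans (subst (e <_) s≡q (n<1+n e)) g-desc
      k , q+k≡w = m≤n⇒∃[o]m+o≡n e<w
      d<gw : d < g (g e)
      d<gw = <-≤-trans d<s (≤-trans (m≤m+n (g (suc e)) k)
        (subst (λ w → g (suc e) + k ≤ g w) q+k≡w (growth-right (Bidescent-sym B) (suc e) k (n<1+n e))))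
      w-fixed : g (g e) ≡ g e
      w-fixed = fixed-right (Bidescent-sym B) e<w d<gw
      e≡w : g e ≡ e
      e≡w = trans (sym (f∘g (g e))) (trans (cong f w-fixed) (f∘g e))
  in <-irrefl (sym e≡w) e<w
  where open Bidescent B

-- The position of the value suc e is at most d and f ascends up to it, so earlier values are at
-- most e and `fixed-left` applies.
f-before : ∀ {n f g d e} → Bidescent n f g d e → ∀ {i} → i < g (suc e) → f i ≡ i
f-before {n} {f} {g} {d} {e} B {i} i<s with k , 1+i+k≡s ← m≤n⇒∃[o]m+o≡n i<s =
  fixed-left B (≤-trans (<⇒≤ i<s) (first-large B)) (s≤s⁻¹ (begin
    suc (f i)        ≤⟨ m≤m+n (suc (f i)) k ⟩
    suc (f i) + k    ≡⟨ +-suc (f i) k ⟨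
    f i + suc k      ≤⟨ growth-left B i (suc k) (subst (_≤ d) (sym i+1+k≡s) (first-large B)) ⟩
    f (i + suc k)    ≡⟨ cong f i+1+k≡s ⟩
    f (g (suc e))    ≡⟨ Bidescent.f∘g B (suc e) ⟩
    suc e            ∎))
  where
  open ≤-Reasoning
  i+1+k≡s = trans (+-suc i k) 1+i+k≡s

-- Growth of f gives one inequality. An excess o would be o further ascents of g above e, carrying g
-- past the position from which the value came.
f-after : ∀ {n f g d e} → Bidescent n f g d e → ∀ j → g (suc e) + j ≤ d → f (g (suc e) + j) ≡ suc e + j
f-after {n} {f} {g} {d} {e} B j s+j≤d with m≤n⇒∃[o]m+o≡n lower-bound
  where
  open ≤-Reasoning
  lower-bound : suc e + j ≤ f (g (suc e) + j)
  lower-bound = begin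
    suc e + j              ≡⟨ cong (_+ j) (Bidescent.f∘g B (suc e)) ⟨
    f (g (suc e)) + j      ≤⟨ growth-left B (g (suc e)) j s+j≤d ⟩
    f (g (suc e) + j)      ∎
... | o , eq = trans (sym eq) (trans (cong (suc e + j +_) o≡0) (+-identityʳ _))
  where
  open ≤-Reasoning
  o≡0 : o ≡ 0
  o≡0 = n≤0⇒n≡0 (+-cancelˡ-≤ (g (suc e) + j) o 0 (begin
    g (suc e) + j + o           ≡⟨ +-assoc (g (suc e)) j o ⟩
    g (suc e) + (j + o)         ≤⟨ growth-right (Bidescent-sym B) (suc e) (j + o) (n<1+n e) ⟩
    g (suc e + (j + o))         ≡⟨ cong g (trans (sym (+-assoc (suc e) j o)) eq) ⟩
    g (f (g (suc e) + j))       ≡⟨ Bidescent.g∘f B _ ⟩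
    g (suc e) + j               ≡⟨ +-identityʳ _ ⟨
    g (suc e) + j + 0           ∎))

-- If one start were smaller, it would be fixed by both functions. The start g (suc e) would then
-- equal suc e although it lies below f (suc d) ≤ e; the other case is dual.
same-start : ∀ {n f g d e} → Bidescent n f g d e → g (suc e) ≡ f (suc d)
same-start {n} {f} {g} {d} {e} B with <-cmp (g (suc e)) (f (suc d))
... | tri≈ _ s≡t _ = s≡t
... | tri< s<t _ _ = contradiction
  (trans (sym (f∘g (suc e))) (trans (cong f (sym (f-before (Bidescent-sym B) s<t))) (f∘g _)))
  (>⇒≢ (s≤s (≤-trans (<⇒≤ s<t) (first-large (Bidescent-sym B)))))
  where open Bidescent B
... | tri> _ _ t<s = contradiction
  (trans (sym (g∘f (suc d))) (trans (cong g (sym (f-before B t<s))) (g∘f _)))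
  (>⇒≢ (s≤s (≤-trans (<⇒≤ t<s) (first-large B))))
  where open Bidescent B

-- The common start is a, with d = a + y and e = a + x. The first block is `f-after`; the second is
-- its dual, read backwards through f. At later positions a value up to e would repeat one already
-- taken, so these positions are fixed.
Bidescent⇒Block : ∀ {n f g d e} → Bidescent n f g d e →
                  ∃ λ a → ∃₂ λ x y → a + (suc x + suc y) ≤ n × Block a (suc x) (suc y) f
Bidescent⇒Block {n} {f} {g} {d} {e} B
  with y , a+y≡d ← m≤n⇒∃[o]m+o≡n (first-large B)
     | x , t+x≡e ← m≤n⇒∃[o]m+o≡n (first-large (Bidescent-sym B)) =
  a , x , y , fits , F
  where
  open Bidescent B
  a = g (suc e)
  a≡t : a ≡ f (suc d)
  a≡t = same-start B
  a+x≡e : a + x ≡ e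
  a+x≡e = trans (cong (_+ x) a≡t) t+x≡e
  g-after : ∀ j → a + j ≤ e → g (a + j) ≡ suc d + j
  g-after j = subst (λ a → a + j ≤ e → g (a + j) ≡ suc d + j) (sym a≡t) (f-after (Bidescent-sym B) j)
  mid₁′ : ∀ {j} → j < suc y → f (a + j) ≡ a + (suc x + j)
  mid₁′ {j} (s≤s j≤y) = trans (f-after B j (subst (a + j ≤_) a+y≡d (+-monoʳ-≤ a j≤y)))
    (trans (cong (λ e → suc e + j) (sym a+x≡e)) (rearrange a x j))
    where
    rearrange : ∀ a x j → suc (a + x) + j ≡ a + (suc x + j)
    rearrange = solve-∀
  position : ∀ j → suc d + j ≡ a + (suc y + j)
  position j = trans (cong (λ d → suc d + j) (sym a+y≡d)) (rearrange a y j)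
    where
    rearrange : ∀ a y j → suc (a + y) + j ≡ a + (suc y + j)
    rearrange = solve-∀
  mid₂′ : ∀ {j} → j < suc x → f (a + (suc y + j)) ≡ a + j
  mid₂′ {j} (s≤s j≤x) = trans
    (cong f (sym (trans (g-after j (subst (a + j ≤_) a+x≡e (+-monoʳ-≤ a j≤x))) (position j))))
    (f∘g (a + j))
  right′ : ∀ j → f (a + (suc y + (suc x + j))) ≡ a + (suc y + (suc x + j))
  right′ j = fixed-right B (subst (d <_) (position (suc x + j)) (s≤s (m≤m+n d _)))
    (≰⇒> large)
    where
    i = a + (suc y + (suc x + j))
    large : ¬ f i ≤ e
    large fi≤e with <-≤-connex (f i) a
    ... | inj₁ fi<a = <-irrefl (trans (sym (f-before (Bidescent-sym B) (subst (f i <_) a≡t fi<a))) (g∘f i))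
                        (<-≤-trans fi<a (m≤m+n a _))
    ... | inj₂ a≤fi with j′ , a+j′≡fi ← m≤n⇒∃[o]m+o≡n a≤fi =
      m+1+n≰m x (subst (_≤ x) (sym (+-suc x j)) (subst (_≤ x) j′≡ j′≤x))
      where
      a+j′≤e = subst (_≤ e) (sym a+j′≡fi) fi≤e
      j′≤x : j′ ≤ x
      j′≤x = +-cancelˡ-≤ a j′ x (subst (a + j′ ≤_) (sym a+x≡e) a+j′≤e)
      j′≡ : j′ ≡ suc x + j
      j′≡ = +-cancelˡ-≡ (suc d) _ _ (begin
        suc d + j′          ≡⟨ g-after j′ a+j′≤e ⟨
        g (a + j′)          ≡⟨ cong g a+j′≡fi ⟩
        g (f i)             ≡⟨ g∘f i ⟩
        i                   ≡⟨ position (suc x + j) ⟨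
        suc d + (suc x + j) ∎)
        where open ≡-Reasoning
  F : Block a (suc x) (suc y) f
  F = record { left = f-before B; mid₁ = mid₁′; mid₂ = mid₂′; right = right′ }
  fits : a + (suc x + suc y) ≤ n
  -- The last position of the second block is not fixed, hence lies below n.
  fits = subst (_≤ n) (rearrange a x y) (≰⇒> λ n≤m → <⇒≢ (+-monoʳ-< a (m<n+m x (s≤s z≤n)))
    (trans (sym (mid₂′ (n<1+n x))) (f≥ n≤m)))
    where
    rearrange : ∀ a x y → suc (a + (suc y + x)) ≡ a + (suc x + suc y)
    rearrange = solve-∀

Descent⇒ext : ∀ (σ : 𝔖 n) {i} → Descent σ i → ext σ (suc (toℕ i)) < ext σ (toℕ i)
Descent⇒ext σ {i} (j , j≡1+i , σi>σj) = subst₂ _<_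
  (trans (sym (ext-toℕ σ j)) (cong (ext σ) j≡1+i)) (sym (ext-toℕ σ i)) σi>σj

-- Extending by the identity creates no descents: if suc i is at least n, it is its own value, which
-- exceeds the value at i.
ext⇒Descent : ∀ (σ : 𝔖 n) {i} → ext σ (suc i) < ext σ i → ∃ λ (k : Fin n) → toℕ k ≡ i × Descent σ k
ext⇒Descent {n} σ {i} desc = fromℕ< i<n , Fin.toℕ-fromℕ< i<n ,
  fromℕ< 1+i<n , trans (Fin.toℕ-fromℕ< 1+i<n) (cong suc (sym (Fin.toℕ-fromℕ< i<n))) ,
  subst₂ _<_ (trans (cong (ext σ) (sym (Fin.toℕ-fromℕ< 1+i<n))) (ext-toℕ σ _))
             (trans (cong (ext σ) (sym (Fin.toℕ-fromℕ< i<n))) (ext-toℕ σ _)) desc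
  where
  i<n : i < n
  i<n = ≰⇒> λ n≤i → <-asym (n<1+n i) (subst₂ _<_ (ext-≥ σ (m≤n⇒m≤1+n n≤i)) (ext-≥ σ n≤i) desc)
  1+i<n : suc i < n
  1+i<n = ≰⇒> λ n≤1+i → <⇒≱ (subst (_< ext σ i) (ext-≥ σ n≤1+i) desc)
    (≤-trans (<⇒≤ (ext-< σ i<n)) n≤1+i)

uniqueDescent : ∀ (σ : 𝔖 n) → ∃! _≡_ (Descent σ) →
                ∃ λ d → ext σ (suc d) < ext σ d × (∀ {i} → i ≢ d → ext σ i < ext σ (suc i))
uniqueDescent σ (d , desc , unique) = toℕ d , Descent⇒ext σ desc , λ {i} i≢d →
  ≤∧≢⇒< (≮⇒≥ λ desc′ → let k , k≡i , D = ext⇒Descent σ desc′ in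
           i≢d (trans (sym k≡i) (cong toℕ (sym (unique D)))))
        (λ eq → m≢1+m+n i (trans (trans (sym (ext-flip σ i)) (trans (cong (ext (Perm.flip σ)) eq) (ext-flip σ (suc i))))
          (cong suc (sym (+-identityʳ i)))))

Bigrassmannian⇒Bidescent : ∀ (σ : 𝔖 n) → Bigrassmannian σ →
                           ∃₂ (Bidescent n (ext σ) (ext (Perm.flip σ)))
Bigrassmannian⇒Bidescent σ (D , E)
  with d , f-desc , f-asc ← uniqueDescent σ D | e , g-desc , g-asc ← uniqueDescent (Perm.flip σ) E =
  d , e , record
    { g∘f = ext-flip σ; f∘g = ext-flip (Perm.flip σ); f≥ = ext-≥ σ; g≥ = ext-≥ (Perm.flip σ)
    ; f-desc = f-desc; g-desc = g-desc; f-asc = f-asc; g-asc = g-asc }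

Bigrassmannian⇒Encodes : ∀ (σ : 𝔖 n) → Bigrassmannian σ → ∃ (Encodes σ)
Bigrassmannian⇒Encodes {n} σ bi
  with _ , _ , B ← Bigrassmannian⇒Bidescent σ bi
  with a , x , y , fits , F ← Bidescent⇒Block B
  with z , end+z≡n ← m≤n⇒∃[o]m+o≡n fits =
  (a , z , x , y) , trans (size-end a z x y) end+z≡n , F

Block-descent : ∀ {a x y f} → Block a (suc x) (suc y) f → f (suc (a + y)) < f (a + y)
Block-descent {a} {x} {y} F = subst₂ _<_
  (sym (trans (Block.mid₂-at F (rearrange a y) (s≤s z≤n)) (+-identityʳ a)))
  (sym (Block.mid₁ F (n<1+n y))) (m<m+n a (s≤s z≤n))
  where
  rearrange : ∀ a y → suc (a + y) ≡ a + (suc y + 0)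
  rearrange = solve-∀

Block-descent-unique : ∀ {a x y f} → Block a (suc x) (suc y) f → ∀ {i} → f (suc i) < f i → i ≡ a + y
Block-descent-unique {a} {x} {y} {f} F {i} desc with region a (suc x) (suc y) i
... | left i<a with m≤n⇒m<n∨m≡n i<a
...   | inj₁ 1+i<a = contradiction (subst₂ _<_ (Block.left F 1+i<a) (Block.left F i<a) desc) (<-asym (n<1+n i))
...   | inj₂ refl  = contradiction
  (subst₂ _<_ (Block.mid₁-at F (sym (+-identityʳ a)) (s≤s z≤n)) (Block.left F i<a) desc)
  (<-asym (m≤m+n a _))
Block-descent-unique {a} {x} {y} {f} F desc | mid₁ j (s≤s j≤y) with m≤n⇒m<n∨m≡n j≤y
... | inj₂ refl = refl
... | inj₁ j<y  = contradiction
  (subst₂ _<_ (Block.mid₁-at F (sym (+-suc a j)) (s≤s j<y)) (Block.mid₁ F (s≤s j≤y)) desc)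
  (<-asym (+-monoʳ-< a (+-monoʳ-< (suc x) (n<1+n j))))
Block-descent-unique {a} {x} {y} {f} F desc | mid₂ j (s≤s j≤x) with m≤n⇒m<n∨m≡n j≤x
... | inj₁ j<x  = contradiction
  (subst₂ _<_ (Block.mid₂-at F (rearrange a y j) (s≤s j<x)) (Block.mid₂ F (s≤s j≤x)) desc)
  (<-asym (+-monoʳ-< a (n<1+n j)))
  where
  rearrange : ∀ a y j → suc (a + (suc y + j)) ≡ a + (suc y + suc j)
  rearrange = solve-∀
... | inj₂ refl = contradiction
  (subst₂ _<_ (Block.right-at F 0 (rearrange a x y)) (Block.mid₂ F (n<1+n x)) desc)
  (<-asym (m<n⇒m<1+n (+-monoʳ-< a (m<n+m x (s≤s z≤n)))))
  where
  rearrange : ∀ a x y → suc (a + (suc y + x)) ≡ a + (suc y + (suc x + 0))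
  rearrange = solve-∀
Block-descent-unique {a} {x} {y} {f} F desc | right j = contradiction
  (subst₂ _<_ (Block.right-at F (suc j) (rearrange a x y j)) (Block.right F j) desc) (<-asym (n<1+n _))
  where
  rearrange : ∀ a x y j → suc (a + (suc y + (suc x + j))) ≡ a + (suc y + (suc x + suc j))
  rearrange = solve-∀

Block⇒∃!Descent : ∀ (σ : 𝔖 n) {a x y} → Block a (suc x) (suc y) (ext σ) → ∃! _≡_ (Descent σ)
Block⇒∃!Descent σ {a} {x} {y} F with k , k≡ , D ← ext⇒Descent σ (Block-descent F) =
  k , D , λ D′ → Fin.toℕ-injective (trans k≡ (sym (Block-descent-unique F (Descent⇒ext σ D′))))

-- The inverse is again of block form, with the two lengths exchanged, so one descent lemma serves
-- for both.
Encodes⇒Bigrassmannian : ∀ (σ : 𝔖 n) t → Encodes σ t → Bigrassmannian σ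
Encodes⇒Bigrassmannian σ (a , z , x , y) (_ , F) =
  Block⇒∃!Descent σ F , Block⇒∃!Descent (Perm.flip σ) (Block-resp-≗ G≗σ⁻¹ G)
  where
  G = block-Block a (suc y) (suc x)
  G≗σ⁻¹ : block a (suc y) (suc x) ≗ ext (Perm.flip σ)
  G≗σ⁻¹ i = trans (sym (ext-flip σ (block a (suc y) (suc x) i)))
    (cong (ext (Perm.flip σ)) (Block-inverse G F i))

-- Counting in 𝔅

𝔅-apart : ∀ n → AllPairs (λ σ σ′ → ¬ (∃ λ t → Encodes σ t × Encodes σ′ t)) (𝔅 n)
𝔅-apart n = AllPairs.map
  (λ {σ} {σ′} σ≉σ′ (t , enc , enc′) → σ≉σ′ (Encodes-≈ {σ = σ} {σ′} t enc enc′))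
  (UniqueS.filter⁺ (𝔖-setoid n) bigrassmannian? (permutations-unique n))

module _ {k n : ℕ} (2+k≡n : 2 + k ≡ n) where

  𝔅-encoded : All (λ σ → Any (Encodes σ) (quads k)) (𝔅 n)
  𝔅-encoded = All.map (λ {σ} bi → encoded σ (Bigrassmannian⇒Encodes σ bi))
    (All.all-filter bigrassmannian? (permutations n))
    where
    encoded : ∀ σ → ∃ (Encodes σ) → Any (Encodes σ) (quads k)
    encoded σ (t , enc@(eq , _)) = lose (subst (λ m → t ∈ quads m) size≡k (∈-quads⁺ t)) enc
      where
      size≡k : size t ≡ k
      size≡k = suc-injective (suc-injective (trans eq (sym 2+k≡n)))

  quads-encoding : All (λ t → Any (λ σ → Encodes σ t) (𝔅 n)) (quads k)
  quads-encoding = All.tabulate encoding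
    where
    encoding : ∀ {t} → t ∈ quads k → Any (λ σ → Encodes σ t) (𝔅 n)
    encoding {t} t∈ = let
        eq = trans (cong (suc ∘ suc) (∈-quads⁻ {k} t∈)) 2+k≡n
        σ , σ∈ , e≈σ = find (permutations-complete n (encode t eq))
        enc = proj₁ (encode-Encodes t eq) ,
              Block-resp-≗ (≈⇒ext-≗ {σ = encode t eq} {σ} e≈σ) (proj₂ (encode-Encodes t eq))
      in lose (∈-filter⁺ bigrassmannian? σ∈ (Encodes⇒Bigrassmannian σ t enc)) enc

  ∑-𝔅 : ∀ {F : 𝔖 n → ℕ} {G : Quad → ℕ} → (∀ σ t → Encodes σ t → F σ ≡ G t) →
        ∑ (𝔅 n) F ≡ ∑ (quads k) G
  ∑-𝔅 {F} {G} F≡G = ∑-matching Encodes F G (λ {σ} {t} → F≡G σ t) (𝔅 n) (quads k)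
    (𝔅-apart n)
    (AllPairs.map (λ {t} {t′} t≢t′ (σ , enc , enc′) → t≢t′ (Encodes-≡ {σ = σ} t t′ enc enc′)) (quads-unique k))
    𝔅-encoded quads-encoding

  -- As k = n - 2, this is 𝔟 n = C(n + 1, 3).
  𝔟≡h : 𝔟 n ≡ h 3 k
  𝔟≡h = begin
    length (𝔅 n)              ≡⟨ ∑-one (𝔅 n) ⟨
    ∑ (𝔅 n) (const 1)         ≡⟨ ∑-𝔅 (λ _ _ _ → refl) ⟩
    ∑ (quads k) (const 1)     ≡⟨ ∑-one (quads k) ⟩
    length (quads k)          ≡⟨ length-quads k ⟩
    h 3 k                     ∎
    where open ≡-Reasoning

  length-filter-𝔅³ : ∀ {P : Pred (𝔖 n × 𝔖 n × 𝔖 n) 0ℓ} (P? : Decidable P)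
    (b : Quad → Quad → Quad → Bool) →
    (∀ π σ τ t t′ t″ → Encodes π t → Encodes σ t′ → Encodes τ t″ → does (P? (π , σ , τ)) ≡ b t t′ t″) →
    length (filter P? (𝔅³ n)) ≡ ∑³ (quads k) (λ t t′ t″ → [ b t t′ t″ ]ᵇ)
  length-filter-𝔅³ P? b P≡b = begin
    length (filter P? (𝔅³ n))
      ≡⟨ length-filter-∑ P? (𝔅³ n) ⟩
    ∑ (𝔅³ n) (λ p → [ does (P? p) ]ᵇ)
      ≡⟨ ∑-cartesianProduct (𝔅 n) (cartesianProduct (𝔅 n) (𝔅 n)) _ ⟩
    ∑ (𝔅 n) (λ π → ∑ (cartesianProduct (𝔅 n) (𝔅 n)) λ p → [ does (P? (π , p)) ]ᵇ)
      ≡⟨ ∑-𝔅 (λ π t enc → trans (∑-cartesianProduct (𝔅 n) (𝔅 n) _)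
          (∑-𝔅 λ σ t′ enc′ → ∑-𝔅 λ τ t″ enc″ → cong [_]ᵇ (P≡b π σ τ t t′ t″ enc enc′ enc″))) ⟩
    ∑³ (quads k) (λ t t′ t″ → [ b t t′ t″ ]ᵇ)
      ∎
    where open ≡-Reasoning

length-𝔅³ : ∀ n → length (𝔅³ n) ≡ 𝔟 n * (𝔟 n * 𝔟 n)
length-𝔅³ n = trans (length-cartesianProduct (𝔅 n) (cartesianProduct (𝔅 n) (𝔅 n)))
  (cong (𝔟 n *_) (length-cartesianProduct (𝔅 n) (𝔅 n)))

-- The six disjuncts are in the order of permutations 3.
module _ {A : Set} (_≤_ : A → A → Set) where
  SomeChain : A → A → A → Set
  SomeChain x y z = x ≤ y × y ≤ z ⊎ x ≤ z × z ≤ y ⊎ y ≤ x × x ≤ z ⊎ y ≤ z × z ≤ x ⊎ z ≤ x × x ≤ y ⊎ z ≤ y × y ≤ x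

-- An arbitrary φ is replaced by its representative among the six listed permutations, for which the
-- tabulated list computes to π, σ and τ in a definite order.
Comparable⇒SomeChain : ∀ {π σ τ : 𝔖 n} → Comparable (π ∷ σ ∷ τ ∷ []) → SomeChain _≤ᴮ_ π σ τ
Comparable⇒SomeChain {n} {π} {σ} {τ} (φ , linked) = split (Any.map
  (λ φ≈ψ → subst (Linked _≤ᴮ_) (tabulate-cong λ i → cong (lookup πs) (φ≈ψ i)) linked)
  (permutations-complete 3 φ))
  where
  πs : Vec (𝔖 n) 3
  πs = π ∷ σ ∷ τ ∷ []
  split : Any (λ ψ → Linked _≤ᴮ_ (tabulate λ i → lookup πs (ψ ⟨$⟩ʳ i))) (permutations 3) → SomeChain _≤ᴮ_ π σ τ
  split (here (p ∷ q ∷ [-])) = inj₁ (p , q)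
  split (there (here (p ∷ q ∷ [-]))) = inj₂ (inj₁ (p , q))
  split (there (there (here (p ∷ q ∷ [-])))) = inj₂ (inj₂ (inj₁ (p , q)))
  split (there (there (there (here (p ∷ q ∷ [-]))))) = inj₂ (inj₂ (inj₂ (inj₁ (p , q))))
  split (there (there (there (there (here (p ∷ q ∷ [-])))))) = inj₂ (inj₂ (inj₂ (inj₂ (inj₁ (p , q)))))
  split (there (there (there (there (there (here (p ∷ q ∷ [-]))))))) = inj₂ (inj₂ (inj₂ (inj₂ (inj₂ (p , q)))))

SomeChain⇒Comparable : ∀ {π σ τ : 𝔖 n} → SomeChain _≤ᴮ_ π σ τ → Comparable (π ∷ σ ∷ τ ∷ [])
SomeChain⇒Comparable {n} {π} {σ} {τ} = Any.satisfied ∘ join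
  where
  join : SomeChain _≤ᴮ_ π σ τ →
         Any (λ ψ → Linked _≤ᴮ_ (tabulate λ i → lookup (π ∷ σ ∷ τ ∷ []) (ψ ⟨$⟩ʳ i))) (permutations 3)
  join (inj₁ (p , q)) = here (p ∷ q ∷ [-])
  join (inj₂ (inj₁ (p , q))) = there (here (p ∷ q ∷ [-]))
  join (inj₂ (inj₂ (inj₁ (p , q)))) = there (there (here (p ∷ q ∷ [-])))
  join (inj₂ (inj₂ (inj₂ (inj₁ (p , q))))) = there (there (there (here (p ∷ q ∷ [-]))))
  join (inj₂ (inj₂ (inj₂ (inj₂ (inj₁ (p , q)))))) = there (there (there (there (here (p ∷ q ∷ [-])))))
  join (inj₂ (inj₂ (inj₂ (inj₂ (inj₂ (p , q)))))) = there (there (there (there (there (here (p ∷ q ∷ [-]))))))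

SomeChain-map : ∀ {A B : Set} (_≤_ : A → A → Set) (_≤′_ : B → B → Set) {R : A → B → Set} →
  (∀ {a a′ b b′} → R a b → R a′ b′ → a ≤ a′ → b ≤′ b′) →
  ∀ {x y z x′ y′ z′} → R x x′ → R y y′ → R z z′ → SomeChain _≤_ x y z → SomeChain _≤′_ x′ y′ z′
SomeChain-map _≤_ _≤′_ mono x y z =
  Sum.map (Product.map (mono x y) (mono y z)) (Sum.map (Product.map (mono x z) (mono z y))
  (Sum.map (Product.map (mono y x) (mono x z)) (Sum.map (Product.map (mono y z) (mono z x))
  (Sum.map (Product.map (mono z x) (mono x y)) (Product.map (mono z y) (mono y x))))))

-- The numbers of chains and of comparable triples

module _ {k n : ℕ} (2+k≡n : 2 + k ≡ n) where

  ∣chains∣ : length (filter (λ (π , σ , τ) → (π ≤ᴮ? σ) ×-dec (σ ≤ᴮ? τ)) (𝔅³ n))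
                     ≡ 1+shift (1+shift (h 9)) k
  ∣chains∣ = trans
    (length-filter-𝔅³ 2+k≡n _ (λ t t′ t″ → does ((t ≼? t′) ×-dec (t′ ≼? t″))) λ π σ τ t t′ t″ e e′ e″ →
      does-⇔ (mk⇔ (Product.map (≤ᴮ⇒≼ {σ = π} {σ} t t′ e e′) (≤ᴮ⇒≼ {σ = σ} {τ} t′ t″ e′ e″))
                  (Product.map (≼⇒≤ᴮ {σ = π} {σ} t t′ e e′) (≼⇒≤ᴮ {σ = σ} {τ} t′ t″ e′ e″)))
        ((π ≤ᴮ? σ) ×-dec (σ ≤ᴮ? τ)) ((t ≼? t′) ×-dec (t′ ≼? t″)))
    (trans (length-chains₃ k) (length-gaps⊗gaps⊗quads k))

  ∣comparable∣ : 6 * 1+shift (1+shift (h 9)) k + h 3 k ≡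
    length (filter (λ (π , σ , τ) → comparable? (π ∷ σ ∷ τ ∷ [])) (𝔅³ n)) + 6 * 1+shift (h 6) k
  ∣comparable∣ = begin
    6 * 1+shift (1+shift (h 9)) k + h 3 k
      ≡⟨ cong₂ (λ i j → 6 * i + j) (trans (length-chains₃ k) (length-gaps⊗gaps⊗quads k)) (length-quads k) ⟨
    _ ≡⟨ ∑-comparable k ⟩
    _ ≡⟨ cong₂ (λ i j → i + 6 * j)
           (length-filter-𝔅³ 2+k≡n (λ (π , σ , τ) → comparable? (π ∷ σ ∷ τ ∷ [])) _ comparable≡)
           (trans (sym (length-gaps⊗quads k)) (sym (length-chains₂ k))) ⟨
    length (filter (λ (π , σ , τ) → comparable? (π ∷ σ ∷ τ ∷ [])) (𝔅³ n)) + 6 * 1+shift (h 6) k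
      ∎
    where
    open ≡-Reasoning
    -- The disjuncts follow the order in `comparableᵇ`, so `does` of this decision computes to the
    -- summand of `∑-comparable`.
    someChain? : ∀ t t′ t″ → Dec (SomeChain _≼_ t t′ t″)
    someChain? x y z =
      ((x ≼? y) ×-dec (y ≼? z)) ⊎-dec ((x ≼? z) ×-dec (z ≼? y)) ⊎-dec ((y ≼? x) ×-dec (x ≼? z)) ⊎-dec
      ((y ≼? z) ×-dec (z ≼? x)) ⊎-dec ((z ≼? x) ×-dec (x ≼? y)) ⊎-dec ((z ≼? y) ×-dec (y ≼? x))
    comparable≡ : ∀ π σ τ t t′ t″ → Encodes π t → Encodes σ t′ → Encodes τ t″ →
      does (comparable? (π ∷ σ ∷ τ ∷ [])) ≡ does (someChain? t t′ t″)
    comparable≡ π σ τ t t′ t″ e e′ e″ = does-⇔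
      (mk⇔ (λ c → SomeChain-map _≤ᴮ_ _≼_ {Encodes} (λ {σ} {τ} {t} {t′} → ≤ᴮ⇒≼ {σ = σ} {τ} t t′)
              {π} {σ} {τ} {t} {t′} {t″} e e′ e″ (Comparable⇒SomeChain {π = π} {σ} {τ} c))
           (λ c → SomeChain⇒Comparable {π = π} {σ} {τ}
             (SomeChain-map _≼_ _≤ᴮ_ {λ t σ → Encodes σ t} (λ {t} {t′} {σ} {τ} → ≼⇒≤ᴮ {σ = σ} {τ} t t′)
               {t} {t′} {t″} {π} {σ} {τ} e e′ e″ c)))
      (comparable? (π ∷ σ ∷ τ ∷ [])) (someChain? t t′ t″)

-- The formulas with denominators cleared

chains-identity : ∀ u v q T b b₃ b₆ → 420 * u * v * T ≡ q * (b * (b₃ * b₆)) →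
                  T * (420 * u * v * b ^ 2) ≡ q * b₃ * b₆ * (b * (b * b))
chains-identity u v q T b b₃ b₆ eq = begin
  T * (420 * u * v * b ^ 2)            ≡⟨ cong (λ i → T * (420 * u * v * (b * i))) (*-identityʳ b) ⟩
  T * (420 * u * v * (b * b))          ≡⟨ before u v T b ⟩
  420 * u * v * T * (b * b)            ≡⟨ cong (_* (b * b)) eq ⟩
  q * (b * (b₃ * b₆)) * (b * b)        ≡⟨ after q b b₃ b₆ ⟩
  q * b₃ * b₆ * (b * (b * b))          ∎
  where
  open ≡-Reasoning
  before : ∀ u v T b → T * (420 * u * v * (b * b)) ≡ 420 * u * v * T * (b * b)
  before = solve-∀
  after : ∀ q b b₃ b₆ → q * (b * (b₃ * b₆)) * (b * b) ≡ q * b₃ * b₆ * (b * (b * b))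
  after = solve-∀

-- The relation C = 6T - 6P + b is multiplied by 70uv: 6 · 70 = 420 fits the formula for T, 6 · 70 =
-- 42 · 10 the one for P, and the diagonal term b contributes 70uv. The negative term stands on the
-- left to stay within ℕ.
comparable-identity : ∀ u v q C P T b b₂ b₃ b₆ →
  6 * T + b ≡ C + 6 * P → 10 * P ≡ b * b₂ → 420 * u * v * T ≡ q * (b * (b₃ * b₆)) →
  C * (70 * u * v * b ^ 2) + 42 * u * v * b₂ * (b * (b * b)) ≡ (q * b₃ * b₆ + 70 * u * v) * (b * (b * b))
comparable-identity u v q C P T b b₂ b₃ b₆ eqC eqP eqT = begin
  C * (70 * u * v * b ^ 2) + 42 * u * v * b₂ * (b * (b * b))
    ≡⟨ cong (λ i → C * (70 * u * v * (b * i)) + 42 * u * v * b₂ * (b * (b * b))) (*-identityʳ b) ⟩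
  C * (70 * u * v * (b * b)) + 42 * u * v * b₂ * (b * (b * b))
    ≡⟨ e₁ u v C b b₂ ⟩
  (70 * u * v * C + 42 * u * v * (b * b₂)) * (b * b)
    ≡⟨ cong (λ i → (70 * u * v * C + 42 * u * v * i) * (b * b)) eqP ⟨
  (70 * u * v * C + 42 * u * v * (10 * P)) * (b * b)
    ≡⟨ e₂ u v C P b ⟩
  70 * u * v * (C + 6 * P) * (b * b)
    ≡⟨ cong (λ i → 70 * u * v * i * (b * b)) eqC ⟨
  70 * u * v * (6 * T + b) * (b * b)
    ≡⟨ e₃ u v T b ⟩
  (420 * u * v * T + 70 * u * v * b) * (b * b)
    ≡⟨ cong (λ i → (i + 70 * u * v * b) * (b * b)) eqT ⟩
  (q * (b * (b₃ * b₆)) + 70 * u * v * b) * (b * b)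
    ≡⟨ e₄ u v q b b₃ b₆ ⟩
  (q * b₃ * b₆ + 70 * u * v) * (b * (b * b))
    ∎
  where
  open ≡-Reasoning
  e₁ : ∀ u v C b b₂ → C * (70 * u * v * (b * b)) + 42 * u * v * b₂ * (b * (b * b)) ≡
                      (70 * u * v * C + 42 * u * v * (b * b₂)) * (b * b)
  e₁ = solve-∀
  e₂ : ∀ u v C P b → (70 * u * v * C + 42 * u * v * (10 * P)) * (b * b) ≡ 70 * u * v * (C + 6 * P) * (b * b)
  e₂ = solve-∀
  e₃ : ∀ u v T b → 70 * u * v * (6 * T + b) * (b * b) ≡ (420 * u * v * T + 70 * u * v * b) * (b * b)
  e₃ = solve-∀
  e₄ : ∀ u v q b b₃ b₆ → (q * (b * (b₃ * b₆)) + 70 * u * v * b) * (b * b) ≡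
                         (q * b₃ * b₆ + 70 * u * v) * (b * (b * b))
  e₄ = solve-∀

module _ {k n : ℕ} (2+k≡n : 2 + k ≡ n) where

  𝔟-+≡h : ∀ j → 𝔟 (n + j) ≡ h 3 (k + j)
  𝔟-+≡h j = 𝔟≡h (cong (λ i → i + j) 2+k≡n)

  pairs-𝔟 : 10 * 1+shift (h 6) k ≡ 𝔟 n * 𝔟 (n + 2)
  pairs-𝔟 = trans (pairs-closed k) (sym (cong₂ _*_ (𝔟≡h 2+k≡n) (𝔟-+≡h 2)))

  triples-𝔟 : 420 * (n + 6) * (n + 7) * 1+shift (1+shift (h 9)) k ≡
              (n ^ 2 + 4 * n + 6) * (𝔟 n * (𝔟 (n + 3) * 𝔟 (n + 6)))
  triples-𝔟 = begin
    420 * (n + 6) * (n + 7) * T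
      ≡⟨ cong₂ (λ i j → 420 * i * j * T) n+6≡k+8 n+7≡k+9 ⟩
    420 * (k + 8) * (k + 9) * T
      ≡⟨ triples-closed k ⟩
    (k * k + 8 * k + 18) * (h 3 k * (h 3 (k + 3) * h 3 (k + 6)))
      ≡⟨ cong₂ _*_ quadratic (cong₂ _*_ (𝔟≡h 2+k≡n) (cong₂ _*_ (𝔟-+≡h 3) (𝔟-+≡h 6))) ⟨
    (n ^ 2 + 4 * n + 6) * (𝔟 n * (𝔟 (n + 3) * 𝔟 (n + 6)))
      ∎
    where
    open ≡-Reasoning
    T = 1+shift (1+shift (h 9)) k
    n+6≡k+8 : n + 6 ≡ k + 8
    n+6≡k+8 = trans (cong (λ i → i + 6) (sym 2+k≡n)) (lemma k)
      where
      lemma : ∀ k → 2 + k + 6 ≡ k + 8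
      lemma = solve-∀
    n+7≡k+9 : n + 7 ≡ k + 9
    n+7≡k+9 = trans (cong (λ i → i + 7) (sym 2+k≡n)) (lemma k)
      where
      lemma : ∀ k → 2 + k + 7 ≡ k + 9
      lemma = solve-∀
    quadratic : n ^ 2 + 4 * n + 6 ≡ k * k + 8 * k + 18
    quadratic = trans (cong (λ i → n * i + 4 * n + 6) (*-identityʳ n))
      (trans (cong (λ i → i * i + 4 * i + 6) (sym 2+k≡n)) (lemma k))
      where
      lemma : ∀ k → (2 + k) * (2 + k) + 4 * (2 + k) + 6 ≡ k * k + 8 * k + 18
      lemma = solve-∀

-- Passage to integers and rationals

open import Data.Integer.Base using (ℤ; +_) renaming (_+_ to _+ℤ_; _-_ to _-ℤ_; _*_ to _*ℤ_)
import Data.Integer.Properties as ℤ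
import Data.Integer.Tactic.RingSolver as ℤ-Solver

/-cross : ∀ {p q : ℤ} {d e : ℕ} .{{_ : NonZero d}} .{{_ : NonZero e}} →
          p *ℤ + e ≡ q *ℤ + d → p / d ≡ q / e
/-cross {p} {q} {suc d} {suc e} eq = ℚ.fromℚᵘ-cong {mkℚᵘ p d} {mkℚᵘ q e} (*≡* eq)

-- The numerator of the first formula contains a genuine subtraction; only here is the term b l
-- brought back to its side.
ℤ-cross : ∀ {c d a b e l} → c * d + b * l ≡ (a + e) * l →
          + c *ℤ + d ≡ (+ a -ℤ + b +ℤ + e) *ℤ + l
ℤ-cross {c} {d} {a} {b} {e} {l} eq = begin
  + c *ℤ + d                                       ≡⟨ isolate (+ c) (+ d) (+ b) (+ l) ⟩
  (+ c *ℤ + d +ℤ + b *ℤ + l) -ℤ + b *ℤ + l         ≡⟨ cong (_-ℤ + b *ℤ + l) cast ⟩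
  (+ a +ℤ + e) *ℤ + l -ℤ + b *ℤ + l                ≡⟨ collect (+ a) (+ b) (+ e) (+ l) ⟩
  (+ a -ℤ + b +ℤ + e) *ℤ + l                       ∎
  where
  open ≡-Reasoning
  isolate : ∀ c d b l → c *ℤ d ≡ (c *ℤ d +ℤ b *ℤ l) -ℤ b *ℤ l
  isolate = ℤ-Solver.solve-∀
  collect : ∀ a b e l → (a +ℤ e) *ℤ l -ℤ b *ℤ l ≡ (a -ℤ b +ℤ e) *ℤ l
  collect = ℤ-Solver.solve-∀
  cast : + c *ℤ + d +ℤ + b *ℤ + l ≡ (+ a +ℤ + e) *ℤ + l
  cast = begin
    + c *ℤ + d +ℤ + b *ℤ + l      ≡⟨ cong₂ _+ℤ_ (ℤ.pos-* c d) (ℤ.pos-* b l) ⟨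
    + (c * d) +ℤ + (b * l)        ≡⟨ ℤ.pos-+ (c * d) (b * l) ⟨
    + (c * d + b * l)             ≡⟨ cong +_ eq ⟩
    + ((a + e) * l)               ≡⟨ ℤ.pos-* (a + e) l ⟩
    + (a + e) *ℤ + l              ≡⟨ cong (_*ℤ + l) (ℤ.pos-+ a e) ⟩
    (+ a +ℤ + e) *ℤ + l           ∎

-- The summand without 𝔟 in the first numerator is 70(n+6)(n+7), where the English formula has
-- 420(n+6)(n+7). For n = 2 there is a single bigrassmannian permutation, so the probability is 1;
-- the first two terms cancel, and the constant 70 gives 1 whereas 420 would give 6.
theorem1p6 : ∀ n (2≤n : n ≥ 2) →
    (p₃ n 2≤n ≡
    _/_ (+ ((n ^ 2 + 4 * n + 6) * 𝔟 (n + 3) * 𝔟 (n + 6))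
    -ℤ + (42 * (n + 6) * (n + 7) * 𝔟 (n + 2))
    +ℤ + (70 * (n + 6) * (n + 7)))
    (70 * (n + 6) * (n + 7) * 𝔟 n ^ 2)
    {{denominator-nonZero 70 2≤n}})
    ×
    (p₃≤ n 2≤n ≡
    _/_ (+ ((n ^ 2 + 4 * n + 6) * 𝔟 (n + 3) * 𝔟 (n + 6)))
    (420 * (n + 6) * (n + 7) * 𝔟 n ^ 2)
    {{denominator-nonZero 420 2≤n}})
theorem1p6 n 2≤n =
  /-cross {+ c} {+ a -ℤ + b +ℤ + e} {d} {70 * (n + 6) * (n + 7) * 𝔟 n ^ 2}
    {{𝔅³-nonZero 2≤n}} {{denominator-nonZero 70 2≤n}}
    (ℤ-cross {c} {70 * (n + 6) * (n + 7) * 𝔟 n ^ 2} {a} {b} {e} {d} C-cross) ,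
  /-cross {+ t} {+ a} {d} {420 * (n + 6) * (n + 7) * 𝔟 n ^ 2}
    {{𝔅³-nonZero 2≤n}} {{denominator-nonZero 420 2≤n}}
    (trans (sym (ℤ.pos-* t (420 * (n + 6) * (n + 7) * 𝔟 n ^ 2))) (trans (cong +_ T-cross) (ℤ.pos-* a d)))
  where
  k : ℕ
  k = proj₁ (m≤n⇒∃[o]m+o≡n 2≤n)
  2+k≡n : 2 + k ≡ n
  2+k≡n = proj₂ (m≤n⇒∃[o]m+o≡n 2≤n)
  c t a b e d : ℕ
  c = length (filter (λ (π , σ , τ) → comparable? (π ∷ σ ∷ τ ∷ [])) (𝔅³ n))
  t = length (filter (λ (π , σ , τ) → (π ≤ᴮ? σ) ×-dec (σ ≤ᴮ? τ)) (𝔅³ n))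
  a = (n ^ 2 + 4 * n + 6) * 𝔟 (n + 3) * 𝔟 (n + 6)
  b = 42 * (n + 6) * (n + 7) * 𝔟 (n + 2)
  e = 70 * (n + 6) * (n + 7)
  d = length (𝔅³ n)
  C-cross : c * (70 * (n + 6) * (n + 7) * 𝔟 n ^ 2) + b * d ≡ (a + e) * d
  C-cross = subst (λ l → c * (70 * (n + 6) * (n + 7) * 𝔟 n ^ 2) + b * l ≡ (a + e) * l) (sym (length-𝔅³ n))
    (comparable-identity (n + 6) (n + 7) (n ^ 2 + 4 * n + 6) c (1+shift (h 6) k) (1+shift (1+shift (h 9)) k)
      (𝔟 n) (𝔟 (n + 2)) (𝔟 (n + 3)) (𝔟 (n + 6))
      (trans (cong (λ i → 6 * 1+shift (1+shift (h 9)) k + i) (𝔟≡h 2+k≡n)) (∣comparable∣ 2+k≡n))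
      (pairs-𝔟 2+k≡n) (triples-𝔟 2+k≡n))
  T-cross : t * (420 * (n + 6) * (n + 7) * 𝔟 n ^ 2) ≡ a * d
  T-cross = subst (λ l → t * (420 * (n + 6) * (n + 7) * 𝔟 n ^ 2) ≡ a * l) (sym (length-𝔅³ n))
    (chains-identity (n + 6) (n + 7) (n ^ 2 + 4 * n + 6) t (𝔟 n) (𝔟 (n + 3)) (𝔟 (n + 6))
      (trans (cong (λ i → 420 * (n + 6) * (n + 7) * i) (∣chains∣ 2+k≡n)) (triples-𝔟 2+k≡n)))
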